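{- Let $A$ be a finite alphabet of colors and $I$ a sentence over $A$ of size $n$. Then $$F_I=\sum_K L^{ -1}_{I,K}\,\mathfrak{S}^*_K,\qquad L^{ -1}_{I,K}=\sum_{\mathcal{P}}(-1)^{\ell(\mathcal{P})}\,prod(\mathcal{P}),$$ where the first sum runs over all sentences $K$ reachable from $I$ in the colored immaculate descent graph $\mathfrak{D}^n_A$ (including $K=I$ via the empty path) and the second over all directed paths $\mathcal{P}$ from $I$ to $K$ in $\mathfrak{D}^n_A$.
   Context: Words over $A$ are finite sequences of colors; a sentence is a finite sequence $I=(w_1,\dots,w_k)$ of nonempty words; $|I|$ = number of letters, $w(I)=w_1\cdots w_k$; $J\preceq I$ means $w(J)=w(I)$ and $I$ arises from $J$ by concatenating adjacent words. Let $x_{a,i}$ ($a\in A$, $i\ge1$) be variables subject only to $x_{a,i}x_{b,j}=x_{b,j}x_{a,i}$ for $i\ne j$; $x_{w,i}=x_{c_1,i}\cdots x_{c_r,i}$ for $w=c_1\cdots c_r$, $x_{\emptyset,i}=1$; $M_I=\sum_{j_1<\dots<j_k}x_{w_1,j_1}\cdots x_{w_k,j_k}$, $F_I=\sum_{J\preceq I}M_J$. For $J=(w_1,\dots,w_k)$ the colored composition diagram has $k$ left-justified rows (row 1 on top), row $i$ with $|w_i|$ boxes colored in order by the letters of $w_i$. A colored immaculate tableau (CIT) of shape $J$ fills the boxes with positive integers weakly increasing left to right in rows and strictly increasing top to bottom in the first column; its type is $(u_1,\dots,u_m)$, $u_i$ the colors of boxes containing $i$ read from lowest row to highest and left to right within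 rows; $x_T=x_{u_1,1}\cdots x_{u_m,m}$; $\mathfrak{S}^*_J=\sum_T x_T$ over CIT of shape $J$. A standard CIT (SCIT) of size $n$ has entries $1,\dots,n$ each once; descent at $i$ if $i+1$ is in a strictly lower row than $i$; $co_A(U)$ is the sentence obtained by reading colors in order of entries and starting a new word after each descent. $L_{I,J}$ = number of SCIT of shape $I$ with $co_A=J$. The colored immaculate descent graph $\mathfrak{D}^n_A$ is the edge-weighted directed simple graph whose vertices are the sentences over $A$ of size $n$, with an edge $I\to J$ (for $J\neq I$) whenever some SCIT of shape $I$ has colored descent composition $J$, weighted by $L_{I,J}$. For a directed path $\mathcal{P}$, $\ell(\mathcal{P})$ is its number of edges and $prod(\mathcal{P})$ the product of its edge weights, with the empty path having $\ell=0$ and $prod=1$. $K$ is reachable from $I$ if there is a directed path from $I$ to $K$. -}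

module Defs where

open import Data.Nat using (ℕ; zero; suc; _+_; _*_; _∸_; _<ᵇ_; _≤_; _<_; _⊔_; _≤?_; _<?_)
import Data.Nat.Properties as ℕP
open import Data.Fin using (Fin)
import Data.Fin.Properties as FinP
open import Data.Bool using (Bool; true; false; if_then_else_)
open import Data.Maybe using (Maybe; just; nothing)
open import Data.Product using (_×_; _,_; proj₁; proj₂)
open import Data.List using (List; []; _∷_; _++_; [_]; map; concat; concatMap; length;
  filter; upTo; allFin; foldr; zip; reverse; mapMaybe; take; applyUpTo)
import Data.List.Properties as ListP
open import Data.Nat.ListAction using (sum)
open import Data.List.Relation.Unary.All using (All; all?)
open import Data.List.Relation.Unary.Linked using (Linked; linked?)
open import Data.List.Relation.Unary.AllPairs using (AllPairs; allPairs?)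
open import Data.Integer as ℤ using (ℤ)
open import Relation.Nullary using (¬_; Dec; yes; no; ¬?; _×-dec_)
open import Relation.Binary.PropositionalEquality using (_≡_; _≢_; refl)
open import Relation.Binary.Definitions using (DecidableEquality)
open import Relation.Unary using (Decidable)

Word : ℕ → Set
Word a = List (Fin a)

-- a sentence is a list of words; it must additionally satisfy IsSentence
Sent : ℕ → Set
Sent a = List (Word a)

NonEmpty : {X : Set} → List X → Set
NonEmpty xs = 1 ≤ length xs

IsSentence : {a : ℕ} → Sent a → Set
IsSentence I = All NonEmpty I

size : {a : ℕ} → Sent a → ℕ
size I = sum (map length I)

word-≟ : {a : ℕ} → DecidableEquality (Word a)
word-≟ = ListP.≡-dec FinP._≟_

sent-≟ : {a : ℕ} → DecidableEquality (Sent a)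
sent-≟ = ListP.≡-dec word-≟

count : {X : Set} {P : X → Set} → Decidable P → List X → ℕ
count P? xs = length (filter P? xs)

listsOf : {X : Set} → ℕ → List X → List (List X)
listsOf zero    xs = [] ∷ []
listsOf (suc k) xs = concatMap (λ x → map (x ∷_) (listsOf k xs)) xs

choices : {X : Set} → List (List X) → List (List X)
choices []         = [] ∷ []
choices (xs ∷ xss) = concatMap (λ x → map (x ∷_) (choices xss)) xs

splits : {X : Set} → List X → List (List (List X))
splits []       = [] ∷ []
splits (x ∷ xs) = concatMap (λ bs → ext bs) (splits xs)
  where
  ext : _ → _
  ext []        = ((x ∷ []) ∷ []) ∷ []
  ext (b ∷ bs)  = ((x ∷ []) ∷ b ∷ bs) ∷ ((x ∷ b) ∷ bs) ∷ []

range1 : ℕ → List ℕ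
range1 m = map suc (upTo m)

sumℤ : List ℤ → ℤ
sumℤ = foldr ℤ._+_ (ℤ.+ 0)

-- all sentences of size n over Fin a (each exactly once): a word of length
-- n together with a cut of it into nonempty consecutive words
sentencesOf : (a n : ℕ) → List (Sent a)
sentencesOf a n = concatMap splits (listsOf n (allFin a))

-- Monomials in the variables x_{c,i} subject only to
-- x_{c,i} x_{d,j} = x_{d,j} x_{c,i} for i ≢ j.
-- A monomial is written as a product of variables, i.e. a list of pairs
-- (i , c) standing for x_{c,i}.  Two such products are equal in the
-- partially commutative monoid iff for every index i the subwords of
-- colors carrying index i coincide.

Mon : ℕ → Set
Mon a = List (ℕ × Fin a)

atIndex : {a : ℕ} → Mon a → ℕ → Word a
atIndex m i = map proj₂ (filter (λ p → proj₁ p ℕP.≟ i) m)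

maxIdx : {a : ℕ} → Mon a → ℕ
maxIdx m = foldr (λ p r → proj₁ p ⊔ r) 0 m

-- equality of monomials (beyond both maximal indices both sides are empty)
MonEq : {a : ℕ} → Mon a → Mon a → Set
MonEq m₁ m₂ = All (λ i → atIndex m₁ i ≡ atIndex m₂ i) (upTo (suc (maxIdx m₁ ⊔ maxIdx m₂)))

monEq? : {a : ℕ} (m₂ : Mon a) → Decidable (λ m₁ → MonEq m₁ m₂)
monEq? m₂ m₁ = all? (λ i → word-≟ (atIndex m₁ i) (atIndex m₂ i)) _

xw : {a : ℕ} → Word a → ℕ → Mon a
xw w i = map (λ c → (i , c)) w

typeMonFrom : {a : ℕ} → ℕ → List (Word a) → Mon a
typeMonFrom i []       = []
typeMonFrom i (u ∷ U)  = xw u i ++ typeMonFrom (suc i) U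

typeMon : {a : ℕ} → List (Word a) → Mon a
typeMon = typeMonFrom 1

-- The coefficient of a series at the monomial x_U (U an arbitrary list of
-- words, read as x_{u_1,1}...x_{u_m,m}) is the number of terms of the
-- defining sum whose monomial equals x_U.  Terms using an index > m = |U|
-- (as list) carry a nonempty word at that index and can never equal x_U,
-- so only indices in 1..m are enumerated.

Mterm : {a : ℕ} → Sent a → List ℕ → Mon a
Mterm []       js       = []
Mterm (w ∷ J)  []       = []
Mterm (w ∷ J)  (j ∷ js) = xw w j ++ Mterm J js

coeffM : {a : ℕ} → Sent a → List (Word a) → ℕ
coeffM J U =
  count (λ js → monEq? (typeMon U) (Mterm J js))
    (filter (linked? _<?_) (listsOf (length J) (range1 (length U))))

_⪯_ : {a : ℕ} → Sent a → Sent a → Set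
J ⪯ I = Data.List.Relation.Unary.Any.Any (λ bs → map concat bs ≡ I) (splits J)
  where import Data.List.Relation.Unary.Any

⪯? : {a : ℕ} (I : Sent a) → Decidable (λ J → J ⪯ I)
⪯? I J = Data.List.Relation.Unary.Any.any? (λ bs → sent-≟ (map concat bs) I) (splits J)
  where import Data.List.Relation.Unary.Any

coeffF : {a : ℕ} → Sent a → List (Word a) → ℕ
coeffF {a} I U = sum (map (λ J → coeffM J U) (filter (⪯? I) (sentencesOf a (size I))))

-- Colored immaculate tableaux.  A filling of shape J is a list of rows of
-- positive integers, row i having |w_i| entries (row 1 first = top).

Filling : Set
Filling = List (List ℕ)

fillings : {a : ℕ} → Sent a → ℕ → List Filling
fillings J m = choices (map (λ w → listsOf (length w) (range1 m)) J)

IsCIT : Filling → Set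
IsCIT T = All (Linked _≤_) T × Linked _<_ (concatMap (take 1) T)

isCIT? : Decidable IsCIT
isCIT? T = all? (linked? _≤?_) T ×-dec linked? _<?_ (concatMap (take 1) T)

rowCells : {a : ℕ} → Sent a → Filling → List (List (ℕ × Fin a))
rowCells []       _        = []
rowCells (w ∷ J)  []       = []
rowCells (w ∷ J)  (t ∷ T)  = zip t w ∷ rowCells J T

readingCells : {a : ℕ} → Sent a → Filling → List (ℕ × Fin a)
readingCells J T = concat (reverse (rowCells J T))

uAt : {a : ℕ} → Sent a → Filling → ℕ → Word a
uAt J T i = map proj₂ (filter (λ p → proj₁ p ℕP.≟ i) (readingCells J T))

maxEntry : Filling → ℕ
maxEntry T = foldr _⊔_ 0 (concat T)

typeOf : {a : ℕ} → Sent a → Filling → List (Word a)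
typeOf J T = map (uAt J T) (range1 (maxEntry T))

xT : {a : ℕ} → Sent a → Filling → Mon a
xT J T = typeMon (typeOf J T)

coeffS : {a : ℕ} → Sent a → List (Word a) → ℕ
coeffS J U =
  count (λ T → monEq? (typeMon U) (xT J T))
    (filter isCIT? (fillings J (length U)))

IsStandard : ℕ → Filling → Set
IsStandard n T = All (λ i → count (λ e → e ℕP.≟ i) (concat T) ≡ 1) (range1 n)

isStandard? : (n : ℕ) → Decidable (IsStandard n)
isStandard? n T = all? (λ i → count (λ e → e ℕP.≟ i) (concat T) ℕP.≟ 1) (range1 n)

scits : {a : ℕ} → Sent a → List Filling
scits I = filter (isStandard? (size I)) (filter isCIT? (fillings I (size I)))

rowIdxFrom : ℕ → Filling → List (ℕ × ℕ)
rowIdxFrom r []       = []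
rowIdxFrom r (t ∷ T)  = map (λ e → (r , e)) t ++ rowIdxFrom (suc r) T

rowOf : Filling → ℕ → Maybe ℕ
rowOf T e = go (rowIdxFrom 1 T)
  where
  go : List (ℕ × ℕ) → Maybe ℕ
  go []             = nothing
  go ((r , e') ∷ xs) with e' ℕP.≟ e
  ... | yes _ = just r
  ... | no  _ = go xs

colorOf : {a : ℕ} → Sent a → Filling → ℕ → Maybe (Fin a)
colorOf J T e = go (concat (rowCells J T))
  where
  go : List (ℕ × Fin _) → Maybe (Fin _)
  go []              = nothing
  go ((e' , c) ∷ xs) with e' ℕP.≟ e
  ... | yes _ = just c
  ... | no  _ = go xs

isDescent : Filling → ℕ → Bool
isDescent T i with rowOf T i | rowOf T (suc i)
... | just r | just r' = r <ᵇ r'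
... | _      | _       = false

cutAt : {a : ℕ} → List (Fin a × Bool) → Sent a
cutAt []                 = []
cutAt ((c , true)  ∷ xs) = (c ∷ []) ∷ cutAt xs
cutAt ((c , false) ∷ xs) with cutAt xs
... | []      = (c ∷ []) ∷ []
... | w ∷ ws  = (c ∷ w) ∷ ws

coA : {a : ℕ} → Sent a → Filling → Sent a
coA I T = cutAt (mapMaybe step (range1 (size I)))
  where
  step : ℕ → Maybe (Fin _ × Bool)
  step i with colorOf I T i
  ... | just c  = just (c , isDescent T i)
  ... | nothing = nothing

L : {a : ℕ} → Sent a → Sent a → ℕ
L I J = count (λ T → sent-≟ (coA I T) J) (scits I)

-- The colored immaculate descent graph D^n_A: vertices the sentences of
-- size n, an edge I → J (J ≢ I) iff L_{I,J} ≢ 0, weighted by L_{I,J}.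

Edge : {a : ℕ} → Sent a → Sent a → Set
Edge I J = (J ≢ I) × (L I J ≢ 0)

edge? : {a : ℕ} (I J : Sent a) → Dec (Edge I J)
edge? I J = ¬? (sent-≟ J I) ×-dec ¬? (L I J ℕP.≟ 0)

IsPath : {a : ℕ} → ℕ → Sent a → Sent a → List (Sent a) → Set
IsPath {a} n I K p =
  All (λ v → Data.List.Membership.Propositional._∈_ v (sentencesOf a n)) p
  × (Data.List.head p ≡ just I)
  × (Data.List.last p ≡ just K)
  × Linked Edge p
  × AllPairs _≢_ p
  where import Data.List.Membership.Propositional
        import Data.List

isPath? : {a : ℕ} (n : ℕ) (I K : Sent a) → Decidable (IsPath n I K)
isPath? {a} n I K p =
  all? (λ v → Data.List.Membership.DecPropositional._∈?_ sent-≟ v (sentencesOf a n)) p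
  ×-dec Data.Maybe.Properties.≡-dec sent-≟ (Data.List.head p) (just I)
  ×-dec Data.Maybe.Properties.≡-dec sent-≟ (Data.List.last p) (just K)
  ×-dec linked? edge? p
  ×-dec allPairs? (λ u v → ¬? (sent-≟ u v)) p
  where import Data.List.Membership.DecPropositional
        import Data.Maybe.Properties
        import Data.List

-- all directed paths from I to K in D^n_A (a path without repeated vertices
-- has at most as many vertices as D^n_A)
paths : {a : ℕ} → ℕ → Sent a → Sent a → List (List (Sent a))
paths {a} n I K =
  filter (isPath? n I K)
    (concatMap (λ l → listsOf l (sentencesOf a n)) (range1 (length (sentencesOf a n))))

ℓ : {a : ℕ} → List (Sent a) → ℕ
ℓ p = length p ∸ 1

prodP : {a : ℕ} → List (Sent a) → ℕ
prodP []            = 1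
prodP (v ∷ [])      = 1
prodP (u ∷ v ∷ p)   = L u v * prodP (v ∷ p)

Linv : {a : ℕ} → ℕ → Sent a → Sent a → ℤ
Linv n I K = sumℤ (map (λ p → ((ℤ.- ℤ.+ 1) ℤ.^ ℓ p) ℤ.* ℤ.+ prodP p) (paths n I K))

Reachable : {a : ℕ} → ℕ → Sent a → Sent a → Set
Reachable n I K = Data.List.Relation.Unary.Any.Any (IsPath n I K) (paths n I K)
  where import Data.List.Relation.Unary.Any

reachable? : {a : ℕ} (n : ℕ) (I : Sent a) → Decidable (Reachable n I)
reachable? n I K = Data.List.Relation.Unary.Any.any? (isPath? n I K) (paths n I K)
  where import Data.List.Relation.Unary.Any

coeffRHS : {a : ℕ} → ℕ → Sent a → List (Word a) → ℤ
coeffRHS {a} n I U =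
  sumℤ (map (λ K → Linv n I K ℤ.* ℤ.+ coeffS K U)
            (filter (reachable? n I) (sentencesOf a n)))

{-# OPTIONS --safe #-}
-- A colored immaculate tableau of type U standardizes to a standard tableau S: the labels of S are grouped into blocks
-- by the words of U, and replacing each label by the index of its block recovers the tableau. A standard tableau arises
-- in this way exactly when it has no descent inside a block, that is, when U refines co_A(S). As the coefficient of F_J
-- at x_U is 1 if U refines J and 0 otherwise, this gives S*_I = Σ_J L_{I,J} F_J.
--
-- In a tableau of shape I and type J all entries 1 lie in the first row, so J = I or the sequence of word lengths of J is
-- lexicographically smaller than that of I. Hence L is unitriangular, the descent graph is acyclic, and L is inverted by
-- the alternating sum over its paths.
module Submission where

open import Defs
open import Data.Bool using (Bool; true; false; if_then_else_; T)
open import Data.Fin using (Fin)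
open import Data.Integer as ℤ using (ℤ; -1ℤ; 0ℤ; 1ℤ) renaming (_+_ to _+ᶻ_; _*_ to _*ᶻ_)
import Data.Integer.Properties as ℤP
open import Data.Integer.Tactic.RingSolver using (solve-∀)
open import Data.List using (List; []; _∷_; _++_; [_]; map; concat; concatMap; length; head; filter; upTo; applyUpTo; allFin; zip; reverse; mapMaybe;
  take; foldr)
import Data.List.Properties as ListP
open import Data.List.Membership.Propositional using (_∈_)
open import Data.List.Membership.Propositional.Properties
open import Data.List.Relation.Binary.Permutation.Propositional using (_↭_; ↭-sym; ↭-trans; ↭-refl)
import Data.List.Relation.Binary.Permutation.Propositional.Properties as Perm
open import Data.List.Relation.Binary.Pointwise using (Pointwise; []; _∷_)
open import Data.List.Relation.Unary.All as All using (All; []; _∷_)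
import Data.List.Relation.Unary.All.Properties as AllP
open import Data.List.Relation.Unary.AllPairs as AllPairs using (AllPairs; []; _∷_)
import Data.List.Relation.Unary.AllPairs.Properties as AllPairsP
open import Data.List.Relation.Unary.Any as Any using (Any; here; there)
open import Data.List.Relation.Unary.Linked as Linked using (Linked; []; [-]; _∷_)
import Data.List.Relation.Unary.Linked.Properties as LinkedP
open import Data.List.Relation.Unary.Unique.Propositional using (Unique)
import Data.List.Relation.Unary.Unique.Propositional.Properties as UniqueP
open import Data.Maybe using (Maybe; just; nothing)
import Data.Maybe.Properties as MaybeP
open import Data.Nat using (ℕ; zero; suc; pred; _+_; _*_; _∸_; _⊔_; _≤_; _<_; _<?_; _<ᵇ_; z≤n; s≤s; s≤s⁻¹; z<s)
open import Data.Nat.ListAction using (sum)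
import Data.Nat.Properties as ℕP
open import Data.Product using (∃-syntax; _×_; _,_; proj₁; proj₂; map₁)
open import Data.Sum using (_⊎_; inj₁; inj₂)
open import Function using (_∘_; id; _on_)
open import Relation.Binary.PropositionalEquality using (_≡_; _≢_; refl; sym; trans; cong; cong₂; subst; subst₂; module ≡-Reasoning)
open import Relation.Nullary using (¬_; Dec; yes; no; does; contradiction)
open import Relation.Nullary.Decidable using (dec-true; dec-false)
open import Relation.Unary using (Decidable)

-- The identity is compared coefficient by coefficient. For a fixed list of words U, possibly with
-- empty words, F and S* become integer vectors indexed by the sentences of size n, and the claim is
-- linear algebra for the matrix L. The delicate point is the count behind the expansion of S*.
-- Standardization is not handled as a pair of inverse functions; both sides are tied to one
-- relation, `Compatible`: block by block, the cells of S in reading order are the letters of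
-- `concat U` numbered 1, 2, and so on. It yields together that U is the type of the coarse tableau,
-- that S is standard, and that the labels of a block increase in reading order; for a standard
-- tableau the last property means that no block contains a descent. Numbers are then compared
-- through duplicate-free lists with the same members. Unitriangularity of L is read off from S*: a
-- nonzero L I J makes the coefficient of S*_I at x_J nonzero, and that coefficient counts tableaux
-- of type J. On the diagonal the other terms of the expansion vanish because a sentence never
-- refines one with lexicographically smaller word lengths.

-- Finite integer sums and indicators

∑ : {X : Set} → List X → (X → ℤ) → ℤ
∑ xs f = sumℤ (map f xs)

𝟙 : {P : Set} → Dec P → ℤ
𝟙 d = if does d then 1ℤ else 0ℤ

𝟙-yes : {P : Set} (d : Dec P) → P → 𝟙 d ≡ 1ℤ
𝟙-yes d p rewrite dec-true d p = refl

𝟙-no : {P : Set} (d : Dec P) → ¬ P → 𝟙 d ≡ 0ℤ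
𝟙-no d ¬p rewrite dec-false d ¬p = refl

𝟙-cong : {P Q : Set} (d : Dec P) (e : Dec Q) → (P → Q) → (Q → P) → 𝟙 d ≡ 𝟙 e
𝟙-cong (yes p) e f g = sym (𝟙-yes e (f p))
𝟙-cong (no ¬p) e f g = sym (𝟙-no e (¬p ∘ g))

module _ {X : Set} where

  ∑-cong : (xs : List X) {f g : X → ℤ} → (∀ x → x ∈ xs → f x ≡ g x) → ∑ xs f ≡ ∑ xs g
  ∑-cong []       h = refl
  ∑-cong (x ∷ xs) h = cong₂ _+ᶻ_ (h x (here refl)) (∑-cong xs (λ y → h y ∘ there))

  ∑-+ : (xs : List X) (f g : X → ℤ) → ∑ xs (λ x → f x +ᶻ g x) ≡ ∑ xs f +ᶻ ∑ xs g
  ∑-+ []       f g = refl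
  ∑-+ (x ∷ xs) f g = trans (cong (f x +ᶻ g x +ᶻ_) (∑-+ xs f g)) (lemma (f x) (g x) _ _)
    where
    open ≡-Reasoning
    lemma : ∀ a b c d → (a +ᶻ b) +ᶻ (c +ᶻ d) ≡ (a +ᶻ c) +ᶻ (b +ᶻ d)
    lemma a b c d = begin
      (a +ᶻ b) +ᶻ (c +ᶻ d)  ≡⟨ ℤP.+-assoc a b _ ⟩
      a +ᶻ (b +ᶻ (c +ᶻ d))  ≡⟨ cong (a +ᶻ_) (sym (ℤP.+-assoc b c d)) ⟩
      a +ᶻ ((b +ᶻ c) +ᶻ d)  ≡⟨ cong (λ e → a +ᶻ (e +ᶻ d)) (ℤP.+-comm b c) ⟩
      a +ᶻ ((c +ᶻ b) +ᶻ d)  ≡⟨ cong (a +ᶻ_) (ℤP.+-assoc c b d) ⟩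
      a +ᶻ (c +ᶻ (b +ᶻ d))  ≡⟨ sym (ℤP.+-assoc a c _) ⟩
      (a +ᶻ c) +ᶻ (b +ᶻ d)  ∎

  ∑-*ˡ : (xs : List X) (c : ℤ) (f : X → ℤ) → ∑ xs (λ x → c *ᶻ f x) ≡ c *ᶻ ∑ xs f
  ∑-*ˡ []       c f = sym (ℤP.*-zeroʳ c)
  ∑-*ˡ (x ∷ xs) c f =
    trans (cong (c *ᶻ f x +ᶻ_) (∑-*ˡ xs c f)) (sym (ℤP.*-distribˡ-+ c (f x) _))

  ∑-*ʳ : (xs : List X) (c : ℤ) (f : X → ℤ) → ∑ xs (λ x → f x *ᶻ c) ≡ ∑ xs f *ᶻ c
  ∑-*ʳ xs c f = begin
    ∑ xs (λ x → f x *ᶻ c)  ≡⟨ ∑-cong xs (λ x _ → ℤP.*-comm (f x) c) ⟩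
    ∑ xs (λ x → c *ᶻ f x)  ≡⟨ ∑-*ˡ xs c f ⟩
    c *ᶻ ∑ xs f            ≡⟨ ℤP.*-comm c _ ⟩
    ∑ xs f *ᶻ c            ∎
    where open ≡-Reasoning

  ∑-zero : (xs : List X) {f : X → ℤ} → (∀ x → x ∈ xs → f x ≡ 0ℤ) → ∑ xs f ≡ 0ℤ
  ∑-zero []       h = refl
  ∑-zero (x ∷ xs) h = cong₂ _+ᶻ_ (h x (here refl)) (∑-zero xs (λ y → h y ∘ there))

  ∑-++ : (xs ys : List X) (f : X → ℤ) → ∑ (xs ++ ys) f ≡ ∑ xs f +ᶻ ∑ ys f
  ∑-++ []       ys f = sym (ℤP.+-identityˡ _)
  ∑-++ (x ∷ xs) ys f = trans (cong (f x +ᶻ_) (∑-++ xs ys f)) (sym (ℤP.+-assoc (f x) _ _))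

  ∑-filter : {P : X → Set} (P? : Decidable P) (xs : List X) (f : X → ℤ) →
    ∑ (filter P? xs) f ≡ ∑ xs (λ x → 𝟙 (P? x) *ᶻ f x)
  ∑-filter P? []       f = refl
  ∑-filter P? (x ∷ xs) f with P? x
  ... | yes _ = cong₂ _+ᶻ_ (sym (ℤP.*-identityˡ (f x))) (∑-filter P? xs f)
  ... | no  _ = trans (∑-filter P? xs f) (sym (ℤP.+-identityˡ _))

  ∑-1 : (xs : List X) → ∑ xs (λ _ → 1ℤ) ≡ ℤ.+ length xs
  ∑-1 []       = refl
  ∑-1 (x ∷ xs) = cong (1ℤ +ᶻ_) (∑-1 xs)

  count-∑ : {P : X → Set} (P? : Decidable P) (xs : List X) →
    ℤ.+ count P? xs ≡ ∑ xs (λ x → 𝟙 (P? x))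
  count-∑ P? xs = begin
    ℤ.+ count P? xs                  ≡⟨ ∑-1 (filter P? xs) ⟨
    ∑ (filter P? xs) (λ _ → 1ℤ)      ≡⟨ ∑-filter P? xs _ ⟩
    ∑ xs (λ x → 𝟙 (P? x) *ᶻ 1ℤ)     ≡⟨ ∑-cong xs (λ x _ → ℤP.*-identityʳ _) ⟩
    ∑ xs (λ x → 𝟙 (P? x))            ∎
    where open ≡-Reasoning

  sum-∑ : (f : X → ℕ) (xs : List X) → ℤ.+ sum (map f xs) ≡ ∑ xs (λ x → ℤ.+ f x)
  sum-∑ f []       = refl
  sum-∑ f (x ∷ xs) = cong (ℤ.+ f x +ᶻ_) (sum-∑ f xs)

  ∑-single : {xs : List X} {x : X} (f : X → ℤ) → Unique xs → x ∈ xs →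
    (∀ y → y ∈ xs → y ≢ x → f y ≡ 0ℤ) → ∑ xs f ≡ f x
  ∑-single f (x≢ ∷ u) (here refl) h =
    trans (cong (f _ +ᶻ_) (∑-zero _ (λ y y∈ → h y (there y∈) (λ e → All.lookup x≢ y∈ (sym e)))))
          (ℤP.+-identityʳ _)
  ∑-single f (x≢ ∷ u) (there x∈) h =
    trans (cong₂ _+ᶻ_ (h _ (here refl) (All.lookup x≢ x∈)) (∑-single f u x∈ (λ y → h y ∘ there)))
          (ℤP.+-identityˡ _)

∑-map : {X Y : Set} (g : X → Y) (xs : List X) (f : Y → ℤ) → ∑ (map g xs) f ≡ ∑ xs (f ∘ g)
∑-map g xs f = cong sumℤ (sym (ListP.map-∘ xs))

∑-concatMap : {X Y : Set} (g : X → List Y) (xs : List X) (f : Y → ℤ) →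
  ∑ (concatMap g xs) f ≡ ∑ xs (λ x → ∑ (g x) f)
∑-concatMap g []       f = refl
∑-concatMap g (x ∷ xs) f =
  trans (∑-++ (g x) (concatMap g xs) f) (cong (∑ (g x) f +ᶻ_) (∑-concatMap g xs f))

∑-comm : {X Y : Set} (xs : List X) (ys : List Y) (f : X → Y → ℤ) →
  ∑ xs (λ x → ∑ ys (f x)) ≡ ∑ ys (λ y → ∑ xs (λ x → f x y))
∑-comm []       ys f = sym (∑-zero ys (λ _ _ → refl))
∑-comm (x ∷ xs) ys f =
  trans (cong (∑ ys (f x) +ᶻ_) (∑-comm xs ys f)) (sym (∑-+ ys (f x) _))

-- Enumerations

-- Pigeonhole, by deleting from `ys` one occurrence of each member of `xs`. It bounds the length of
-- paths, and used in both directions it replaces explicit bijections in counting.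
length-⊆ : {X : Set} {xs ys : List X} → Unique xs → (∀ {x} → x ∈ xs → x ∈ ys) →
  length xs ≤ length ys
length-⊆ {xs = []}     u sub = z≤n
length-⊆ {xs = x ∷ xs} (x≢ ∷ u) sub with ∈-∃++ (sub (here refl))
... | as , bs , refl = subst (suc (length xs) ≤_) (sym len) (s≤s (length-⊆ u sub′))
  where
  len : length (as ++ x ∷ bs) ≡ suc (length (as ++ bs))
  len = trans (ListP.length-++ as) (trans (ℕP.+-suc (length as) _) (cong suc (sym (ListP.length-++ as))))
  sub′ : ∀ {y} → y ∈ xs → y ∈ as ++ bs
  sub′ y∈ with ∈-++⁻ as (sub (there y∈))
  ... | inj₁ p           = ∈-++⁺ˡ p
  ... | inj₂ (here refl) = contradiction refl (All.lookup x≢ y∈)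
  ... | inj₂ (there p)   = ∈-++⁺ʳ as p

length-≡ : {X : Set} {xs ys : List X} → Unique xs → Unique ys →
  (∀ {x} → x ∈ xs → x ∈ ys) → (∀ {x} → x ∈ ys → x ∈ xs) → length xs ≡ length ys
length-≡ ux uy p q = ℕP.≤-antisym (length-⊆ ux p) (length-⊆ uy q)

-- Injectivity is asked only between members of the list: coarsening a filling by blocks is shown to
-- be injective only on fillings compatible with U.
unique-map : {X Y : Set} (f : X → Y) {xs : List X} →
  (∀ {x y} → x ∈ xs → y ∈ xs → f x ≡ f y → x ≡ y) → Unique xs → Unique (map f xs)
unique-map f inj []       = []
unique-map f inj (x≢ ∷ u) =
  AllP.map⁺ (All.tabulate (λ y∈ e → All.lookup x≢ y∈ (inj (here refl) (there y∈) e)))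
  ∷ unique-map f (λ p q → inj (there p) (there q)) u

∈-concatMap-elim : {X Y : Set} (f : X → List Y) (xs : List X) {y : Y} →
  y ∈ concatMap f xs → ∃[ x ] x ∈ xs × y ∈ f x
∈-concatMap-elim f (x ∷ xs) y∈ with ∈-++⁻ (f x) y∈
... | inj₁ p = x , here refl , p
... | inj₂ p = let (x′ , x′∈ , q) = ∈-concatMap-elim f xs p in x′ , there x′∈ , q

unique-concatMap : {X Y : Set} (f : X → List Y) {xs : List X} → Unique xs →
  (∀ x → x ∈ xs → Unique (f x)) →
  (∀ {x x′ y} → x ∈ xs → x′ ∈ xs → y ∈ f x → y ∈ f x′ → x ≡ x′) →
  Unique (concatMap f xs)
unique-concatMap f []       uf dis = []
unique-concatMap f (x≢ ∷ u) uf dis = UniqueP.++⁺ (uf _ (here refl))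
  (unique-concatMap f u (λ y → uf y ∘ there) (λ p q → dis (there p) (there q)))
  λ { (p , q) → let (x′ , x′∈ , y∈) = ∈-concatMap-elim f _ q
                in All.lookup x≢ x′∈ (dis (here refl) (there x′∈) p y∈) }

∈-concatMap-intro : {X Y : Set} (f : X → List Y) {xs : List X} {x : X} {y : Y} →
  x ∈ xs → y ∈ f x → y ∈ concatMap f xs
∈-concatMap-intro f x∈ y∈ = ∈-concatMap⁺ f (Any.map (λ { refl → y∈ }) x∈)

module _ {X : Set} where

  ∈-cons⁺ : ∀ {x l} {xs : List X} {yss : List (List X)} → x ∈ xs → l ∈ yss →
    x ∷ l ∈ concatMap (λ x → map (x ∷_) yss) xs
  ∈-cons⁺ {x} {yss = yss} x∈ l∈ =
    ∈-concatMap-intro (λ x → map (x ∷_) yss) x∈ (∈-map⁺ (x ∷_) l∈)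

  ∈-cons⁻ : ∀ {l : List X} xs yss → l ∈ concatMap (λ x → map (x ∷_) yss) xs →
    ∃[ x ] ∃[ l′ ] l ≡ x ∷ l′ × x ∈ xs × l′ ∈ yss
  ∈-cons⁻ xs yss l∈ with ∈-concatMap-elim (λ x → map (x ∷_) yss) xs l∈
  ... | x , x∈ , p with ∈-map⁻ (x ∷_) p
  ... | l′ , l′∈ , e = x , l′ , e , x∈ , l′∈

  ∈-listsOf⁺ : ∀ k {xs l : List X} → length l ≡ k → All (_∈ xs) l → l ∈ listsOf k xs
  ∈-listsOf⁺ zero    {l = []}    e h        = here refl
  ∈-listsOf⁺ (suc k) {l = x ∷ l} e (x∈ ∷ h) =
    ∈-cons⁺ x∈ (∈-listsOf⁺ k (ℕP.suc-injective e) h)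

  ∈-listsOf⁻ : ∀ k {xs l : List X} → l ∈ listsOf k xs → length l ≡ k × All (_∈ xs) l
  ∈-listsOf⁻ zero    (here refl) = refl , []
  ∈-listsOf⁻ (suc k) {xs} l∈ with ∈-cons⁻ xs (listsOf k xs) l∈
  ... | x , l′ , refl , x∈ , l′∈ = let (e , h) = ∈-listsOf⁻ k l′∈ in cong suc e , x∈ ∷ h

  unique-cons : ∀ {xss : List X} {yss : List (List X)} → Unique xss → Unique yss →
    Unique (concatMap (λ x → map (x ∷_) yss) xss)
  unique-cons ux uy = unique-concatMap _ ux
    (λ x _ → UniqueP.map⁺ ListP.∷-injectiveʳ uy)
    (λ {x} {x′} _ _ p q → let (_ , _ , e) = ∈-map⁻ (x ∷_) p
                              (_ , _ , e′) = ∈-map⁻ (x′ ∷_) q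
                          in ListP.∷-injectiveˡ (trans (sym e) e′))

  listsOf-unique : ∀ k {xs : List X} → Unique xs → Unique (listsOf k xs)
  listsOf-unique zero    u = [] ∷ []
  listsOf-unique (suc k) u = unique-cons u (listsOf-unique k u)

  ∈-choices⁺ : ∀ {l : List X} {xss} → Pointwise _∈_ l xss → l ∈ choices xss
  ∈-choices⁺ []       = here refl
  ∈-choices⁺ (p ∷ ps) = ∈-cons⁺ p (∈-choices⁺ ps)

  ∈-choices⁻ : ∀ {l : List X} xss → l ∈ choices xss → Pointwise _∈_ l xss
  ∈-choices⁻ []         (here refl) = []
  ∈-choices⁻ (xs ∷ xss) l∈ with ∈-cons⁻ xs (choices xss) l∈
  ... | x , l′ , refl , x∈ , l′∈ = x∈ ∷ ∈-choices⁻ xss l′∈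

  choices-unique : ∀ {xss : List (List X)} → All Unique xss → Unique (choices xss)
  choices-unique []       = [] ∷ []
  choices-unique (u ∷ us) = unique-cons u (choices-unique us)

-- The functions local to `where` blocks of Defs are named here by unification.
mutual
  extend : {X : Set} → X → List X → List (List X) → List (List (List X))
  extend = _

  splits-extend : {X : Set} (x : X) (xs : List X) →
    splits (x ∷ xs) ≡ concatMap (extend x xs) (splits xs)
  splits-extend x xs = refl

∈-splits⁻ : {X : Set} (xs : List X) {bs : List (List X)} → bs ∈ splits xs →
  concat bs ≡ xs × All NonEmpty bs
∈-splits⁻ []       (here refl) = refl , []
∈-splits⁻ (x ∷ xs) bs∈ with ∈-concatMap-elim (extend x xs) (splits xs) bs∈
... | []     , cs∈ , here refl         = cong (x ∷_) (proj₁ (∈-splits⁻ xs cs∈)) , s≤s z≤n ∷ []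
... | c ∷ cs , cs∈ , here refl         =
  let (e , h) = ∈-splits⁻ xs cs∈ in cong (x ∷_) e , s≤s z≤n ∷ h
... | c ∷ cs , cs∈ , there (here refl) with ∈-splits⁻ xs cs∈
... | e , _ ∷ h = cong (x ∷_) e , s≤s z≤n ∷ h

∈-splits⁺ : {X : Set} (xs : List X) {bs : List (List X)} → concat bs ≡ xs → All NonEmpty bs →
  bs ∈ splits xs
∈-splits⁺ []       {[]}                   e h        = here refl
∈-splits⁺ []       {[] ∷ bs}              e (() ∷ h)
∈-splits⁺ (x ∷ xs) {[] ∷ bs}              e (() ∷ h)
∈-splits⁺ (x ∷ xs) {(y ∷ []) ∷ bs}        e (_ ∷ h) with ListP.∷-injective e
... | refl , e′ with bs | ∈-splits⁺ xs e′ h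
... | []     | p = ∈-concatMap-intro (extend x xs) p (here refl)
... | _ ∷ _  | p = ∈-concatMap-intro (extend x xs) p (here refl)
∈-splits⁺ (x ∷ xs) {(y ∷ z ∷ b) ∷ bs}     e (_ ∷ h) with ListP.∷-injective e
... | refl , e′ =
  ∈-concatMap-intro (extend x xs) (∈-splits⁺ xs e′ (s≤s z≤n ∷ h)) (there (here refl))

-- A split of `x ∷ xs` determines the split of `xs` it extends: a first word of length one was newly
-- added, a longer one arose by prefixing x. This distinction relies on splits having no empty
-- words.
splits-unique : {X : Set} (xs : List X) → Unique (splits xs)
splits-unique []       = [] ∷ []
splits-unique (x ∷ xs) = unique-concatMap (extend x xs) (splits-unique xs) ext-unique disjoint
  where
  ext-unique : ∀ bs → bs ∈ splits xs → Unique (extend x xs bs)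
  ext-unique []             _ = [] ∷ []
  ext-unique ([] ∷ bs)      p with ∈-splits⁻ xs p
  ... | _ , () ∷ _
  ext-unique ((y ∷ b) ∷ bs) _ = ((λ ()) ∷ []) ∷ [] ∷ []

  disjoint : ∀ {bs bs′ y} → bs ∈ splits xs → bs′ ∈ splits xs →
    y ∈ extend x xs bs → y ∈ extend x xs bs′ → bs ≡ bs′
  disjoint {[]}    {[]}             _ _ _ _ = refl
  disjoint {[]}    {[] ∷ _}         _ q _ _ with ∈-splits⁻ xs q
  ... | _ , () ∷ _
  disjoint {[] ∷ _} {_}             p _ _ _ with ∈-splits⁻ xs p
  ... | _ , () ∷ _
  disjoint {_ ∷ _} {[] ∷ _}         _ q _ _ with ∈-splits⁻ xs q
  ... | _ , () ∷ _
  disjoint {[]}    {(_ ∷ _) ∷ _}    _ _ (here refl) (here ())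
  disjoint {[]}    {(_ ∷ _) ∷ _}    _ _ (here refl) (there (here ()))
  disjoint {(_ ∷ _) ∷ _} {[]}       _ _ (here refl) (here ())
  disjoint {(_ ∷ _) ∷ _} {[]}       _ _ (there (here refl)) (here ())
  disjoint {(_ ∷ _) ∷ _} {(_ ∷ _) ∷ _} _ _ (here refl) (here refl) = refl
  disjoint {(_ ∷ _) ∷ _} {(_ ∷ _) ∷ _} _ _ (here refl) (there (here ()))
  disjoint {(_ ∷ _) ∷ _} {(_ ∷ _) ∷ _} _ _ (there (here refl)) (here ())
  disjoint {(_ ∷ _) ∷ _} {(_ ∷ _) ∷ _} _ _ (there (here refl)) (there (here refl)) = refl

-- The enumeration of the sentences of a given size

size-concat : ∀ {a} (I : Sent a) → size I ≡ length (concat I)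
size-concat []      = refl
size-concat (w ∷ I) = trans (cong (length w +_) (size-concat I)) (sym (ListP.length-++ w))

module _ {a : ℕ} where

  ∈-sentencesOf⁺ : {I : Sent a} → IsSentence I → I ∈ sentencesOf a (size I)
  ∈-sentencesOf⁺ {I} s = ∈-concatMap-intro splits {listsOf (size I) (allFin a)} {concat I}
    (∈-listsOf⁺ (size I) (sym (size-concat I)) (All.tabulate (λ {c} _ → ∈-allFin c)))
    (∈-splits⁺ (concat I) refl s)

  ∈-sentencesOf⁻ : ∀ n {I : Sent a} → I ∈ sentencesOf a n → IsSentence I × size I ≡ n
  ∈-sentencesOf⁻ n {I} I∈ with ∈-concatMap-elim splits (listsOf n (allFin a)) I∈
  ... | w , w∈ , p with ∈-splits⁻ w p
  ... | refl , s = s , trans (size-concat I) (proj₁ (∈-listsOf⁻ n w∈))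

  sentencesOf-unique : ∀ n → Unique (sentencesOf a n)
  sentencesOf-unique n = unique-concatMap splits
    (listsOf-unique n (UniqueP.allFin⁺ a))
    (λ w _ → splits-unique w)
    (λ {w} {w′} _ _ p q → trans (sym (proj₁ (∈-splits⁻ w p))) (proj₁ (∈-splits⁻ w′ q)))

-- With N the weighted adjacency matrix, the signed sum over the paths with l edges is (−N)^l; since L = 1 + N, applying
-- the alternating sum to L F telescopes to F − (−N)^m F, and N^m = 0 when m is the number of vertices.
module Inversion {a : ℕ} (n : ℕ) (_⊏_ : Sent a → Sent a → Set)
  (⊏-irrefl : ∀ {I} → ¬ (I ⊏ I)) (⊏-trans : ∀ {I J K} → I ⊏ J → J ⊏ K → I ⊏ K)
  (L-diagonal : ∀ {I} → I ∈ sentencesOf a n → L I I ≡ 1)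
  (edge-⊏ : ∀ {I J} → I ∈ sentencesOf a n → J ∈ sentencesOf a n → Edge I J → J ⊏ I) where

  V : List (Sent a)
  V = sentencesOf a n

  weight : List (Sent a) → ℤ
  weight p = ((ℤ.- ℤ.+ 1) ℤ.^ ℓ p) *ᶻ ℤ.+ prodP p

  term : Sent a → Sent a → List (Sent a) → ℤ
  term I K p = 𝟙 (isPath? n I K p) *ᶻ weight p

  -- Here `l` counts edges, hence the `suc l` vertices. The sum runs over all vertex lists, with an
  -- indicator inside `term`, so that it can be unfolded at the first vertex.
  pathSum : ℕ → Sent a → Sent a → ℤ
  pathSum l I K = ∑ (listsOf (suc l) V) (term I K)

  N : Sent a → Sent a → ℤ
  N I J = 𝟙 (edge? I J) *ᶻ ℤ.+ L I J

  term-zero : ∀ I K p → ¬ IsPath n I K p → term I K p ≡ 0ℤ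
  term-zero I K p h = trans (cong (_*ᶻ weight p) (𝟙-no (isPath? n I K p) h)) (ℤP.*-zeroˡ (weight p))

  Linv-pathSum : ∀ I K → Linv n I K ≡ ∑ (upTo (length V)) (λ l → pathSum l I K)
  Linv-pathSum I K = begin
    ∑ (paths n I K) weight
      ≡⟨ ∑-filter (isPath? n I K) (concatMap (λ l → listsOf l V) (range1 (length V))) weight ⟩
    ∑ (concatMap (λ l → listsOf l V) (range1 (length V))) (term I K)
      ≡⟨ ∑-concatMap (λ l → listsOf l V) (range1 (length V)) (term I K) ⟩
    ∑ (range1 (length V)) (λ l → ∑ (listsOf l V) (term I K))
      ≡⟨ ∑-map suc (upTo (length V)) _ ⟩
    ∑ (upTo (length V)) (λ l → pathSum l I K)  ∎
    where open ≡-Reasoning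

  -- Edges strictly descend for the transitive, irreflexive order `⊏`, so no walk returns to a
  -- vertex. Therefore an edge can always be put in front of a path.
  edges-distinct : ∀ {p} → All (_∈ V) p → Linked Edge p → AllPairs _≢_ p
  edges-distinct vs es = AllPairs.map (λ { v⊏u refl → ⊏-irrefl v⊏u })
    (LinkedP.Linked⇒AllPairs (λ v⊏u w⊏v → ⊏-trans w⊏v v⊏u) (descending vs es))
    where
    descending : ∀ {p} → All (_∈ V) p → Linked Edge p → Linked (λ u v → v ⊏ u) p
    descending _              []       = []
    descending _              [-]      = [-]
    descending (u∈ ∷ v∈ ∷ vs) (e ∷ es) = edge-⊏ u∈ v∈ e ∷ descending (v∈ ∷ vs) es

  path-cons⁺ : ∀ {I J K : Sent a} {q} → I ∈ V → Edge I J → IsPath n J K (J ∷ q) → IsPath n I K (I ∷ J ∷ q)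
  path-cons⁺ I∈ e (vs , _ , l , es , _) =
    I∈ ∷ vs , refl , l , e ∷ es , edges-distinct (I∈ ∷ vs) (e ∷ es)

  path-cons⁻ : ∀ {I J K : Sent a} {q} → IsPath n I K (I ∷ J ∷ q) → Edge I J × IsPath n J K (J ∷ q)
  path-cons⁻ (_ ∷ vs , _ , l , e ∷ es , _ ∷ ds) = e , vs , refl , l , es , ds

  N-edge : ∀ I J → Edge I J → N I J ≡ ℤ.+ L I J
  N-edge I J e = trans (cong (_*ᶻ ℤ.+ L I J) (𝟙-yes (edge? I J) e)) (ℤP.*-identityˡ (ℤ.+ L I J))

  N-nonedge : ∀ I J → ¬ Edge I J → N I J ≡ 0ℤ
  N-nonedge I J ¬e = trans (cong (_*ᶻ ℤ.+ L I J) (𝟙-no (edge? I J) ¬e)) (ℤP.*-zeroˡ (ℤ.+ L I J))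

  term-cons : ∀ {I J K} q → I ∈ V →
    term I K (I ∷ J ∷ q) ≡ -1ℤ *ᶻ (N I J *ᶻ term J K (J ∷ q))
  term-cons {I} {J} {K} q I∈ = by-cases (edge? I J)
    where
    open ≡-Reasoning
    s = -1ℤ ℤ.^ length q
    r = ℤ.+ prodP (J ∷ q)
    d = 𝟙 (isPath? n J K (J ∷ q))
    rearrange : ∀ d s l r → d *ᶻ (-1ℤ *ᶻ s *ᶻ (l *ᶻ r)) ≡ -1ℤ *ᶻ (l *ᶻ (d *ᶻ (s *ᶻ r)))
    rearrange = solve-∀
    by-cases : Dec (Edge I J) → term I K (I ∷ J ∷ q) ≡ -1ℤ *ᶻ (N I J *ᶻ term J K (J ∷ q))
    by-cases (no ¬e) = trans (term-zero I K (I ∷ J ∷ q) (λ p → ¬e (proj₁ (path-cons⁻ p))))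
      (sym (cong (λ z → -1ℤ *ᶻ (z *ᶻ term J K (J ∷ q))) (N-nonedge I J ¬e)))
    by-cases (yes e) = begin
      𝟙 (isPath? n I K (I ∷ J ∷ q)) *ᶻ (-1ℤ *ᶻ s *ᶻ ℤ.+ (L I J * prodP (J ∷ q)))
        ≡⟨ cong₂ (λ d z → d *ᶻ (-1ℤ *ᶻ s *ᶻ z))
             (𝟙-cong (isPath? n I K (I ∷ J ∷ q)) (isPath? n J K (J ∷ q))
               (λ p → proj₂ (path-cons⁻ p)) (path-cons⁺ I∈ e))
             (ℤP.pos-* (L I J) (prodP (J ∷ q))) ⟩
      d *ᶻ (-1ℤ *ᶻ s *ᶻ (ℤ.+ L I J *ᶻ r))
        ≡⟨ rearrange d s (ℤ.+ L I J) r ⟩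
      -1ℤ *ᶻ (ℤ.+ L I J *ᶻ (d *ᶻ (s *ᶻ r)))
        ≡⟨ cong (λ z → -1ℤ *ᶻ (z *ᶻ (d *ᶻ (s *ᶻ r)))) (N-edge I J e) ⟨
      -1ℤ *ᶻ (N I J *ᶻ term J K (J ∷ q))  ∎

  pathSum-suc : ∀ l {I} K → I ∈ V →
    pathSum (suc l) I K ≡ -1ℤ *ᶻ ∑ V (λ J → N I J *ᶻ pathSum l J K)
  pathSum-suc l {I} K I∈ = begin
    ∑ (listsOf (suc (suc l)) V) (term I K)
      ≡⟨ ∑-concatMap (λ v → map (v ∷_) Q) V (term I K) ⟩
    ∑ V (λ v → ∑ (map (v ∷_) Q) (term I K))
      ≡⟨ ∑-cong V (λ v _ → ∑-map (v ∷_) Q (term I K)) ⟩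
    ∑ V (λ v → ∑ Q (λ q → term I K (v ∷ q)))
      -- A path from I has I as its first vertex.
      ≡⟨ ∑-single _ (sentencesOf-unique n) I∈
           (λ v _ v≢I → ∑-zero Q (λ q _ → term-zero I K (v ∷ q) (λ { (_ , h , _) → v≢I (MaybeP.just-injective h) }))) ⟩
    ∑ Q (λ q → term I K (I ∷ q))
      ≡⟨ ∑-cong Q first-step ⟩
    ∑ Q (λ q → -1ℤ *ᶻ ∑ V (λ J → N I J *ᶻ term J K q))
      ≡⟨ ∑-*ˡ Q -1ℤ _ ⟩
    -1ℤ *ᶻ ∑ Q (λ q → ∑ V (λ J → N I J *ᶻ term J K q))
      ≡⟨ cong (-1ℤ *ᶻ_) (∑-comm Q V _) ⟩
    -1ℤ *ᶻ ∑ V (λ J → ∑ Q (λ q → N I J *ᶻ term J K q))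
      ≡⟨ cong (-1ℤ *ᶻ_) (∑-cong V (λ J _ → ∑-*ˡ Q (N I J) (term J K))) ⟩
    -1ℤ *ᶻ ∑ V (λ J → N I J *ᶻ pathSum l J K)  ∎
    where
    open ≡-Reasoning
    Q = listsOf (suc l) V

    first-step : ∀ q → q ∈ Q → term I K (I ∷ q) ≡ -1ℤ *ᶻ ∑ V (λ J → N I J *ᶻ term J K q)
    first-step []      q∈ = contradiction (proj₁ (∈-listsOf⁻ (suc l) {V} q∈)) λ ()
    -- Only the head J of the remaining list contributes, since a path from J′ begins with J′.
    -- Writing this one term as a sum over all vertices allows the two sums to be exchanged.
    first-step (J ∷ q) q∈ = trans (term-cons q I∈) (cong (-1ℤ *ᶻ_) (sym
      (∑-single _ (sentencesOf-unique n) (All.head (proj₂ (∈-listsOf⁻ (suc l) {V} q∈)))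
        (λ J′ _ J′≢J → trans
          (cong (N I J′ *ᶻ_) (term-zero J′ K (J ∷ q) (λ { (_ , h , _) → J′≢J (sym (MaybeP.just-injective h)) })))
          (ℤP.*-zeroʳ (N I J′))))))

  pathSum-zero : ∀ {I} K → I ∈ V → pathSum 0 I K ≡ 𝟙 (sent-≟ K I)
  pathSum-zero {I} K I∈ = begin
    ∑ (listsOf 1 V) (term I K)
      ≡⟨ ∑-single (term I K) (listsOf-unique 1 (sentencesOf-unique n)) (∈-listsOf⁺ 1 refl (I∈ ∷ []))
           (λ p p∈ p≢ → term-zero I K p (not-path p p∈ p≢)) ⟩
    𝟙 (isPath? n I K (I ∷ [])) *ᶻ 1ℤ
      ≡⟨ ℤP.*-identityʳ (𝟙 (isPath? n I K (I ∷ []))) ⟩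
    𝟙 (isPath? n I K (I ∷ []))
      ≡⟨ 𝟙-cong (isPath? n I K (I ∷ [])) (sent-≟ K I)
           (λ { (_ , _ , l , _) → sym (MaybeP.just-injective l) })
           (λ { refl → I∈ ∷ [] , refl , refl , [-] , [] ∷ [] }) ⟩
    𝟙 (sent-≟ K I)  ∎
    where
    open ≡-Reasoning
    not-path : ∀ p → p ∈ listsOf 1 V → p ≢ I ∷ [] → ¬ IsPath n I K p
    not-path (J ∷ [])     _  p≢ (_ , h , _) = p≢ (cong [_] (MaybeP.just-injective h))
    not-path []           p∈ _  _           = contradiction (proj₁ (∈-listsOf⁻ 1 {V} p∈)) λ ()
    not-path (_ ∷ _ ∷ _)  p∈ _  _           = contradiction (proj₁ (∈-listsOf⁻ 1 {V} p∈)) λ ()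

  -- A list of `suc (length V)` vertices repeats one of them, so it is not a path. This is the
  -- nilpotency of N.
  pathSum-long : ∀ I K → pathSum (length V) I K ≡ 0ℤ
  pathSum-long I K = ∑-zero (listsOf (suc (length V)) V) λ p p∈ → term-zero I K p λ { (vs , _ , _ , _ , ds) →
    ℕP.n≮n (length V) (subst (_≤ length V) (proj₁ (∈-listsOf⁻ (suc (length V)) {V} p∈))
      (length-⊆ ds (All.lookup vs))) }

  -- The action of the l-th power of -N on a vector.
  apply : ℕ → (Sent a → ℤ) → Sent a → ℤ
  apply l v I = ∑ V (λ K → pathSum l I K *ᶻ v K)

  apply-zero : ∀ v {I} → I ∈ V → apply 0 v I ≡ v I
  apply-zero v {I} I∈ = begin
    apply 0 v I
      ≡⟨ ∑-single _ (sentencesOf-unique n) I∈ (λ K _ K≢I → trans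
           (cong (_*ᶻ v K) (trans (pathSum-zero K I∈) (𝟙-no (sent-≟ K I) K≢I))) (ℤP.*-zeroˡ (v K))) ⟩
    pathSum 0 I I *ᶻ v I
      ≡⟨ cong (_*ᶻ v I) (trans (pathSum-zero I I∈) (𝟙-yes (sent-≟ I I) refl)) ⟩
    1ℤ *ᶻ v I  ≡⟨ ℤP.*-identityˡ (v I) ⟩
    v I        ∎
    where open ≡-Reasoning

  apply-suc : ∀ l v {I} → I ∈ V → apply (suc l) v I ≡ -1ℤ *ᶻ ∑ V (λ J → N I J *ᶻ apply l v J)
  apply-suc l v {I} I∈ = begin
    ∑ V (λ K → pathSum (suc l) I K *ᶻ v K)
      ≡⟨ ∑-cong V (λ K _ → trans (cong (_*ᶻ v K) (pathSum-suc l K I∈)) (ℤP.*-assoc -1ℤ (∑ V (λ J → N I J *ᶻ pathSum l J K)) (v K))) ⟩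
    ∑ V (λ K → -1ℤ *ᶻ (∑ V (λ J → N I J *ᶻ pathSum l J K) *ᶻ v K))
      ≡⟨ ∑-*ˡ V -1ℤ _ ⟩
    -1ℤ *ᶻ ∑ V (λ K → ∑ V (λ J → N I J *ᶻ pathSum l J K) *ᶻ v K)
      ≡⟨ cong (-1ℤ *ᶻ_) (∑-cong V (λ K _ → sym (∑-*ʳ V (v K) _))) ⟩
    -1ℤ *ᶻ ∑ V (λ K → ∑ V (λ J → N I J *ᶻ pathSum l J K *ᶻ v K))
      ≡⟨ cong (-1ℤ *ᶻ_) (∑-comm V V _) ⟩
    -1ℤ *ᶻ ∑ V (λ J → ∑ V (λ K → N I J *ᶻ pathSum l J K *ᶻ v K))
      ≡⟨ cong (-1ℤ *ᶻ_) (∑-cong V (λ J _ → trans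
           (∑-cong V (λ K _ → ℤP.*-assoc (N I J) (pathSum l J K) (v K))) (∑-*ˡ V (N I J) _))) ⟩
    -1ℤ *ᶻ ∑ V (λ J → N I J *ᶻ apply l v J)  ∎
    where open ≡-Reasoning

  module _ (F S : Sent a → ℤ) (S-expansion : ∀ {I} → I ∈ V → S I ≡ ∑ V (λ J → ℤ.+ L I J *ᶻ F J)) where

    -- An edge joins distinct vertices, so N is L without its diagonal, and the diagonal entries are
    -- 1.
    L-split : ∀ {I} → I ∈ V → ∀ J → ℤ.+ L I J ≡ 𝟙 (sent-≟ J I) +ᶻ N I J
    L-split {I} I∈ J = by-cases (sent-≟ J I) (L I J ℕP.≟ 0)
      where
      by-cases : Dec (J ≡ I) → Dec (L I J ≡ 0) → ℤ.+ L I J ≡ 𝟙 (sent-≟ J I) +ᶻ N I J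
      by-cases (yes refl) _ = trans (cong ℤ.+_ (L-diagonal I∈))
        (sym (cong₂ _+ᶻ_ (𝟙-yes (sent-≟ I I) refl) (N-nonedge I I (λ e → proj₁ e refl))))
      by-cases (no J≢I) (no L≢0) = sym (trans
        (cong₂ _+ᶻ_ (𝟙-no (sent-≟ J I) J≢I) (N-edge I J (J≢I , L≢0))) (ℤP.+-identityˡ (ℤ.+ L I J)))
      by-cases (no J≢I) (yes L≡0) = trans (cong ℤ.+_ L≡0)
        (sym (cong₂ _+ᶻ_ (𝟙-no (sent-≟ J I) J≢I) (N-nonedge I J (λ e → proj₂ e L≡0))))

    S-split : ∀ {I} → I ∈ V → S I ≡ F I +ᶻ ∑ V (λ J → N I J *ᶻ F J)
    S-split {I} I∈ = begin
      S I  ≡⟨ S-expansion I∈ ⟩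
      ∑ V (λ J → ℤ.+ L I J *ᶻ F J)
        ≡⟨ ∑-cong V (λ J _ → trans (cong (_*ᶻ F J) (L-split I∈ J)) (ℤP.*-distribʳ-+ (F J) (𝟙 (sent-≟ J I)) (N I J))) ⟩
      ∑ V (λ J → 𝟙 (sent-≟ J I) *ᶻ F J +ᶻ N I J *ᶻ F J)
        ≡⟨ ∑-+ V _ _ ⟩
      ∑ V (λ J → 𝟙 (sent-≟ J I) *ᶻ F J) +ᶻ ∑ V (λ J → N I J *ᶻ F J)
        ≡⟨ cong (_+ᶻ ∑ V (λ J → N I J *ᶻ F J)) (trans
             (∑-single _ (sentencesOf-unique n) I∈
               (λ J _ J≢I → trans (cong (_*ᶻ F J) (𝟙-no (sent-≟ J I) J≢I)) (ℤP.*-zeroˡ (F J))))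
             (trans (cong (_*ᶻ F I) (𝟙-yes (sent-≟ I I) refl)) (ℤP.*-identityˡ (F I)))) ⟩
      F I +ᶻ ∑ V (λ J → N I J *ᶻ F J)  ∎
      where open ≡-Reasoning

    -- The equation S = (1 + N) F multiplied by the l-th power of -N. The induction peels off the
    -- leftmost factor -N, so only the base case uses the relation between S and F.
    apply-difference : ∀ l {I} → I ∈ V → apply l S I ≡ apply l F I +ᶻ -1ℤ *ᶻ apply (suc l) F I
    apply-difference zero {I} I∈ = begin
      apply 0 S I                          ≡⟨ apply-zero S I∈ ⟩
      S I                                  ≡⟨ S-split I∈ ⟩
      F I +ᶻ NF                            ≡⟨ negate-twice (F I) NF ⟩
      F I +ᶻ -1ℤ *ᶻ (-1ℤ *ᶻ NF)            ≡⟨ cong₂ (λ x y → x +ᶻ -1ℤ *ᶻ (-1ℤ *ᶻ y)) (apply-zero F I∈)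
                                                (∑-cong V (λ J J∈ → cong (N I J *ᶻ_) (apply-zero F J∈))) ⟨
      apply 0 F I +ᶻ -1ℤ *ᶻ (-1ℤ *ᶻ ∑ V (λ J → N I J *ᶻ apply 0 F J))
                                           ≡⟨ cong (λ x → apply 0 F I +ᶻ -1ℤ *ᶻ x) (apply-suc 0 F I∈) ⟨
      apply 0 F I +ᶻ -1ℤ *ᶻ apply 1 F I    ∎
      where
      open ≡-Reasoning
      NF = ∑ V (λ J → N I J *ᶻ F J)
      negate-twice : ∀ x y → x +ᶻ y ≡ x +ᶻ -1ℤ *ᶻ (-1ℤ *ᶻ y)
      negate-twice = solve-∀
    apply-difference (suc l) {I} I∈ = begin
      apply (suc l) S I
        ≡⟨ apply-suc l S I∈ ⟩
      -1ℤ *ᶻ ∑ V (λ J → N I J *ᶻ apply l S J)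
        ≡⟨ cong (-1ℤ *ᶻ_) (∑-cong V (λ J J∈ → trans (cong (N I J *ᶻ_) (apply-difference l J∈))
             (distribute (N I J) (apply l F J) (apply (suc l) F J)))) ⟩
      -1ℤ *ᶻ ∑ V (λ J → N I J *ᶻ apply l F J +ᶻ -1ℤ *ᶻ (N I J *ᶻ apply (suc l) F J))
        ≡⟨ cong (-1ℤ *ᶻ_) (trans (∑-+ V _ _) (cong (∑ V (λ J → N I J *ᶻ apply l F J) +ᶻ_) (∑-*ˡ V -1ℤ _))) ⟩
      -1ℤ *ᶻ (∑ V (λ J → N I J *ᶻ apply l F J) +ᶻ -1ℤ *ᶻ ∑ V (λ J → N I J *ᶻ apply (suc l) F J))
        ≡⟨ ℤP.*-distribˡ-+ -1ℤ (∑ V (λ J → N I J *ᶻ apply l F J)) (-1ℤ *ᶻ ∑ V (λ J → N I J *ᶻ apply (suc l) F J)) ⟩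
      -1ℤ *ᶻ ∑ V (λ J → N I J *ᶻ apply l F J) +ᶻ -1ℤ *ᶻ (-1ℤ *ᶻ ∑ V (λ J → N I J *ᶻ apply (suc l) F J))
        ≡⟨ cong₂ (λ x y → x +ᶻ -1ℤ *ᶻ y) (apply-suc l F I∈) (apply-suc (suc l) F I∈) ⟨
      apply (suc l) F I +ᶻ -1ℤ *ᶻ apply (suc (suc l)) F I  ∎
      where
      open ≡-Reasoning
      distribute : ∀ c x y → c *ᶻ (x +ᶻ -1ℤ *ᶻ y) ≡ c *ᶻ x +ᶻ -1ℤ *ᶻ (c *ᶻ y)
      distribute = solve-∀

    telescope : ∀ m {I} → I ∈ V → ∑ (upTo m) (λ l → apply l S I) ≡ F I +ᶻ -1ℤ *ᶻ apply m F I
    telescope zero {I} I∈ = sym (trans (cong (λ x → F I +ᶻ -1ℤ *ᶻ x) (apply-zero F I∈)) (cancel (F I)))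
      where
      cancel : ∀ x → x +ᶻ -1ℤ *ᶻ x ≡ 0ℤ
      cancel = solve-∀
    telescope (suc m) {I} I∈ = begin
      ∑ (upTo (suc m)) (λ l → apply l S I)
        ≡⟨ cong (λ xs → ∑ xs (λ l → apply l S I)) (ListP.upTo-∷ʳ m) ⟨
      ∑ (upTo m ++ [ m ]) (λ l → apply l S I)
        ≡⟨ ∑-++ (upTo m) [ m ] _ ⟩
      ∑ (upTo m) (λ l → apply l S I) +ᶻ (apply m S I +ᶻ 0ℤ)
        ≡⟨ cong₂ (λ x y → x +ᶻ (y +ᶻ 0ℤ)) (telescope m I∈) (apply-difference m I∈) ⟩
      (F I +ᶻ -1ℤ *ᶻ apply m F I) +ᶻ (apply m F I +ᶻ -1ℤ *ᶻ apply (suc m) F I +ᶻ 0ℤ)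
        ≡⟨ cancel (F I) (apply m F I) (apply (suc m) F I) ⟩
      F I +ᶻ -1ℤ *ᶻ apply (suc m) F I  ∎
      where
      open ≡-Reasoning
      cancel : ∀ x y z → (x +ᶻ -1ℤ *ᶻ y) +ᶻ (y +ᶻ -1ℤ *ᶻ z +ᶻ 0ℤ) ≡ x +ᶻ -1ℤ *ᶻ z
      cancel = solve-∀

    -- Any member of `paths n I K` witnesses reachability, so otherwise the sum is empty. Hence the
    -- sum over reachable K equals the sum over all vertices.
    Linv-unreachable : ∀ I K → ¬ Reachable n I K → Linv n I K ≡ 0ℤ
    Linv-unreachable I K ¬r = ∑-zero (paths n I K) λ p p∈ →
      contradiction (Any.map (λ { refl → proj₂ (∈-filter⁻ (isPath? n I K)
        {xs = concatMap (λ l → listsOf l V) (range1 (length V))} p∈) }) p∈) ¬r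

    inversion : ∀ {I} → I ∈ V →
      F I ≡ ∑ (filter (reachable? n I) V) (λ K → Linv n I K *ᶻ S K)
    inversion {I} I∈ = sym (begin
      ∑ (filter (reachable? n I) V) (λ K → Linv n I K *ᶻ S K)
        ≡⟨ ∑-filter (reachable? n I) V _ ⟩
      ∑ V (λ K → 𝟙 (reachable? n I K) *ᶻ (Linv n I K *ᶻ S K))
        ≡⟨ ∑-cong V (λ K _ → drop-indicator K) ⟩
      ∑ V (λ K → Linv n I K *ᶻ S K)
        ≡⟨ ∑-cong V (λ K _ → trans (cong (_*ᶻ S K) (Linv-pathSum I K)) (sym (∑-*ʳ (upTo (length V)) (S K) _))) ⟩
      ∑ V (λ K → ∑ (upTo (length V)) (λ l → pathSum l I K *ᶻ S K))
        ≡⟨ ∑-comm V (upTo (length V)) _ ⟩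
      ∑ (upTo (length V)) (λ l → apply l S I)
        ≡⟨ telescope (length V) I∈ ⟩
      F I +ᶻ -1ℤ *ᶻ apply (length V) F I
        ≡⟨ cong (λ x → F I +ᶻ -1ℤ *ᶻ x) (∑-zero V (λ K _ →
             trans (cong (_*ᶻ F K) (pathSum-long I K)) (ℤP.*-zeroˡ (F K)))) ⟩
      F I +ᶻ 0ℤ
        ≡⟨ ℤP.+-identityʳ (F I) ⟩
      F I  ∎)
      where
      open ≡-Reasoning
      drop-indicator : ∀ K → 𝟙 (reachable? n I K) *ᶻ (Linv n I K *ᶻ S K) ≡ Linv n I K *ᶻ S K
      drop-indicator K = by-cases (reachable? n I K)
        where
        by-cases : Dec (Reachable n I K) →
          𝟙 (reachable? n I K) *ᶻ (Linv n I K *ᶻ S K) ≡ Linv n I K *ᶻ S K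
        by-cases (yes r) = trans (cong (_*ᶻ (Linv n I K *ᶻ S K)) (𝟙-yes (reachable? n I K) r))
          (ℤP.*-identityˡ (Linv n I K *ᶻ S K))
        by-cases (no ¬r) = trans (cong (_*ᶻ (Linv n I K *ᶻ S K)) (𝟙-no (reachable? n I K) ¬r)) (trans (ℤP.*-zeroˡ (Linv n I K *ᶻ S K))
          (sym (trans (cong (_*ᶻ S K) (Linv-unreachable I K ¬r)) (ℤP.*-zeroˡ (S K)))))

-- Monomials and the expansion of F

infix 8 _!_
-- Beyond the end of the list the value is the empty word, in accordance with x_∅ = 1: trailing
-- empty words do not change a monomial.
_!_ : {X : Set} → List (List X) → ℕ → List X
[]      ! i     = []
(u ∷ U) ! zero  = u
(u ∷ U) ! suc i = U ! i

-- The sentence J for which M_J contains the monomial x_U: empty words of U contribute no variable.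
flat : ∀ {a} → List (Word a) → Sent a
flat []            = []
flat ([] ∷ U)      = flat U
flat ((c ∷ u) ∷ U) = (c ∷ u) ∷ flat U

flat-sentence : ∀ {a} (U : List (Word a)) → IsSentence (flat U)
flat-sentence []            = []
flat-sentence ([] ∷ U)      = flat-sentence U
flat-sentence ((c ∷ u) ∷ U) = s≤s z≤n ∷ flat-sentence U

flat-id : ∀ {a} {J : Sent a} → IsSentence J → flat J ≡ J
flat-id []                              = refl
flat-id {J = (c ∷ w) ∷ J} (s≤s z≤n ∷ s) = cong ((c ∷ w) ∷_) (flat-id s)

∈-range1⁺ : ∀ {m i} → 1 ≤ i → i ≤ m → i ∈ range1 m
∈-range1⁺ {i = suc i} _ i≤m = ∈-map⁺ suc (∈-upTo⁺ i≤m)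

∈-range1⁻ : ∀ {m i} → i ∈ range1 m → 1 ≤ i × i ≤ m
∈-range1⁻ i∈ with ∈-map⁻ suc i∈
... | j , j∈ , refl = s≤s z≤n , ∈-upTo⁻ j∈

range1-unique : ∀ m → Unique (range1 m)
range1-unique m = UniqueP.map⁺ ℕP.suc-injective (UniqueP.upTo⁺ m)

module _ {a : ℕ} where

  atIndex-++ : (m₁ m₂ : Mon a) (i : ℕ) → atIndex (m₁ ++ m₂) i ≡ atIndex m₁ i ++ atIndex m₂ i
  atIndex-++ m₁ m₂ i =
    trans (cong (map proj₂) (ListP.filter-++ (λ p → proj₁ p ℕP.≟ i) m₁ m₂)) (ListP.map-++ proj₂ (filter (λ p → proj₁ p ℕP.≟ i) m₁) _)

  atIndex-none : (m : Mon a) (i : ℕ) → All (λ p → proj₁ p ≢ i) m → atIndex m i ≡ []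
  atIndex-none m i h = cong (map proj₂) (ListP.filter-none (λ p → proj₁ p ℕP.≟ i) h)

  atIndex-xw : (w : Word a) (i : ℕ) → atIndex (xw w i) i ≡ w
  atIndex-xw w i = begin
    map proj₂ (filter (λ p → proj₁ p ℕP.≟ i) (xw w i))
      ≡⟨ cong (map proj₂) (ListP.filter-all (λ p → proj₁ p ℕP.≟ i) (AllP.map⁺ (All.tabulate (λ _ → refl)))) ⟩
    map proj₂ (xw w i)  ≡⟨ ListP.map-∘ w ⟨
    map id w            ≡⟨ ListP.map-id w ⟩
    w                   ∎
    where open ≡-Reasoning

  atIndex-xw-other : (w : Word a) {i j : ℕ} → j ≢ i → atIndex (xw w j) i ≡ []
  atIndex-xw-other w {i} {j} j≢i = atIndex-none (xw w j) i (AllP.map⁺ (All.tabulate (λ _ → j≢i)))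

  atIndex-typeMon-below : ∀ b (U : List (Word a)) {i} → i < b → atIndex (typeMonFrom b U) i ≡ []
  atIndex-typeMon-below b []      i<b = refl
  atIndex-typeMon-below b (u ∷ U) {i} i<b = trans (atIndex-++ (xw u b) _ i)
    (cong₂ _++_ (atIndex-xw-other u (ℕP.>⇒≢ i<b)) (atIndex-typeMon-below (suc b) U (ℕP.m<n⇒m<1+n i<b)))

  atIndex-typeMon-head : ∀ b (u : Word a) U → atIndex (typeMonFrom b (u ∷ U)) b ≡ u
  atIndex-typeMon-head b u U = trans (atIndex-++ (xw u b) _ b)
    (trans (cong₂ _++_ (atIndex-xw u b) (atIndex-typeMon-below (suc b) U ℕP.≤-refl)) (ListP.++-identityʳ u))

  atIndex-typeMon : ∀ b (U : List (Word a)) i → atIndex (typeMonFrom b U) (b + i) ≡ U ! i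
  atIndex-typeMon b []      i       = refl
  atIndex-typeMon b (u ∷ U) zero    =
    trans (cong (atIndex (typeMonFrom b (u ∷ U))) (ℕP.+-identityʳ b)) (atIndex-typeMon-head b u U)
  atIndex-typeMon b (u ∷ U) (suc i) = begin
    atIndex (typeMonFrom b (u ∷ U)) (b + suc i)
      ≡⟨ cong (atIndex (typeMonFrom b (u ∷ U))) (ℕP.+-suc b i) ⟩
    atIndex (typeMonFrom b (u ∷ U)) (suc b + i)
      ≡⟨ atIndex-++ (xw u b) _ (suc b + i) ⟩
    atIndex (xw u b) (suc b + i) ++ atIndex (typeMonFrom (suc b) U) (suc b + i)
      ≡⟨ cong₂ _++_ (atIndex-xw-other u (ℕP.<⇒≢ (s≤s (ℕP.m≤m+n b i)))) (atIndex-typeMon (suc b) U i) ⟩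
    U ! i  ∎
    where open ≡-Reasoning

  atIndex-beyond : (m : Mon a) {i : ℕ} → maxIdx m < i → atIndex m i ≡ []
  atIndex-beyond m {i} lt = atIndex-none m i (below m lt)
    where
    below : ∀ m → maxIdx m < i → All (λ p → proj₁ p ≢ i) m
    below []            lt = []
    below ((j , c) ∷ m) lt =
      ℕP.<⇒≢ (ℕP.≤-<-trans (ℕP.m≤m⊔n j (maxIdx m)) lt) ∷ below m (ℕP.≤-<-trans (ℕP.m≤n⊔m j (maxIdx m)) lt)

  -- Above both maximal indices both subwords are empty, so the finitely many comparisons in `MonEq`
  -- settle every index.
  MonEq⁻ : (m₁ m₂ : Mon a) → MonEq m₁ m₂ → ∀ i → atIndex m₁ i ≡ atIndex m₂ i
  MonEq⁻ m₁ m₂ e i with i <? suc (maxIdx m₁ ⊔ maxIdx m₂)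
  ... | yes i< = All.lookup e (∈-upTo⁺ i<)
  ... | no i≮  = trans (atIndex-beyond m₁ (ℕP.m⊔n≤o⇒m≤o (suc (maxIdx m₁)) (suc (maxIdx m₂)) (ℕP.≮⇒≥ i≮)))
    (sym (atIndex-beyond m₂ (ℕP.m⊔n≤o⇒n≤o (suc (maxIdx m₁)) (suc (maxIdx m₂)) (ℕP.≮⇒≥ i≮))))

  MonEq⁺ : (m₁ m₂ : Mon a) → (∀ i → atIndex m₁ i ≡ atIndex m₂ i) → MonEq m₁ m₂
  MonEq⁺ m₁ m₂ e = All.tabulate (λ {i} _ → e i)

  -- The indices of the nonempty words of U, counted from b. These are the summation indices of the
  -- term of M that equals x_U.
  positions : ℕ → List (Word a) → List ℕ
  positions b []            = []
  positions b ([] ∷ U)      = positions (suc b) U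
  positions b ((c ∷ u) ∷ U) = b ∷ positions (suc b) U

  positions-bounds : ∀ b U → All (λ j → b ≤ j × j < b + length U) (positions b U)
  positions-bounds b []            = []
  positions-bounds b (u ∷ U) with positions-bounds (suc b) U
  ... | h with u
  ... | []    = All.map (λ (l , r) → ℕP.<⇒≤ l , ℕP.<-≤-trans r (ℕP.≤-reflexive (sym (ℕP.+-suc b _)))) h
  ... | c ∷ _ = (ℕP.≤-refl , ℕP.m<m+n b z<s)
    ∷ All.map (λ (l , r) → ℕP.<⇒≤ l , ℕP.<-≤-trans r (ℕP.≤-reflexive (sym (ℕP.+-suc b _)))) h

  positions-increasing : ∀ b U → AllPairs _<_ (positions b U)
  positions-increasing b []            = []
  positions-increasing b ([] ∷ U)      = positions-increasing (suc b) U
  positions-increasing b ((c ∷ u) ∷ U) =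
    All.map proj₁ (positions-bounds (suc b) U) ∷ positions-increasing (suc b) U

  positions-length : ∀ b U → length (positions b U) ≡ length (flat U)
  positions-length b []            = refl
  positions-length b ([] ∷ U)      = positions-length (suc b) U
  positions-length b ((c ∷ u) ∷ U) = cong suc (positions-length (suc b) U)

  Mterm-positions : ∀ b U → Mterm (flat U) (positions b U) ≡ typeMonFrom b U
  Mterm-positions b []            = refl
  Mterm-positions b ([] ∷ U)      = Mterm-positions (suc b) U
  Mterm-positions b ((c ∷ u) ∷ U) = cong (xw (c ∷ u) b ++_) (Mterm-positions (suc b) U)

  atIndex-Mterm-below : ∀ {b} (J : Sent a) js → All (b <_) js → atIndex (Mterm J js) b ≡ []
  atIndex-Mterm-below []      js       h       = refl
  atIndex-Mterm-below (w ∷ J) []       h       = refl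
  atIndex-Mterm-below (w ∷ J) (j ∷ js) (l ∷ h) = trans (atIndex-++ (xw w j) _ _)
    (cong₂ _++_ (atIndex-xw-other w (ℕP.>⇒≢ l)) (atIndex-Mterm-below J js h))

  atIndex-Mterm-head : ∀ (w : Word a) {b} J js → All (b <_) js → atIndex (Mterm (w ∷ J) (b ∷ js)) b ≡ w
  atIndex-Mterm-head w {b} J js h = trans (atIndex-++ (xw w b) _ b)
    (trans (cong₂ _++_ (atIndex-xw w b) (atIndex-Mterm-below J js h)) (ListP.++-identityʳ w))

  -- Induction on U, reading off the subword at index b. If the first position exceeds b, nothing
  -- stands there and the first word of U must be empty; if it equals b, the first word of J stands
  -- there, and being nonempty it must be the first word of U. Cancelling it leaves the same problem
  -- from `suc b` on.
  Mterm-unique : ∀ b U {J : Sent a} {js} → IsSentence J → length js ≡ length J → AllPairs _<_ js →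
    All (λ j → b ≤ j × j < b + length U) js →
    (∀ i → atIndex (Mterm J js) i ≡ atIndex (typeMonFrom b U) i) →
    J ≡ flat U × js ≡ positions b U
  Mterm-unique b [] {[]} {[]} s len inc bd e = refl , refl
  Mterm-unique b [] {js = j ∷ js} s len inc ((l , r) ∷ bd) e =
    contradiction (subst (j <_) (ℕP.+-identityʳ b) r) (ℕP.≤⇒≯ l)
  Mterm-unique b ([] ∷ U) {[]} {[]} s len inc bd e = Mterm-unique (suc b) U s len inc [] e
  Mterm-unique b ([] ∷ U) {w ∷ J} {j ∷ js} (w≢ ∷ s) len (j< ∷ inc) ((l , r) ∷ bd) e with ℕP.m≤n⇒m<n∨m≡n l
  ... | inj₁ b<j = Mterm-unique (suc b) U (w≢ ∷ s) len (j< ∷ inc)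
    (All.zipWith (λ (l , _ , r) → l , ℕP.<-≤-trans r (ℕP.≤-reflexive (ℕP.+-suc b _)))
      (b<j ∷ All.map (ℕP.<-trans b<j) j< , (l , r) ∷ bd)) e
  Mterm-unique b ([] ∷ U) {[] ∷ J} {b ∷ js} (() ∷ s) len (j< ∷ inc) ((l , r) ∷ bd) e | inj₂ refl
  Mterm-unique b ([] ∷ U) {(c ∷ w) ∷ J} {b ∷ js} (w≢ ∷ s) len (j< ∷ inc) ((l , r) ∷ bd) e | inj₂ refl =
    contradiction (trans (sym (atIndex-Mterm-head (c ∷ w) J js j<)) (trans (e b) (atIndex-typeMon-head b [] U))) λ ()
  Mterm-unique b ((c ∷ u) ∷ U) {[]} {[]} s len inc bd e =
    contradiction (trans (e b) (atIndex-typeMon-head b (c ∷ u) U)) λ ()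
  Mterm-unique b ((c ∷ u) ∷ U) {w ∷ J} {j ∷ js} (w≢ ∷ s) len (j< ∷ inc) ((l , r) ∷ bd) e
    with ℕP.m≤n⇒m<n∨m≡n l
  ... | inj₁ b<j = contradiction
    (trans (sym (atIndex-Mterm-below (w ∷ J) (j ∷ js) (b<j ∷ All.map (ℕP.<-trans b<j) j<)))
      (trans (e b) (atIndex-typeMon-head b (c ∷ u) U))) λ ()
  ... | inj₂ refl with trans (sym (atIndex-Mterm-head w J js j<)) (trans (e b) (atIndex-typeMon-head b (c ∷ u) U))
  ... | refl with Mterm-unique (suc b) U s (ℕP.suc-injective len) inc
    (All.zipWith (λ (l , _ , r) → l , ℕP.<-≤-trans r (ℕP.≤-reflexive (ℕP.+-suc b _))) (j< , bd))
    (λ i → ListP.++-cancelˡ (atIndex (xw (c ∷ u) b) i) _ _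
      (trans (sym (atIndex-++ (xw (c ∷ u) b) _ i)) (trans (e i) (atIndex-++ (xw (c ∷ u) b) _ i))))
  ... | refl , refl = refl , refl

count-one : {X : Set} {P : X → Set} (P? : Decidable P) {xs : List X} {x : X} → Unique xs →
  x ∈ xs → P x → (∀ {y} → y ∈ xs → P y → y ≡ x) → count P? xs ≡ 1
count-one P? {xs} {x} u x∈ px h = length-≡ {ys = [ x ]} (UniqueP.filter⁺ P? u) ([] ∷ [])
  (λ y∈ → let (p , q) = ∈-filter⁻ P? {xs = xs} y∈ in here (h p q))
  λ { (here refl) → ∈-filter⁺ P? x∈ px }

count-none : {X : Set} {P : X → Set} (P? : Decidable P) {xs : List X} →
  (∀ {y} → y ∈ xs → ¬ P y) → count P? xs ≡ 0
count-none P? h = cong length (ListP.filter-none P? (All.tabulate h))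

module _ {a : ℕ} where

  coeffM-flat : (U : List (Word a)) → coeffM (flat U) U ≡ 1
  coeffM-flat U = count-one (λ js → monEq? (typeMon U) (Mterm (flat U) js))
    (UniqueP.filter⁺ (Linked.linked? _<?_) (listsOf-unique (length (flat U)) (range1-unique (length U))))
    (∈-filter⁺ (Linked.linked? _<?_)
      (∈-listsOf⁺ (length (flat U)) (positions-length 1 U)
        (All.map (λ (l , r) → ∈-range1⁺ l (s≤s⁻¹ r)) (positions-bounds 1 U)))
      (LinkedP.AllPairs⇒Linked (positions-increasing 1 U)))
    (MonEq⁺ (Mterm (flat U) (positions 1 U)) (typeMon U) (λ i → cong (λ m → atIndex m i) (Mterm-positions 1 U)))
    λ {js} js∈ e → let (p , q) = ∈-filter⁻ (Linked.linked? _<?_) {xs = listsOf (length (flat U)) (range1 (length U))} js∈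
                       (len , bd) = ∈-listsOf⁻ (length (flat U)) p
      in proj₂ (Mterm-unique 1 U (flat-sentence U) len (LinkedP.Linked⇒AllPairs ℕP.<-trans q)
           (All.map (λ j∈ → let (l , r) = ∈-range1⁻ j∈ in l , s≤s r) bd) (MonEq⁻ (Mterm (flat U) js) (typeMon U) e))

  coeffM-other : (U : List (Word a)) {J : Sent a} → IsSentence J → J ≢ flat U → coeffM J U ≡ 0
  coeffM-other U {J} s J≢ = count-none (λ js → monEq? (typeMon U) (Mterm J js))
    λ {js} js∈ e → let (p , q) = ∈-filter⁻ (Linked.linked? _<?_) {xs = listsOf (length J) (range1 (length U))} js∈
                       (len , bd) = ∈-listsOf⁻ (length J) p
      in J≢ (proj₁ (Mterm-unique 1 U s len (LinkedP.Linked⇒AllPairs ℕP.<-trans q)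
           (All.map (λ j∈ → let (l , r) = ∈-range1⁻ j∈ in l , s≤s r) bd) (MonEq⁻ (Mterm J js) (typeMon U) e)))

  ⪯⁻ : {J I : Sent a} → J ⪯ I → ∃[ bs ] concat bs ≡ J × All NonEmpty bs × map concat bs ≡ I
  ⪯⁻ {J} r = go (splits J) (∈-splits⁻ J) r
    where
    go : ∀ {I} bss → (∀ {bs} → bs ∈ bss → concat bs ≡ J × All NonEmpty bs) →
      Any (λ bs → map concat bs ≡ I) bss → ∃[ bs ] concat bs ≡ J × All NonEmpty bs × map concat bs ≡ I
    go (bs ∷ bss) h (here e)  = let (p , q) = h (here refl) in bs , p , q , e
    go (bs ∷ bss) h (there r) = go bss (h ∘ there) r

  ⪯⁺ : {J I : Sent a} (bs : List (Sent a)) → concat bs ≡ J → All NonEmpty bs → map concat bs ≡ I → J ⪯ I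
  ⪯⁺ {J} bs e h e′ = Any.map (λ { refl → e′ }) (∈-splits⁺ J e h)

  ⪯-concat : {J I : Sent a} → J ⪯ I → concat J ≡ concat I
  ⪯-concat {J} {I} r with ⪯⁻ {J} {I} r
  ... | bs , refl , _ , refl = sym (ListP.concat-concat bs)

  coeffF-flat : (I : Sent a) (U : List (Word a)) → ℤ.+ coeffF I U ≡ 𝟙 (⪯? I (flat U))
  coeffF-flat I U = begin
    ℤ.+ coeffF I U
      ≡⟨ sum-∑ (λ J → coeffM J U) (filter (⪯? I) V) ⟩
    ∑ (filter (⪯? I) V) (λ J → ℤ.+ coeffM J U)
      ≡⟨ by-cases (⪯? I (flat U)) ⟩
    𝟙 (⪯? I (flat U))  ∎
    where
    open ≡-Reasoning
    V = sentencesOf a (size I)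

    other : ∀ J → J ∈ filter (⪯? I) V → J ≢ flat U → ℤ.+ coeffM J U ≡ 0ℤ
    other J J∈ J≢ = cong ℤ.+_ (coeffM-other U
      (proj₁ (∈-sentencesOf⁻ (size I) (proj₁ (∈-filter⁻ (⪯? I) {xs = V} J∈)))) J≢)

    by-cases : Dec (flat U ⪯ I) → ∑ (filter (⪯? I) V) (λ J → ℤ.+ coeffM J U) ≡ 𝟙 (⪯? I (flat U))
    by-cases (yes r) = begin
      ∑ (filter (⪯? I) V) (λ J → ℤ.+ coeffM J U)
        ≡⟨ ∑-single _ (UniqueP.filter⁺ (⪯? I) (sentencesOf-unique (size I))) (∈-filter⁺ (⪯? I) flat∈ r) other ⟩
      ℤ.+ coeffM (flat U) U  ≡⟨ cong ℤ.+_ (coeffM-flat U) ⟩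
      1ℤ                     ≡⟨ 𝟙-yes (⪯? I (flat U)) r ⟨
      𝟙 (⪯? I (flat U))      ∎
      where
      -- Refinement preserves the letters and thus the size, so `flat U` is among the sentences over
      -- which F_I is summed.
      flat∈ : flat U ∈ V
      flat∈ = subst (λ n → flat U ∈ sentencesOf a n)
        (trans (size-concat (flat U)) (trans (cong length (⪯-concat {flat U} {I} r)) (sym (size-concat I))))
        (∈-sentencesOf⁺ (flat-sentence U))
    by-cases (no ¬r) = trans
      (∑-zero (filter (⪯? I) V) (λ J J∈ → other J J∈ λ { refl → ¬r (proj₂ (∈-filter⁻ (⪯? I) {xs = V} J∈)) }))
      (sym (𝟙-no (⪯? I (flat U)) ¬r))

-- Tableaux and unitriangularity

Shaped : ∀ {a} → Sent a → Filling → Set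
Shaped = Pointwise (λ w t → length t ≡ length w)

-- Lower rows come first, matching the order in which `readingCells` lists the boxes.
readingWord : Filling → List ℕ
readingWord []      = []
readingWord (t ∷ T) = readingWord T ++ t

-- Entries are numbered from 1 and the words of U from 0. Through `_!_` the list U may end in empty
-- words that the list `typeOf J T` does not have.
HasType : ∀ {a} → Sent a → Filling → List (Word a) → Set
HasType J T U = ∀ i → uAt J T (suc i) ≡ U ! i

map-proj₁-zip : {X Y : Set} (xs : List X) (ys : List Y) → length xs ≡ length ys →
  map proj₁ (zip xs ys) ≡ xs
map-proj₁-zip []       []       e = refl
map-proj₁-zip (x ∷ xs) (y ∷ ys) e = cong (x ∷_) (map-proj₁-zip xs ys (ℕP.suc-injective e))

map-proj₂-zip : {X Y : Set} (xs : List X) (ys : List Y) → length xs ≡ length ys →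
  map proj₂ (zip xs ys) ≡ ys
map-proj₂-zip []       []       e = refl
map-proj₂-zip (x ∷ xs) (y ∷ ys) e = cong (y ∷_) (map-proj₂-zip xs ys (ℕP.suc-injective e))

All-map⁻ : {X Y : Set} {f : X → Y} {P : Y → Set} {xs : List X} {ys : List Y} → map f xs ≡ ys →
  All P ys → All (λ x → P (f x)) xs
All-map⁻ refl = AllP.map⁻

readingWord⊆concat : ∀ T {e} → e ∈ readingWord T → e ∈ concat T
readingWord⊆concat (t ∷ T) e∈ with ∈-++⁻ (readingWord T) e∈
... | inj₁ p = ∈-++⁺ʳ t (readingWord⊆concat T p)
... | inj₂ p = ∈-++⁺ˡ p

≤-maximum : ∀ {e} xs → e ∈ xs → e ≤ foldr _⊔_ 0 xs
≤-maximum (x ∷ xs) (here refl) = ℕP.m≤m⊔n x _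
≤-maximum (x ∷ xs) (there e∈)  = ℕP.≤-trans (≤-maximum xs e∈) (ℕP.m≤n⊔m x _)

-- Needed for `upTo`, where g is `id`; a general g makes the induction possible, because each step
-- replaces it by `g ∘ suc`.
!-map : {X : Set} (f : ℕ → List X) (g : ℕ → ℕ) (m i : ℕ) →
  (i < m × map f (map suc (applyUpTo g m)) ! i ≡ f (suc (g i)))
  ⊎ (m ≤ i × map f (map suc (applyUpTo g m)) ! i ≡ [])
!-map f g zero    i       = inj₂ (z≤n , refl)
!-map f g (suc m) zero    = inj₁ (z<s , refl)
!-map f g (suc m) (suc i) with !-map f (g ∘ suc) m i
... | inj₁ (l , e) = inj₁ (s≤s l , e)
... | inj₂ (l , e) = inj₂ (s≤s l , e)

module _ {a : ℕ} where

  readingCells-∷ : ∀ (w : Word a) J t T → readingCells (w ∷ J) (t ∷ T) ≡ readingCells J T ++ zip t w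
  readingCells-∷ w J t T = begin
    concat (reverse (zip t w ∷ rowCells J T))
      ≡⟨ cong concat (ListP.unfold-reverse (zip t w) (rowCells J T)) ⟩
    concat (reverse (rowCells J T) ++ [ zip t w ])
      ≡⟨ ListP.concat-++ (reverse (rowCells J T)) [ zip t w ] ⟨
    readingCells J T ++ (zip t w ++ [])
      ≡⟨ cong (readingCells J T ++_) (ListP.++-identityʳ (zip t w)) ⟩
    readingCells J T ++ zip t w  ∎
    where open ≡-Reasoning

  uAt-∷ : ∀ (w : Word a) J t T i → uAt (w ∷ J) (t ∷ T) i ≡ uAt J T i ++ atIndex (zip t w) i
  uAt-∷ w J t T i = trans (cong (λ m → atIndex m i) (readingCells-∷ w J t T))
    (atIndex-++ (readingCells J T) (zip t w) i)

  readingCells-entries : ∀ {J : Sent a} {T} → Shaped J T → map proj₁ (readingCells J T) ≡ readingWord T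
  readingCells-entries []                          = refl
  readingCells-entries {w ∷ J} {t ∷ T} (e ∷ sh) = begin
    map proj₁ (readingCells (w ∷ J) (t ∷ T))
      ≡⟨ cong (map proj₁) (readingCells-∷ w J t T) ⟩
    map proj₁ (readingCells J T ++ zip t w)
      ≡⟨ ListP.map-++ proj₁ (readingCells J T) (zip t w) ⟩
    map proj₁ (readingCells J T) ++ map proj₁ (zip t w)
      ≡⟨ cong₂ _++_ (readingCells-entries sh) (map-proj₁-zip t w e) ⟩
    readingWord T ++ t  ∎
    where open ≡-Reasoning

  uAt-none : ∀ {J : Sent a} {T} i → Shaped J T → All (_≢ i) (readingWord T) → uAt J T i ≡ []
  uAt-none {J} {T} i sh h = atIndex-none (readingCells J T) i (All-map⁻ (readingCells-entries sh) h)

  ∈-fillings⁻ : ∀ {m} J {T} → T ∈ fillings {a} J m → Shaped J T × All (λ e → 1 ≤ e × e ≤ m) (readingWord T)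
  ∈-fillings⁻ {m} J T∈ = go J (∈-choices⁻ (map (λ w → listsOf (length w) (range1 m)) J) T∈)
    where
    go : ∀ J {T} → Pointwise _∈_ T (map (λ w → listsOf (length w) (range1 m)) J) →
      Shaped J T × All (λ e → 1 ≤ e × e ≤ m) (readingWord T)
    go []      []       = [] , []
    go (w ∷ J) (p ∷ ps) = let (len , h) = ∈-listsOf⁻ (length w) p
                              (sh , hs) = go J ps
      in len ∷ sh , AllP.++⁺ hs (All.map ∈-range1⁻ h)

  ∈-fillings⁺ : ∀ {m J T} → Shaped {a} J T → All (λ e → 1 ≤ e × e ≤ m) (readingWord T) → T ∈ fillings J m
  ∈-fillings⁺ {m} sh h = ∈-choices⁺ (go sh h)
    where
    go : ∀ {J T} → Shaped J T → All (λ e → 1 ≤ e × e ≤ m) (readingWord T) →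
      Pointwise _∈_ T (map (λ w → listsOf (length w) (range1 m)) J)
    go []                   h = []
    go {T = t ∷ T} (e ∷ sh) h =
      ∈-listsOf⁺ _ e (All.map (λ (l , r) → ∈-range1⁺ l r) (AllP.++⁻ʳ (readingWord T) h))
      ∷ go sh (AllP.++⁻ˡ (readingWord T) h)

  fillings-unique : ∀ (J : Sent a) m → Unique (fillings J m)
  fillings-unique J m = choices-unique (AllP.map⁺ (row-unique J))
    where
    row-unique : ∀ J → All (λ (w : Word a) → Unique (listsOf (length w) (range1 m))) J
    row-unique J = All.tabulate (λ {w} _ → listsOf-unique (length w) (range1-unique m))

  -- The list `typeOf` stops at the largest entry; past it both sides are empty.
  typeOf-! : ∀ {J : Sent a} {T} → Shaped J T → ∀ i → typeOf J T ! i ≡ uAt J T (suc i)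
  typeOf-! {J} {T} sh i with !-map (uAt J T) id (maxEntry T) i
  ... | inj₁ (_ , e) = e
  ... | inj₂ (l , e) = trans e (sym (uAt-none (suc i) sh (All.tabulate λ {e} e∈ → λ { refl →
    ℕP.<⇒≱ (s≤s l) (≤-maximum (concat T) (readingWord⊆concat T e∈)) })))

  type-monomial⁺ : ∀ {J : Sent a} {T} U → Shaped J T → HasType J T U → MonEq (xT J T) (typeMon U)
  type-monomial⁺ {J} {T} U sh h = MonEq⁺ (xT J T) (typeMon U) λ where
    zero    → trans (atIndex-typeMon-below 1 (typeOf J T) z<s) (sym (atIndex-typeMon-below 1 U z<s))
    (suc i) → trans (atIndex-typeMon 1 (typeOf J T) i)
      (trans (typeOf-! sh i) (trans (h i) (sym (atIndex-typeMon 1 U i))))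

  type-monomial⁻ : ∀ {J : Sent a} {T} U → Shaped J T → MonEq (xT J T) (typeMon U) → HasType J T U
  type-monomial⁻ {J} {T} U sh e i = begin
    uAt J T (suc i)          ≡⟨ typeOf-! sh i ⟨
    typeOf J T ! i           ≡⟨ atIndex-typeMon 1 (typeOf J T) i ⟨
    atIndex (xT J T) (suc i) ≡⟨ MonEq⁻ (xT J T) (typeMon U) e (suc i) ⟩
    atIndex (typeMon U) (suc i) ≡⟨ atIndex-typeMon 1 U i ⟩
    U ! i                    ∎
    where open ≡-Reasoning

  -- Lexicographic comparison of word lengths, blind to colours. The empty sentence is comparable
  -- with nothing; in `triangular` type and shape are shown to end together as long as their word
  -- lengths agree.
  data _⊏_ : Sent a → Sent a → Set where
    shorter : ∀ {v w J I} → length v < length w → (v ∷ J) ⊏ (w ∷ I)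
    later   : ∀ {v w J I} → length v ≡ length w → J ⊏ I → (v ∷ J) ⊏ (w ∷ I)

  ⊏-irrefl : ∀ {I} → ¬ (I ⊏ I)
  ⊏-irrefl (shorter l) = ℕP.n≮n _ l
  ⊏-irrefl (later _ p) = ⊏-irrefl p

  ⊏-trans : ∀ {I J K} → I ⊏ J → J ⊏ K → I ⊏ K
  ⊏-trans (shorter l) (shorter m) = shorter (ℕP.<-trans l m)
  ⊏-trans (shorter l) (later e q) = shorter (ℕP.<-≤-trans l (ℕP.≤-reflexive e))
  ⊏-trans (later e p) (shorter m) = shorter (ℕP.≤-<-trans (ℕP.≤-reflexive e) m)
  ⊏-trans (later e p) (later f q) = later (trans e f) (⊏-trans p q)

  -- Merging can only lengthen the first word, and keeps its length only if nothing nonempty is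
  -- merged into it; then the comparison moves on to the remaining words.
  coarsening-⋢ : ∀ {I J : Sent a} → IsSentence I → I ⪯ J → ¬ (J ⊏ I)
  coarsening-⋢ {I} {J} s r with ⪯⁻ {J = I} {I = J} r
  ... | bs , refl , h , refl = go bs h s
    where
    go : ∀ bs → All NonEmpty bs → IsSentence (concat bs) → ¬ (map concat bs ⊏ concat bs)
    go ([] ∷ bs)              (() ∷ _) s       p
    go ((g ∷ gs) ∷ bs)        (_ ∷ h)  s       (shorter l) =
      ℕP.<⇒≱ l (ℕP.≤-trans (ℕP.m≤m+n (length g) _) (ℕP.≤-reflexive (sym (ListP.length-++ g))))
    go ((g ∷ []) ∷ bs)        (_ ∷ h)  (_ ∷ s) (later e p) = go bs h s p
    go ((g ∷ (c ∷ g′) ∷ gs) ∷ bs) (_ ∷ h) (_ ∷ _ ∷ s) (later e p) =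
      ℕP.m+1+n≢m (length g) (trans (sym (ListP.length-++ g)) e)
    go ((g ∷ [] ∷ gs) ∷ bs)   (_ ∷ h)  (_ ∷ () ∷ s) (later e p)

  -- The k-th row is filled with b + k. For b = 0 this is the only tableau of shape I and type I.
  constantRows : ℕ → Sent a → Filling
  constantRows b []      = []
  constantRows b (w ∷ I) = map (λ _ → suc b) w ∷ constantRows (suc b) I

  -- Each row begins with its minimum, and these minima lie in the first column, which increases
  -- from e downward.
  rows-above : ∀ {e} {I : Sent a} {T} → IsSentence I → Shaped I T → All (Linked _≤_) T →
    Linked _<_ (e ∷ concatMap (take 1) T) → All (e <_) (readingWord T)
  rows-above [] [] rows col = []
  rows-above {I = (c ∷ w) ∷ I} {T = (f ∷ t) ∷ T} (_ ∷ s) (_ ∷ sh) (r ∷ rows) (e<f ∷ col) = AllP.++⁺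
    (All.map (ℕP.<-trans e<f) (rows-above s sh rows col))
    (e<f ∷ All.map (ℕP.<-≤-trans e<f) (AllPairs.head (LinkedP.Linked⇒AllPairs ℕP.≤-trans r)))

  -- Induction on the rows, b of which have already been removed. The lower rows exceed the first
  -- entry of the top row, which is at least b + 1, so the entries b + 1 all lie in the top row and
  -- the first word v of J is at most as long as that row. If it is equally long, the top row is
  -- constant, and the remaining words of J describe the remaining rows.
  triangular : ∀ b {I : Sent a} {T} {J} → IsSentence I → IsSentence J → Shaped I T →
    All (b <_) (readingWord T) → IsCIT T → (∀ i → uAt I T (suc b + i) ≡ J ! i) →
    (J ≡ I × T ≡ constantRows b I) ⊎ J ⊏ I
  triangular b {[]} {T = []} {[]} s s′ [] pos cit h = inj₁ (refl , refl)
  triangular b {[]} {T = []} {(_ ∷ _) ∷ _} s s′ [] pos cit h = contradiction (h 0) λ ()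
  triangular b {[]} {T = []} {[] ∷ _} s (() ∷ _) [] pos cit h
  -- A type cannot end before the shape: the first box puts the colour c into the word at index e,
  -- which lies above b.
  triangular b {(c ∷ w) ∷ I} {(e ∷ t) ∷ T} {[]} (_ ∷ s) s′ (len ∷ sh) pos cit h = contradiction empty (nonempty (uAt I T e))
    where
    open ≡-Reasoning
    e>b : b < e
    e>b = All.head (AllP.++⁻ʳ (readingWord T) pos)
    rest : List (ℕ × Fin a)
    rest = filter (λ p → proj₁ p ℕP.≟ e) (zip t w)
    nonempty : ∀ {X : Set} (xs : List X) {x ys} → xs ++ x ∷ ys ≢ []
    nonempty []       ()
    nonempty (_ ∷ xs) ()
    empty : uAt I T e ++ c ∷ map proj₂ rest ≡ []
    empty = begin
      uAt I T e ++ c ∷ map proj₂ rest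
        ≡⟨ cong (λ m → uAt I T e ++ map proj₂ m) (ListP.filter-accept (λ p → proj₁ p ℕP.≟ e) refl) ⟨
      uAt I T e ++ atIndex (zip (e ∷ t) (c ∷ w)) e
        ≡⟨ uAt-∷ (c ∷ w) I (e ∷ t) T e ⟨
      uAt ((c ∷ w) ∷ I) ((e ∷ t) ∷ T) e
        ≡⟨ cong (uAt ((c ∷ w) ∷ I) ((e ∷ t) ∷ T)) (ℕP.m+[n∸m]≡n e>b) ⟨
      uAt ((c ∷ w) ∷ I) ((e ∷ t) ∷ T) (suc b + (e ∸ suc b))
        ≡⟨ h (e ∸ suc b) ⟩
      []  ∎
  triangular b {(c ∷ w) ∷ I} {(e ∷ t) ∷ T} {v ∷ J} (_ ∷ s) (_ ∷ s′) (len ∷ sh) pos (r ∷ rows , col) h =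
    by-cases (ℕP.m≤n⇒m<n∨m≡n length-v)
    where
    open ≡-Reasoning
    row : List (ℕ × Fin a)
    row = zip (e ∷ t) (c ∷ w)
    P? : Decidable (λ (p : ℕ × Fin a) → proj₁ p ≡ suc b)
    P? p = proj₁ p ℕP.≟ suc b
    above : All (suc b <_) (readingWord T)
    above = All.map (ℕP.≤-<-trans (All.head (AllP.++⁻ʳ (readingWord T) pos))) (rows-above s sh rows col)
    v-row : map proj₂ (filter P? row) ≡ v
    v-row = begin
      atIndex row (suc b)
        ≡⟨ cong (_++ atIndex row (suc b)) (uAt-none (suc b) sh (All.map ℕP.>⇒≢ above)) ⟨
      uAt I T (suc b) ++ atIndex row (suc b)
        ≡⟨ uAt-∷ (c ∷ w) I (e ∷ t) T (suc b) ⟨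
      uAt ((c ∷ w) ∷ I) ((e ∷ t) ∷ T) (suc b)
        ≡⟨ cong (uAt ((c ∷ w) ∷ I) ((e ∷ t) ∷ T)) (ℕP.+-identityʳ (suc b)) ⟨
      uAt ((c ∷ w) ∷ I) ((e ∷ t) ∷ T) (suc b + 0)
        ≡⟨ h 0 ⟩
      v  ∎
    v-length : length (filter P? row) ≡ length v
    v-length = trans (sym (ListP.length-map proj₂ (filter P? row))) (cong length v-row)
    row-length : length row ≡ length (c ∷ w)
    row-length = trans (sym (ListP.length-map proj₂ row)) (cong length (map-proj₂-zip (e ∷ t) (c ∷ w) len))
    length-v : length v ≤ length (c ∷ w)
    length-v = subst₂ _≤_ v-length row-length (ListP.length-filter P? row)
    full : length v ≡ length (c ∷ w) → filter P? row ≡ row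
    full eq = ListP.filter-complete P? (trans v-length (trans eq (sym row-length)))
    constant : length v ≡ length (c ∷ w) → All (λ p → proj₁ p ≡ suc b) row
    constant eq = subst (All _) (full eq) (AllP.all-filter P? row)
    by-cases : length v < length (c ∷ w) ⊎ length v ≡ length (c ∷ w) →
      (v ∷ J ≡ (c ∷ w) ∷ I × (e ∷ t) ∷ T ≡ constantRows b ((c ∷ w) ∷ I)) ⊎ (v ∷ J) ⊏ ((c ∷ w) ∷ I)
    by-cases (inj₁ l)  = inj₂ (shorter l)
    by-cases (inj₂ eq) with triangular (suc b) s s′ sh above (rows , Linked.tail col) h′
      where
      h′ : ∀ i → uAt I T (suc (suc b) + i) ≡ J ! i
      h′ i = begin
        uAt I T (suc (suc b) + i)
          ≡⟨ ListP.++-identityʳ _ ⟨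
        uAt I T (suc (suc b) + i) ++ []
          -- The removed row holds only b + 1 and contributes nothing at larger indices.
          ≡⟨ cong (uAt I T (suc (suc b) + i) ++_) (atIndex-none row _
               (All.map (λ { refl → ℕP.<⇒≢ (s≤s (s≤s (ℕP.m≤m+n b i))) }) (constant eq))) ⟨
        uAt I T (suc (suc b) + i) ++ atIndex row (suc (suc b) + i)
          ≡⟨ uAt-∷ (c ∷ w) I (e ∷ t) T _ ⟨
        uAt ((c ∷ w) ∷ I) ((e ∷ t) ∷ T) (suc (suc b) + i)
          ≡⟨ cong (uAt ((c ∷ w) ∷ I) ((e ∷ t) ∷ T)) (ℕP.+-suc (suc b) i) ⟨
        uAt ((c ∷ w) ∷ I) ((e ∷ t) ∷ T) (suc b + suc i)
          ≡⟨ h (suc i) ⟩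
        J ! i  ∎
    ... | inj₂ p             = inj₂ (later eq p)
    ... | inj₁ (refl , refl) = inj₁ (cong (_∷ I) v≡ , cong (_∷ constantRows (suc b) I) t≡)
      where
      v≡ : v ≡ c ∷ w
      v≡ = trans (sym v-row) (trans (cong (map proj₂) (full eq)) (map-proj₂-zip (e ∷ t) (c ∷ w) len))
      t≡ : e ∷ t ≡ map (λ _ → suc b) (c ∷ w)
      t≡ = begin
        e ∷ t                          ≡⟨ map-proj₁-zip (e ∷ t) (c ∷ w) len ⟨
        map proj₁ row                  ≡⟨ ListP.map-cong-local (constant eq) ⟩
        map (λ _ → suc b) row          ≡⟨ ListP.map-∘ row ⟩
        map (λ _ → suc b) (map proj₂ row) ≡⟨ cong (map (λ _ → suc b)) (map-proj₂-zip (e ∷ t) (c ∷ w) len) ⟩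
        map (λ _ → suc b) (c ∷ w)      ∎

  constantRows-shaped : ∀ b (I : Sent a) → Shaped I (constantRows b I)
  constantRows-shaped b []      = []
  constantRows-shaped b (w ∷ I) = ListP.length-map _ w ∷ constantRows-shaped (suc b) I

  constantRows-bounds : ∀ b (I : Sent a) → All (λ e → b < e × e ≤ b + length I) (readingWord (constantRows b I))
  constantRows-bounds b []      = []
  constantRows-bounds b (w ∷ I) = AllP.++⁺
    (All.map (λ (l , r) → ℕP.<⇒≤ l , ℕP.≤-trans r (ℕP.≤-reflexive (sym (ℕP.+-suc b (length I)))))
      (constantRows-bounds (suc b) I))
    (AllP.map⁺ (All.tabulate (λ _ → ℕP.≤-refl , ℕP.m<m+n b z<s)))

  constantRows-CIT : ∀ b {I : Sent a} → IsSentence I → IsCIT (constantRows b I)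
  constantRows-CIT b s = rows b _ , column b s
    where
    rows : ∀ b I → All (Linked _≤_) (constantRows b I)
    rows b []      = []
    rows b (w ∷ I) = LinkedP.map⁺ (LinkedP.AllPairs⇒Linked (all-≤ w)) ∷ rows (suc b) I
      where
      all-≤ : ∀ w → AllPairs (λ _ _ → suc b ≤ suc b) w
      all-≤ []      = []
      all-≤ (_ ∷ w) = All.tabulate (λ _ → ℕP.≤-refl) ∷ all-≤ w
    column : ∀ b {I} → IsSentence I → Linked _<_ (concatMap (take 1) (constantRows b I))
    column b []                                          = []
    column b {(c ∷ w) ∷ []}               (_ ∷ [])       = [-]
    column b {(c ∷ w) ∷ (d ∷ v) ∷ I}      (_ ∷ s)        = ℕP.≤-refl ∷ column (suc b) s
    column b {(c ∷ w) ∷ [] ∷ I}           (_ ∷ () ∷ _)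

  constantRows-type : ∀ b (I : Sent a) i → uAt I (constantRows b I) (suc b + i) ≡ I ! i
  constantRows-type b []      i = refl
  constantRows-type b (w ∷ I) i = trans (uAt-∷ w I _ _ (suc b + i))
    (trans (cong (λ m → uAt I (constantRows (suc b) I) (suc b + i) ++ atIndex m (suc b + i)) (zip-xw w)) (at i))
    where
    zip-xw : ∀ w → zip (map (λ _ → suc b) w) w ≡ xw w (suc b)
    zip-xw []      = refl
    zip-xw (c ∷ w) = cong ((suc b , c) ∷_) (zip-xw w)
    at : ∀ i → uAt I (constantRows (suc b) I) (suc b + i) ++ atIndex (xw w (suc b)) (suc b + i) ≡ (w ∷ I) ! i
    at zero rewrite ℕP.+-identityʳ b = cong₂ _++_
      (uAt-none (suc b) (constantRows-shaped (suc b) I)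
        (All.map (λ (l , _) → ℕP.>⇒≢ l) (constantRows-bounds (suc b) I)))
      (atIndex-xw w (suc b))
    at (suc i) rewrite ℕP.+-suc b i = trans (cong₂ _++_
      (constantRows-type (suc b) I i) (atIndex-xw-other w (ℕP.<⇒≢ (s≤s (s≤s (ℕP.m≤m+n b i))))))
      (ListP.++-identityʳ (I ! i))

  coeffS-diagonal : {I : Sent a} → IsSentence I → coeffS I I ≡ 1
  coeffS-diagonal {I} s = count-one (λ T → monEq? (typeMon I) (xT I T))
    (UniqueP.filter⁺ isCIT? (fillings-unique I (length I)))
    (∈-filter⁺ isCIT? (∈-fillings⁺ (constantRows-shaped 0 I) (constantRows-bounds 0 I)) (constantRows-CIT 0 s))
    (type-monomial⁺ I (constantRows-shaped 0 I) (constantRows-type 0 I))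
    λ T∈ e → unique (∈-filter⁻ isCIT? {xs = fillings I (length I)} T∈) e
    where
    unique : ∀ {T} → T ∈ fillings I (length I) × IsCIT T → MonEq (xT I T) (typeMon I) → T ≡ constantRows 0 I
    unique (T∈ , cit) e with ∈-fillings⁻ I T∈
    ... | sh , pos with triangular 0 s s sh (All.map proj₁ pos) cit (type-monomial⁻ I sh e)
    ... | inj₁ (_ , T≡) = T≡
    ... | inj₂ I⊏I      = contradiction I⊏I ⊏-irrefl

  coeffS-triangular : {I J : Sent a} → IsSentence I → IsSentence J → coeffS I J ≢ 0 → J ≡ I ⊎ J ⊏ I
  coeffS-triangular {I} {J} s s′ c≢0 = exists (filter (λ T → monEq? (typeMon J) (xT I T)) (filter isCIT? (fillings I (length J))))
    refl c≢0
    where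
    exists : ∀ Ts → filter (λ T → monEq? (typeMon J) (xT I T)) (filter isCIT? (fillings I (length J))) ≡ Ts →
      length Ts ≢ 0 → J ≡ I ⊎ J ⊏ I
    exists []       _  ≢0 = contradiction refl ≢0
    exists (T ∷ Ts) eq _ with ∈-filter⁻ (λ T → monEq? (typeMon J) (xT I T))
      {xs = filter isCIT? (fillings I (length J))} (subst (T ∈_) (sym eq) (here refl))
    ... | T∈ , e with ∈-filter⁻ isCIT? {xs = fillings I (length J)} T∈
    ... | T∈′ , cit with ∈-fillings⁻ I T∈′
    ... | sh , pos with triangular 0 s s′ sh (All.map proj₁ pos) cit (type-monomial⁻ J sh e)
    ... | inj₁ (J≡I , _) = inj₁ J≡I
    ... | inj₂ J⊏I       = inj₂ J⊏I

-- Standardization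

module _ {X : Set} where

  filter-map : {Y : Set} {P : Y → Set} (P? : Decidable P) (f : X → Y) (xs : List X) →
    filter P? (map f xs) ≡ map f (filter (λ x → P? (f x)) xs)
  filter-map P? f []       = refl
  filter-map P? f (x ∷ xs) with P? (f x)
  ... | yes _ = cong (f x ∷_) (filter-map P? f xs)
  ... | no  _ = filter-map P? f xs

  filter-refine : {P Q : X → Set} (P? : Decidable P) (Q? : Decidable Q) → (∀ {x} → P x → Q x) →
    ∀ xs → filter P? (filter Q? xs) ≡ filter P? xs
  filter-refine P? Q? h []       = refl
  filter-refine P? Q? h (x ∷ xs) with Q? x
  ... | no ¬q = trans (filter-refine P? Q? h xs) (sym (ListP.filter-reject P? (¬q ∘ h)))
  ... | yes _ with P? x
  ... | yes _ = cong (x ∷_) (filter-refine P? Q? h xs)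
  ... | no _  = filter-refine P? Q? h xs

  AllPairs-cross : ∀ {R : X → X → Set} xs {ys} → AllPairs R (xs ++ ys) →
    ∀ {x y} → x ∈ xs → y ∈ ys → R x y
  AllPairs-cross (x ∷ xs) (r ∷ _) (here refl) y∈ = All.lookup r (∈-++⁺ʳ xs y∈)
  AllPairs-cross (x ∷ xs) (_ ∷ s) (there x∈)  y∈ = AllPairs-cross xs s x∈ y∈

  AllPairs-++⁻ : ∀ {R : X → X → Set} xs {ys} → AllPairs R (xs ++ ys) → AllPairs R xs × AllPairs R ys
  AllPairs-++⁻ []       s       = [] , s
  AllPairs-++⁻ (x ∷ xs) (r ∷ s) = let (p , q) = AllPairs-++⁻ xs s in AllP.++⁻ˡ xs r ∷ p , q

  AllPairs-filter : {R : X → X → Set} {P : X → Set} (P? : Decidable P) {xs : List X} →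
    AllPairs (λ x y → P x → P y → R x y) xs → AllPairs R (filter P? xs)
  AllPairs-filter P? []                    = []
  AllPairs-filter P? (_∷_ {x} {xs} r s) with P? x
  ... | yes p = All.zipWith (λ (f , q) → f p q) (AllP.filter⁺ P? r , AllP.all-filter P? xs) ∷ AllPairs-filter P? s
  ... | no _  = AllPairs-filter P? s

  AllPairs-filter-tail : {R : X → X → Set} {P : X → Set} (P? : Decidable P) {x : X} {xs : List X} →
    AllPairs R (filter P? (x ∷ xs)) → AllPairs R (filter P? xs)
  AllPairs-filter-tail P? {x} s with P? x | s
  ... | yes _ | _ ∷ s′ = s′
  ... | no _  | s′     = s′

  -- By asymmetry the two heads cannot each lie in the tail of the other list, so they coincide;
  -- irreflexivity then removes them from the membership assumptions.
  sorted-≡ : {R : X → X → Set} → (∀ {x} → ¬ R x x) → (∀ {x y} → R x y → ¬ R y x) →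
    ∀ {xs ys} → AllPairs R xs → AllPairs R ys →
    (∀ {x} → x ∈ xs → x ∈ ys) → (∀ {x} → x ∈ ys → x ∈ xs) → xs ≡ ys
  sorted-≡ irr asy {[]}     {[]}     []       []       f g = refl
  sorted-≡ irr asy {[]}     {y ∷ ys} sx       sy       f g = contradiction (g (here refl)) λ ()
  sorted-≡ irr asy {x ∷ xs} {[]}     sx       sy       f g = contradiction (f (here refl)) λ ()
  sorted-≡ {R} irr asy {x ∷ xs} {y ∷ ys} (x< ∷ sx) (y< ∷ sy) f g with heads (f (here refl)) (g (here refl))
    where
    heads : x ∈ y ∷ ys → y ∈ x ∷ xs → x ≡ y
    heads (here e)  _         = e
    heads (there _) (here e)  = sym e
    heads (there p) (there q) = contradiction (All.lookup x< q) (asy (All.lookup y< p))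
  ... | refl = cong (x ∷_) (sorted-≡ irr asy sx sy
    (λ p → strip x< p (f (there p))) (λ p → strip y< p (g (there p))))
    where
    strip : ∀ {zs zs′ z} → All (R x) zs → z ∈ zs → z ∈ x ∷ zs′ → z ∈ zs′
    strip x< p (here refl) = contradiction (All.lookup x< p) irr
    strip x< p (there q)   = q

module _ {X : Set} where

  at : List X → ℕ → Maybe X
  at []       i       = nothing
  at (x ∷ xs) zero    = just x
  at (x ∷ xs) (suc i) = at xs i

  at-ext : ∀ {xs ys : List X} → (∀ i → at xs i ≡ at ys i) → xs ≡ ys
  at-ext {[]}     {[]}     h = refl
  at-ext {[]}     {y ∷ ys} h = contradiction (h 0) λ ()
  at-ext {x ∷ xs} {[]}     h = contradiction (h 0) λ ()
  at-ext {x ∷ xs} {y ∷ ys} h = cong₂ _∷_ (MaybeP.just-injective (h 0)) (at-ext (h ∘ suc))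

  -- The index of the word of U that contains the s-th letter of concat U (length U if there is none).
  blk : List (List X) → ℕ → ℕ
  blk []            s       = 0
  blk ([] ∷ U)      s       = suc (blk U s)
  blk ((c ∷ u) ∷ U) zero    = 0
  blk ((c ∷ u) ∷ U) (suc s) = blk (u ∷ U) s

  blk-step : ∀ U s → blk U s ≤ blk U (suc s)
  blk-step []            s       = z≤n
  blk-step ([] ∷ U)      s       = s≤s (blk-step U s)
  blk-step ((c ∷ u) ∷ U) zero    = z≤n
  blk-step ((c ∷ u) ∷ U) (suc s) = blk-step (u ∷ U) s

  blk-bound : ∀ U s → s < length (concat U) → blk U s < length U
  blk-bound ([] ∷ U)      s       s<       = s≤s (blk-bound U s s<)
  blk-bound ((c ∷ u) ∷ U) zero    s<       = z<s
  blk-bound ((c ∷ u) ∷ U) (suc s) (s≤s s<) = blk-bound (u ∷ U) s s<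

  blk-mono : ∀ U {s t} → s ≤ t → blk U s ≤ blk U t
  blk-mono U {s} {t} s≤t = subst (λ t → blk U s ≤ blk U t) (ℕP.m∸n+n≡m s≤t) (go (t ∸ s))
    where
    go : ∀ d → blk U s ≤ blk U (d + s)
    go zero    = ℕP.≤-refl
    go (suc d) = ℕP.≤-trans (go d) (blk-step U (d + s))

  -- The version of `blk` for labels: labels and blocks are numbered from 1, whereas `blk` counts
  -- both letters and words from 0. In particular, 0 is never a block.
  block : List (List X) → ℕ → ℕ
  block U e = suc (blk U (pred e))

  block-mono : ∀ U {s t} → s ≤ t → block U s ≤ block U t
  block-mono U s≤t = s≤s (blk-mono U (ℕP.pred-mono-≤ s≤t))

  indexed : List X → List (ℕ × X)
  indexed []       = []
  indexed (x ∷ xs) = (0 , x) ∷ map (map₁ suc) (indexed xs)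

  indexed-sorted : ∀ xs → AllPairs (_<_ on proj₁) (indexed xs)
  indexed-sorted []       = []
  indexed-sorted (x ∷ xs) = AllP.map⁺ (All.tabulate (λ _ → z<s))
    ∷ AllPairsP.map⁺ (AllPairs.map s≤s (indexed-sorted xs))

  indexed-bound : ∀ xs → All (λ p → proj₁ p < length xs) (indexed xs)
  indexed-bound []       = []
  indexed-bound (x ∷ xs) = z<s ∷ AllP.map⁺ (All.map s≤s (indexed-bound xs))

  indexed-length : ∀ xs → length (indexed xs) ≡ length xs
  indexed-length []       = refl
  indexed-length (x ∷ xs) = cong suc (trans (ListP.length-map _ (indexed xs)) (indexed-length xs))

  -- Induction letter by letter: removing the first letter of a word lowers the later letter numbers
  -- by one but keeps their blocks, while removing an empty first word lowers all block numbers by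
  -- one.
  indexed-block : ∀ U i → map proj₂ (filter (λ p → blk U (proj₁ p) ℕP.≟ i) (indexed (concat U))) ≡ U ! i
  indexed-block []            i       = refl
  indexed-block ([] ∷ U)      zero    = cong (map proj₂)
    (ListP.filter-none (λ p → suc (blk U (proj₁ p)) ℕP.≟ 0) (All.tabulate {xs = indexed (concat U)} (λ _ ())))
  indexed-block ([] ∷ U)      (suc i) = trans
    (cong (map proj₂) (ListP.filter-≐ (λ p → suc (blk U (proj₁ p)) ℕP.≟ suc i) (λ p → blk U (proj₁ p) ℕP.≟ i)
      (ℕP.suc-injective , cong suc) (indexed (concat U))))
    (indexed-block U i)
  indexed-block ((c ∷ u) ∷ U) i       = by-index i (trans
    (cong (map proj₂) (filter-map (λ p → blk ((c ∷ u) ∷ U) (proj₁ p) ℕP.≟ i) (map₁ suc) (indexed (u ++ concat U))))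
    (trans (sym (ListP.map-∘ (filter (λ p → blk (u ∷ U) (proj₁ p) ℕP.≟ i) (indexed (u ++ concat U)))))
      (indexed-block (u ∷ U) i)))
    where
    rest : List (ℕ × X)
    rest = map (map₁ suc) (indexed (u ++ concat U))
    by-index : ∀ i → map proj₂ (filter (λ p → blk ((c ∷ u) ∷ U) (proj₁ p) ℕP.≟ i) rest) ≡ (u ∷ U) ! i →
      map proj₂ (filter (λ p → blk ((c ∷ u) ∷ U) (proj₁ p) ℕP.≟ i) ((0 , c) ∷ rest)) ≡ ((c ∷ u) ∷ U) ! i
    by-index zero    e = cong (c ∷_) e
    by-index (suc i) e = e

toList : {X : Set} → Maybe X → List X
toList nothing  = []
toList (just x) = [ x ]

readingWord-map : ∀ (f : ℕ → ℕ) S → readingWord (map (map f) S) ≡ map f (readingWord S)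
readingWord-map f []      = refl
readingWord-map f (t ∷ S) = trans (cong (_++ map f t) (readingWord-map f S)) (sym (ListP.map-++ f (readingWord S) t))

pairs-≡ : {X Y : Set} {ps qs : List (X × Y)} → map proj₁ ps ≡ map proj₁ qs → map proj₂ ps ≡ map proj₂ qs →
  ps ≡ qs
pairs-≡ {ps = []}     {[]}     e f = refl
pairs-≡ {ps = p ∷ ps} {q ∷ qs} e f = cong₂ _∷_
  (cong₂ _,_ (ListP.∷-injectiveˡ e) (ListP.∷-injectiveˡ f))
  (pairs-≡ (ListP.∷-injectiveʳ e) (ListP.∷-injectiveʳ f))

heads-⊆ : ∀ T {e} → e ∈ concatMap (take 1) T → e ∈ readingWord T
heads-⊆ ([] ∷ T)      e∈          = ∈-++⁺ˡ (heads-⊆ T e∈)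
heads-⊆ ((x ∷ t) ∷ T) (here refl) = ∈-++⁺ʳ (readingWord T) (here refl)
heads-⊆ ((x ∷ t) ∷ T) (there e∈)  = ∈-++⁺ˡ (heads-⊆ T e∈)

-- Relabelling can be done on the reading word alone: the rows of T show where to cut the new word
-- into rows.
unmap : ∀ {f : ℕ → ℕ} T {W} → map f W ≡ readingWord T → ∃[ S ] map (map f) S ≡ T × readingWord S ≡ W
unmap []      {[]} e = [] , refl , refl
unmap (t ∷ T) {W}  e with split (readingWord T) W e
  where
  split : ∀ {f : ℕ → ℕ} xs {ys} W → map f W ≡ xs ++ ys → ∃[ A ] ∃[ B ] W ≡ A ++ B × map f A ≡ xs × map f B ≡ ys
  split []       W       e = [] , W , refl , refl , e
  split (x ∷ xs) (y ∷ W) e = let (A , B , p , q , r) = split xs W (ListP.∷-injectiveʳ e)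
    in y ∷ A , B , cong (y ∷_) p , cong₂ _∷_ (ListP.∷-injectiveˡ e) q , r
... | A , B , refl , p , q with unmap T p
... | S , refl , refl = B ∷ S , cong (_∷ _) q , refl

module _ {a : ℕ} where

  inBlock? : (U : List (Word a)) (i : ℕ) → Decidable (λ (p : ℕ × Fin a) → block U (proj₁ p) ≡ i)
  inBlock? U i p = block U (proj₁ p) ℕP.≟ i

  -- The cells that a standardization must have, listed by label: the letters of `concat U` numbered
  -- from 1.
  reference : List (Word a) → Mon a
  reference U = map (map₁ suc) (indexed (concat U))

  reference-sorted : ∀ U → AllPairs (_<_ on proj₁) (reference U)
  reference-sorted U = AllPairsP.map⁺ (AllPairs.map s≤s (indexed-sorted (concat U)))

  reference-bound : ∀ U → All (λ p → 1 ≤ proj₁ p × proj₁ p ≤ length (concat U)) (reference U)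
  reference-bound U = AllP.map⁺ (All.map (λ l → s≤s z≤n , l) (indexed-bound (concat U)))

  reference-length : ∀ U → length (reference U) ≡ length (concat U)
  reference-length U = trans (ListP.length-map _ (indexed (concat U))) (indexed-length (concat U))

  reference-block : ∀ U i → map proj₂ (filter (inBlock? U (suc i)) (reference U)) ≡ U ! i
  reference-block U i = begin
    map proj₂ (filter (inBlock? U (suc i)) (map (map₁ suc) (indexed (concat U))))
      ≡⟨ cong (map proj₂) (filter-map (inBlock? U (suc i)) (map₁ suc) (indexed (concat U))) ⟩
    map proj₂ (map (map₁ suc) (filter (λ p → suc (blk U (proj₁ p)) ℕP.≟ suc i) (indexed (concat U))))
      ≡⟨ ListP.map-∘ (filter (λ p → suc (blk U (proj₁ p)) ℕP.≟ suc i) (indexed (concat U))) ⟨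
    map proj₂ (filter (λ p → suc (blk U (proj₁ p)) ℕP.≟ suc i) (indexed (concat U)))
      ≡⟨ cong (map proj₂) (ListP.filter-≐ (λ p → suc (blk U (proj₁ p)) ℕP.≟ suc i)
           (λ p → blk U (proj₁ p) ℕP.≟ i) (ℕP.suc-injective , cong suc) (indexed (concat U))) ⟩
    map proj₂ (filter (λ p → blk U (proj₁ p) ℕP.≟ i) (indexed (concat U)))
      ≡⟨ indexed-block U i ⟩
    U ! i  ∎
    where open ≡-Reasoning

  atIndex-shift : (m : Mon a) (i : ℕ) → atIndex (map (map₁ suc) m) (suc i) ≡ atIndex m i
  atIndex-shift m i = begin
    map proj₂ (filter (λ p → proj₁ p ℕP.≟ suc i) (map (map₁ suc) m))
      ≡⟨ cong (map proj₂) (filter-map (λ p → proj₁ p ℕP.≟ suc i) (map₁ suc) m) ⟩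
    map proj₂ (map (map₁ suc) (filter (λ p → suc (proj₁ p) ℕP.≟ suc i) m))
      ≡⟨ ListP.map-∘ (filter (λ p → suc (proj₁ p) ℕP.≟ suc i) m) ⟨
    map proj₂ (filter (λ p → suc (proj₁ p) ℕP.≟ suc i) m)
      ≡⟨ cong (map proj₂) (ListP.filter-≐ (λ p → suc (proj₁ p) ℕP.≟ suc i) (λ p → proj₁ p ℕP.≟ i)
           (ℕP.suc-injective , cong suc) m) ⟩
    atIndex m i  ∎
    where open ≡-Reasoning

  atIndex-indexed : (w : Word a) (i : ℕ) → atIndex (indexed w) i ≡ toList (at w i)
  atIndex-indexed []      i       = refl
  atIndex-indexed (c ∷ w) zero    = cong (c ∷_)
    (atIndex-none (map (map₁ suc) (indexed w)) 0 (AllP.map⁺ (All.tabulate {xs = indexed w} (λ _ ()))))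
  atIndex-indexed (c ∷ w) (suc i) = trans (atIndex-shift (indexed w) i) (atIndex-indexed w i)

  atIndex-reference : ∀ U i → atIndex (reference U) (suc i) ≡ toList (at (concat U) i)
  atIndex-reference U i = trans (atIndex-shift (indexed (concat U)) i) (atIndex-indexed (concat U) i)

  ∈-atIndex⁺ : ∀ {m : Mon a} {e c} → (e , c) ∈ m → c ∈ atIndex m e
  ∈-atIndex⁺ {m} {e} p = ∈-map⁺ proj₂ (∈-filter⁺ (λ p → proj₁ p ℕP.≟ e) p refl)

  ∈-atIndex⁻ : ∀ {m : Mon a} {e c} → c ∈ atIndex m e → (e , c) ∈ m
  ∈-atIndex⁻ {m} {e} c∈ with ∈-map⁻ proj₂ c∈
  ... | (_ , _) , p , refl with ∈-filter⁻ (λ p → proj₁ p ℕP.≟ e) {xs = m} p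
  ... | q , refl = q

  -- The rule by which standardization breaks ties: equal entries of the coarse tableau receive
  -- increasing labels in reading order. Since it relates all pairs of places, it also excludes
  -- repeated labels.
  BlockSorted : List (Word a) → List ℕ → Set
  BlockSorted U = AllPairs (λ x y → block U x ≡ block U y → x < y)

  -- The cells of each block of U, in reading order, are the cells of that block of the reference word.
  -- This says both that U is the type of the image of S under block U and that
  -- S is the standardization of that image.
  Compatible : Sent a → Filling → List (Word a) → Set
  Compatible I S U = ∀ i → filter (inBlock? U i) (readingCells I S) ≡ filter (inBlock? U i) (reference U)

  -- All cells with label e lie in the block of e, so they can be selected after that block has been
  -- selected.
  block-atIndex : ∀ U (m m′ : Mon a) → (∀ i → filter (inBlock? U i) m ≡ filter (inBlock? U i) m′) →
    ∀ e → atIndex m e ≡ atIndex m′ e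
  block-atIndex U m m′ h e = cong (map proj₂) (begin
    filter (λ p → proj₁ p ℕP.≟ e) m
      ≡⟨ filter-refine (λ p → proj₁ p ℕP.≟ e) (inBlock? U (block U e)) (cong (block U)) m ⟨
    filter (λ p → proj₁ p ℕP.≟ e) (filter (inBlock? U (block U e)) m)
      ≡⟨ cong (filter (λ p → proj₁ p ℕP.≟ e)) (h (block U e)) ⟩
    filter (λ p → proj₁ p ℕP.≟ e) (filter (inBlock? U (block U e)) m′)
      ≡⟨ filter-refine (λ p → proj₁ p ℕP.≟ e) (inBlock? U (block U e)) (cong (block U)) m′ ⟩
    filter (λ p → proj₁ p ℕP.≟ e) m′  ∎)
    where open ≡-Reasoning

  block-∈ : ∀ (m m′ : Mon a) → (∀ e → atIndex m e ≡ atIndex m′ e) → ∀ {p} → p ∈ m → p ∈ m′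
  block-∈ m m′ h {e , c} p = ∈-atIndex⁻ {m′} (subst (c ∈_) (h e) (∈-atIndex⁺ {m} p))

  module _ {I : Sent a} {S : Filling} {U : List (Word a)} (sh : Shaped I S) where

    -- Within a block both lists of cells have strictly increasing labels and the same members, so
    -- they are equal.
    compatible⁺ : BlockSorted U (readingWord S) →
      (∀ e → atIndex (readingCells I S) e ≡ atIndex (reference U) e) → Compatible I S U
    compatible⁺ bs h i = sorted-≡ (ℕP.n≮n _) ℕP.<-asym
      (sorted (readingCells I S) (AllPairsP.map⁻ (subst (BlockSorted U) (sym (readingCells-entries sh)) bs)))
      (AllPairsP.filter⁺ (inBlock? U i) (reference-sorted U))
      (transport (readingCells I S) (reference U) h)
      (transport (reference U) (readingCells I S) (sym ∘ h))
      where
      sorted : ∀ (m : Mon a) → AllPairs (λ p q → block U (proj₁ p) ≡ block U (proj₁ q) → proj₁ p < proj₁ q) m →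
        AllPairs (_<_ on proj₁) (filter (inBlock? U i) m)
      sorted m s = AllPairs-filter (inBlock? U i) (AllPairs.map (λ { f e e′ → f (trans e (sym e′)) }) s)
      transport : ∀ m m′ → (∀ e → atIndex m e ≡ atIndex m′ e) →
        ∀ {p} → p ∈ filter (inBlock? U i) m → p ∈ filter (inBlock? U i) m′
      transport m m′ h p∈ with ∈-filter⁻ (inBlock? U i) {xs = m} p∈
      ... | q , e = ∈-filter⁺ (inBlock? U i) {xs = m′} (block-∈ m m′ h q) e

    module _ (comp : Compatible I S U) where

      compatible-sorted : BlockSorted U (readingWord S)
      compatible-sorted = subst (BlockSorted U) (readingCells-entries sh)
        (AllPairsP.map⁺ (by-class (readingCells I S) (λ i →
          subst (AllPairs (_<_ on proj₁)) (sym (comp i)) (AllPairsP.filter⁺ (inBlock? U i) (reference-sorted U)))))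
        where
        by-class : ∀ (m : Mon a) → (∀ i → AllPairs (_<_ on proj₁) (filter (inBlock? U i) m)) →
          AllPairs (λ p q → block U (proj₁ p) ≡ block U (proj₁ q) → proj₁ p < proj₁ q) m
        by-class []      h = []
        -- The cell p is the first one of its own block, so its label is smaller than that of every
        -- later cell of the block.
        by-class (p ∷ m) h = All.tabulate (λ q∈ e → All.lookup
            (AllPairs.head (subst (AllPairs (_<_ on proj₁))
              (ListP.filter-accept (inBlock? U (block U (proj₁ p))) {p} {m} refl) (h (block U (proj₁ p)))))
            (∈-filter⁺ (inBlock? U (block U (proj₁ p))) q∈ (sym e)))
          ∷ by-class m (λ i → AllPairs-filter-tail (inBlock? U i) (h i))

      compatible-atIndex : ∀ e → atIndex (readingCells I S) e ≡ atIndex (reference U) e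
      compatible-atIndex = block-atIndex U (readingCells I S) (reference U) comp

      -- Equal cells would share a block and contradict the strict order there, so the reading cells
      -- are distinct, as are those of the reference; having the same members, the two lists are
      -- equally long.
      compatible-size : size I ≡ length (concat U)
      compatible-size = trans (sym (cells-length sh)) (trans
        (length-≡ (unique (readingCells I S) (AllPairsP.map⁻
            (subst (BlockSorted U) (sym (readingCells-entries sh)) compatible-sorted)))
          (AllPairs.map (λ { l refl → ℕP.n≮n _ l }) (reference-sorted U))
          (block-∈ (readingCells I S) (reference U) compatible-atIndex)
          (block-∈ (reference U) (readingCells I S) (sym ∘ compatible-atIndex)))
        (reference-length U))
        where
        unique : ∀ (m : Mon a) → AllPairs (λ p q → block U (proj₁ p) ≡ block U (proj₁ q) → proj₁ p < proj₁ q) m →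
          Unique m
        unique m = AllPairs.map λ { f refl → ℕP.n≮n _ (f refl) }
        cells-length : ∀ {J T} → Shaped J T → length (readingCells J T) ≡ size J
        cells-length []                        = refl
        cells-length {w ∷ J} {t ∷ T} (e ∷ sh) = begin
          length (readingCells (w ∷ J) (t ∷ T))     ≡⟨ cong length (readingCells-∷ w J t T) ⟩
          length (readingCells J T ++ zip t w)      ≡⟨ ListP.length-++ (readingCells J T) ⟩
          length (readingCells J T) + length (zip t w)
            ≡⟨ cong₂ _+_ (cells-length sh)
                 (trans (sym (ListP.length-map proj₂ (zip t w))) (cong length (map-proj₂-zip t w e))) ⟩
          size J + length w                         ≡⟨ ℕP.+-comm (size J) (length w) ⟩
          length w + size J                         ∎
          where open ≡-Reasoning

      compatible-bound : All (λ e → 1 ≤ e × e ≤ length (concat U)) (readingWord S)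
      compatible-bound = subst (All _) (readingCells-entries sh) (AllP.map⁺ (All.tabulate (λ p∈ →
        All.lookup (reference-bound U) (block-∈ (readingCells I S) (reference U) compatible-atIndex p∈))))

  shaped-map⁺ : ∀ (f : ℕ → ℕ) {I : Sent a} {S} → Shaped I S → Shaped I (map (map f) S)
  shaped-map⁺ f []       = []
  shaped-map⁺ f {S = t ∷ S} (e ∷ sh) = trans (ListP.length-map f t) e ∷ shaped-map⁺ f sh

  shaped-map⁻ : ∀ (f : ℕ → ℕ) {I : Sent a} S → Shaped I (map (map f) S) → Shaped I S
  shaped-map⁻ f []      []       = []
  shaped-map⁻ f (s ∷ S) (e ∷ sh) = trans (sym (ListP.length-map f s)) e ∷ shaped-map⁻ f S sh

  readingCells-map : ∀ (f : ℕ → ℕ) (I : Sent a) S →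
    readingCells I (map (map f) S) ≡ map (map₁ f) (readingCells I S)
  readingCells-map f []      S       = refl
  readingCells-map f (w ∷ I) []      = refl
  readingCells-map f (w ∷ I) (t ∷ S) = begin
    readingCells (w ∷ I) (map f t ∷ map (map f) S)
      ≡⟨ readingCells-∷ w I (map f t) (map (map f) S) ⟩
    readingCells I (map (map f) S) ++ zip (map f t) w
      ≡⟨ cong₂ _++_ (readingCells-map f I S) (zip-map t w) ⟩
    map (map₁ f) (readingCells I S) ++ map (map₁ f) (zip t w)
      ≡⟨ ListP.map-++ (map₁ f) (readingCells I S) (zip t w) ⟨
    map (map₁ f) (readingCells I S ++ zip t w)
      ≡⟨ cong (map (map₁ f)) (readingCells-∷ w I t S) ⟨
    map (map₁ f) (readingCells (w ∷ I) (t ∷ S))  ∎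
    where
    open ≡-Reasoning
    zip-map : ∀ t (w : Word a) → zip (map f t) w ≡ map (map₁ f) (zip t w)
    zip-map []      w       = refl
    zip-map (x ∷ t) []      = refl
    zip-map (x ∷ t) (c ∷ w) = cong ((f x , c) ∷_) (zip-map t w)

  uAt-map : ∀ (f : ℕ → ℕ) (I : Sent a) S i →
    uAt I (map (map f) S) i ≡ map proj₂ (filter (λ p → f (proj₁ p) ℕP.≟ i) (readingCells I S))
  uAt-map f I S i = begin
    map proj₂ (filter (λ p → proj₁ p ℕP.≟ i) (readingCells I (map (map f) S)))
      ≡⟨ cong (λ m → map proj₂ (filter (λ p → proj₁ p ℕP.≟ i) m)) (readingCells-map f I S) ⟩
    map proj₂ (filter (λ p → proj₁ p ℕP.≟ i) (map (map₁ f) (readingCells I S)))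
      ≡⟨ cong (map proj₂) (filter-map (λ p → proj₁ p ℕP.≟ i) (map₁ f) (readingCells I S)) ⟩
    map proj₂ (map (map₁ f) (filter (λ p → f (proj₁ p) ℕP.≟ i) (readingCells I S)))
      ≡⟨ ListP.map-∘ (filter (λ p → f (proj₁ p) ℕP.≟ i) (readingCells I S)) ⟨
    map proj₂ (filter (λ p → f (proj₁ p) ℕP.≟ i) (readingCells I S))  ∎
    where open ≡-Reasoning

  compatible-type : ∀ {I S U} → Compatible I S U → HasType I (map (map (block U)) S) U
  compatible-type {I} {S} {U} comp i = trans (uAt-map (block U) I S (suc i))
    (trans (cong (map proj₂) (comp (suc i))) (reference-block U i))

  -- Along a reading word sorted in each block, comparing two entries is the same as comparing their blocks.
  module _ (U : List (Word a)) where

    block-<⁻ : ∀ {x y} → block U x < block U y → x < y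
    block-<⁻ l = ℕP.≰⇒> (λ y≤x → ℕP.<⇒≱ l (block-mono U y≤x))

    -- Lower rows are read first, so down the first column the inequality inside a block is
    -- reversed.
    heads-sorted : ∀ T → BlockSorted U (readingWord T) →
      AllPairs (λ x y → block U y ≡ block U x → y < x) (concatMap (take 1) T)
    heads-sorted []            s = []
    heads-sorted ([] ∷ T)      s = heads-sorted T (proj₁ (AllPairs-++⁻ (readingWord T) s))
    heads-sorted ((x ∷ t) ∷ T) s =
      All.tabulate (λ y∈ → AllPairs-cross (readingWord T) s (heads-⊆ T y∈) (here refl))
      ∷ heads-sorted T (proj₁ (AllPairs-++⁻ (readingWord T) s))

    heads-map : ∀ T → concatMap (take 1) (map (map (block U)) T) ≡ map (block U) (concatMap (take 1) T)
    heads-map []            = refl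
    heads-map ([] ∷ T)      = heads-map T
    heads-map ((x ∷ t) ∷ T) = cong (block U x ∷_) (heads-map T)

    -- Only strictness in the first column is at stake: two of its labels in one block would
    -- decrease downward by `heads-sorted`, while the column increases.
    CIT-map⁺ : ∀ {S} → BlockSorted U (readingWord S) → IsCIT S → IsCIT (map (map (block U)) S)
    CIT-map⁺ {S} s (rows , column) =
      AllP.map⁺ (All.map (λ r → LinkedP.map⁺ (Linked.map (block-mono U) r)) rows) ,
      subst (Linked _<_) (sym (heads-map S)) (LinkedP.map⁺ (Linked.zipWith
        (λ (f , l) → ℕP.≤∧≢⇒< (block-mono U (ℕP.<⇒≤ l)) (λ e → ℕP.<-asym l (f (sym e))))
        (LinkedP.AllPairs⇒Linked (heads-sorted S s) , column)))

    -- Along a row, labels of one block increase because a row is read from left to right, and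
    -- labels of different blocks are ordered as their blocks. In the first column the blocks
    -- already differ.
    CIT-map⁻ : ∀ {S} → BlockSorted U (readingWord S) → IsCIT (map (map (block U)) S) → IsCIT S
    CIT-map⁻ {S} s (rows , column) = row-wise S s (AllP.map⁻ rows) ,
      Linked.map block-<⁻ (LinkedP.map⁻ (subst (Linked _<_) (heads-map S) column))
      where
      compare : ∀ {x y} → (block U x ≡ block U y → x < y) × block U x ≤ block U y → x ≤ y
      compare (f , l) with ℕP.m≤n⇒m<n∨m≡n l
      ... | inj₁ l′ = ℕP.<⇒≤ (block-<⁻ l′)
      ... | inj₂ e  = ℕP.<⇒≤ (f e)
      row-wise : ∀ S → BlockSorted U (readingWord S) → All (λ t → Linked _≤_ (map (block U) t)) S →
        All (Linked _≤_) S
      row-wise []      s []       = []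
      row-wise (t ∷ S) s (r ∷ rs) = let (p , q) = AllPairs-++⁻ (readingWord S) s in
        Linked.zipWith compare (LinkedP.AllPairs⇒Linked q , LinkedP.map⁻ r) ∷ row-wise S p rs

    -- Standardization of a word. The queue `q e` holds the labels still available for the letter e;
    -- each letter takes the first label of its queue. The lengths guarantee that no queue runs out
    -- early and that all are empty at the end.
    realise : (q : ℕ → List ℕ) (W : List ℕ) → (∀ e → All (λ x → block U x ≡ e) (q e)) →
      (∀ e → length (q e) ≡ count (λ x → x ℕP.≟ e) W) →
      ∃[ W′ ] map (block U) W′ ≡ W × (∀ e → filter (λ x → block U x ℕP.≟ e) W′ ≡ q e)
    realise q []      h len = [] , refl , λ e → sym (empty (q e) (len e))
      where
      empty : ∀ (xs : List ℕ) → length xs ≡ 0 → xs ≡ []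
      empty [] _ = refl
    realise q (e ∷ W) h len = extended (q e) refl
      where
      pop : List ℕ → ℕ → List ℕ
      pop xs e′ with e ℕP.≟ e′
      ... | yes _ = xs
      ... | no  _ = q e′
      extended : ∀ xs → q e ≡ xs →
        ∃[ W′ ] map (block U) W′ ≡ e ∷ W × (∀ e → filter (λ x → block U x ℕP.≟ e) W′ ≡ q e)
      extended [] eq = contradiction (trans (sym (cong length eq))
        (trans (len e) (cong length (ListP.filter-accept (λ x → x ℕP.≟ e) refl)))) λ ()
      extended (x ∷ xs) eq = let (W′ , m , f) = realise (pop xs) W pop-block pop-length
        in x ∷ W′ , cong₂ _∷_ x-block m , λ e′ → filtered e′ (f e′)
        where
        all-block : All (λ x → block U x ≡ e) (x ∷ xs)
        all-block = subst (All _) eq (h e)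
        x-block : block U x ≡ e
        x-block = All.head all-block
        pop-block : ∀ e′ → All (λ x → block U x ≡ e′) (pop xs e′)
        pop-block e′ with e ℕP.≟ e′
        ... | yes refl = All.tail all-block
        ... | no  _    = h e′
        pop-length : ∀ e′ → length (pop xs e′) ≡ count (λ x → x ℕP.≟ e′) W
        pop-length e′ with e ℕP.≟ e′
        ... | yes refl = ℕP.suc-injective (trans (sym (cong length eq)) (trans (len e)
          (cong length (ListP.filter-accept (λ x → x ℕP.≟ e) {e} {W} refl))))
        ... | no e≢e′  = trans (len e′) (cong length (ListP.filter-reject (λ x → x ℕP.≟ e′) {e} {W} e≢e′))
        filtered : ∀ e′ {W′} → filter (λ x → block U x ℕP.≟ e′) W′ ≡ pop xs e′ →
          filter (λ x → block U x ℕP.≟ e′) (x ∷ W′) ≡ q e′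
        filtered e′ {W′} f with e ℕP.≟ e′
        ... | yes refl = trans (ListP.filter-accept (λ x → block U x ℕP.≟ e) x-block)
          (trans (cong (x ∷_) f) (sym eq))
        ... | no e≢e′ = trans (ListP.filter-reject (λ x → block U x ℕP.≟ e′) (λ b → e≢e′ (trans (sym x-block) b))) f

  uAt-length : ∀ {I : Sent a} {T} → Shaped I T → ∀ i → length (uAt I T i) ≡ count (λ x → x ℕP.≟ i) (readingWord T)
  uAt-length {I} {T} sh i = begin
    length (map proj₂ (filter (λ p → proj₁ p ℕP.≟ i) (readingCells I T)))
      ≡⟨ ListP.length-map proj₂ (filter (λ p → proj₁ p ℕP.≟ i) (readingCells I T)) ⟩
    length (filter (λ p → proj₁ p ℕP.≟ i) (readingCells I T))
      ≡⟨ ListP.length-map proj₁ (filter (λ p → proj₁ p ℕP.≟ i) (readingCells I T)) ⟨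
    length (map proj₁ (filter (λ p → proj₁ p ℕP.≟ i) (readingCells I T)))
      ≡⟨ cong length (filter-map (λ x → x ℕP.≟ i) proj₁ (readingCells I T)) ⟨
    count (λ x → x ℕP.≟ i) (map proj₁ (readingCells I T))
      ≡⟨ cong (count (λ x → x ℕP.≟ i)) (readingCells-entries sh) ⟩
    count (λ x → x ℕP.≟ i) (readingWord T)  ∎
    where open ≡-Reasoning

  -- The queue for an entry e consists of the labels of block e in increasing order. That T has type
  -- U makes the queue as long as the number of entries e in T.
  standardization : ∀ {I T U} → Shaped {a} I T → All (1 ≤_) (readingWord T) → HasType I T U →
    ∃[ S ] map (map (block U)) S ≡ T × Compatible I S U
  standardization {I} {T} {U} sh pos type with realise U queue (readingWord T) queue-block queue-length
    where
    queue : ℕ → List ℕ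
    queue e = map proj₁ (filter (inBlock? U e) (reference U))
    queue-block : ∀ e → All (λ x → block U x ≡ e) (queue e)
    queue-block e = AllP.map⁺ (AllP.all-filter (inBlock? U e) (reference U))
    queue-length : ∀ e → length (queue e) ≡ count (λ x → x ℕP.≟ e) (readingWord T)
    -- T has no entry 0 and no label has block 0.
    queue-length zero = trans
      (cong (length ∘ map proj₁) (ListP.filter-none (inBlock? U 0) (All.tabulate {xs = reference U} (λ _ ()))))
      (sym (cong length (ListP.filter-none (λ x → x ℕP.≟ 0) (All.map ℕP.>⇒≢ pos))))
    queue-length (suc i) = begin
      length (map proj₁ (filter (inBlock? U (suc i)) (reference U)))
        ≡⟨ ListP.length-map proj₁ (filter (inBlock? U (suc i)) (reference U)) ⟩
      length (filter (inBlock? U (suc i)) (reference U))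
        ≡⟨ ListP.length-map proj₂ (filter (inBlock? U (suc i)) (reference U)) ⟨
      length (map proj₂ (filter (inBlock? U (suc i)) (reference U)))
        ≡⟨ cong length (trans (reference-block U i) (sym (type i))) ⟩
      length (uAt I T (suc i))
        ≡⟨ uAt-length sh (suc i) ⟩
      count (λ x → x ℕP.≟ suc i) (readingWord T)  ∎
      where open ≡-Reasoning
  ... | W , m , f with unmap T m
  ... | S , refl , refl = S , refl , comp
    where
    sh′ : Shaped I S
    sh′ = shaped-map⁻ (block U) S sh
    entries : ∀ i → map proj₁ (filter (inBlock? U i) (readingCells I S)) ≡ map proj₁ (filter (inBlock? U i) (reference U))
    entries i = begin
      map proj₁ (filter (inBlock? U i) (readingCells I S))
        ≡⟨ filter-map (λ x → block U x ℕP.≟ i) proj₁ (readingCells I S) ⟨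
      filter (λ x → block U x ℕP.≟ i) (map proj₁ (readingCells I S))
        ≡⟨ cong (filter (λ x → block U x ℕP.≟ i)) (readingCells-entries sh′) ⟩
      filter (λ x → block U x ℕP.≟ i) (readingWord S)
        ≡⟨ f i ⟩
      map proj₁ (filter (inBlock? U i) (reference U))  ∎
      where open ≡-Reasoning
    comp : Compatible I S U
    comp zero    = trans (ListP.filter-none (inBlock? U 0) (All.tabulate {xs = readingCells I S} (λ _ ())))
      (sym (ListP.filter-none (inBlock? U 0) (All.tabulate {xs = reference U} (λ _ ()))))
    -- The labels agree by the choice of W, the colours because T has type U.
    comp (suc i) = pairs-≡ (entries (suc i))
      (trans (sym (uAt-map (block U) I S (suc i))) (trans (type i) (sym (reference-block U i))))

  -- The coarse filling tells the block of every box, and compatibility fixes the sequence of labels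
  -- inside each block.
  compatible-injective : ∀ {I S S′ U} → Shaped {a} I S → Shaped I S′ → Compatible I S U → Compatible I S′ U →
    map (map (block U)) S ≡ map (map (block U)) S′ → S ≡ S′
  compatible-injective {I} {S} {S′} {U} sh sh′ comp comp′ e = rows sh sh′ (words
    (trans (sym (readingWord-map (block U) S)) (trans (cong readingWord e) (readingWord-map (block U) S′)))
    (λ i → begin
      filter (λ x → block U x ℕP.≟ i) (readingWord S)  ≡⟨ entries sh i ⟩
      map proj₁ (filter (inBlock? U i) (readingCells I S))
        ≡⟨ cong (map proj₁) (trans (comp i) (sym (comp′ i))) ⟩
      map proj₁ (filter (inBlock? U i) (readingCells I S′)) ≡⟨ entries sh′ i ⟨
      filter (λ x → block U x ℕP.≟ i) (readingWord S′) ∎))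
    where
    open ≡-Reasoning
    entries : ∀ {S} → Shaped I S → ∀ i →
      filter (λ x → block U x ℕP.≟ i) (readingWord S) ≡ map proj₁ (filter (inBlock? U i) (readingCells I S))
    entries {S} sh i = trans (cong (filter (λ x → block U x ℕP.≟ i)) (sym (readingCells-entries sh)))
      (filter-map (λ x → block U x ℕP.≟ i) proj₁ (readingCells I S))
    -- The first letters have the same block, and each is the first member of that block's list; so
    -- they are equal and can be removed.
    words : ∀ {W W′} → map (block U) W ≡ map (block U) W′ →
      (∀ i → filter (λ x → block U x ℕP.≟ i) W ≡ filter (λ x → block U x ℕP.≟ i) W′) → W ≡ W′
    words {[]}    {[]}     m f = refl
    words {x ∷ W} {x′ ∷ W′} m f = cong₂ _∷_ head-≡ (words (ListP.∷-injectiveʳ m) tail)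
      where
      block-≡ : block U x ≡ block U x′
      block-≡ = ListP.∷-injectiveˡ m
      head-≡ : x ≡ x′
      head-≡ = ListP.∷-injectiveˡ (trans (sym (ListP.filter-accept (λ z → block U z ℕP.≟ block U x) refl))
        (trans (f (block U x)) (ListP.filter-accept (λ z → block U z ℕP.≟ block U x) (sym block-≡))))
      tail : ∀ i → filter (λ z → block U z ℕP.≟ i) W ≡ filter (λ z → block U z ℕP.≟ i) W′
      tail i = by-cases (block U x ℕP.≟ i)
        where
        by-cases : Dec (block U x ≡ i) → filter (λ z → block U z ℕP.≟ i) W ≡ filter (λ z → block U z ℕP.≟ i) W′
        by-cases (yes p) = ListP.∷-injectiveʳ
          (trans (sym (ListP.filter-accept (λ z → block U z ℕP.≟ i) p))
            (trans (f i) (ListP.filter-accept (λ z → block U z ℕP.≟ i) (trans (sym block-≡) p))))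
        by-cases (no ¬p) = trans (sym (ListP.filter-reject (λ z → block U z ℕP.≟ i) ¬p))
          (trans (f i) (ListP.filter-reject (λ z → block U z ℕP.≟ i) (¬p ∘ trans block-≡)))
    -- The reading word ends with the top row, whose length is given by the shape.
    rows : ∀ {I S S′} → Shaped {a} I S → Shaped I S′ → readingWord S ≡ readingWord S′ → S ≡ S′
    rows []                 []                   e = refl
    rows {S = t ∷ S} {t′ ∷ S′} (l ∷ sh) (l′ ∷ sh′) e = cong₂ _∷_ t≡ (rows sh sh′
      (ListP.++-cancelʳ t (readingWord S) (readingWord S′) (trans e (cong (readingWord S′ ++_) (sym t≡)))))
      where
      suffix : ∀ (xs ys : List ℕ) {zs zs′ : List ℕ} → length zs ≡ length zs′ → xs ++ zs ≡ ys ++ zs′ → zs ≡ zs′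
      suffix []       []       l e = e
      suffix (x ∷ xs) (y ∷ ys) l e = suffix xs ys l (ListP.∷-injectiveʳ e)
      suffix []       (y ∷ ys) {zs} {zs′} l e = contradiction
        (trans (sym l) (trans (cong length e) (cong suc (ListP.length-++ ys)))) (ℕP.m≢1+n+m (length zs′))
      suffix (x ∷ xs) []       {zs} {zs′} l e = contradiction
        (trans l (trans (cong length (sym e)) (cong suc (ListP.length-++ xs)))) (ℕP.m≢1+n+m (length zs))
      t≡ : t ≡ t′
      t≡ = suffix (readingWord S) (readingWord S′) (trans l (sym l′)) e

-- Cutting a word at its descents

module _ {a : ℕ} where

  data Compat : List (Fin a × Bool) → List (Word a) → Set where
    done : Compat [] []
    skip : ∀ {cs U} → Compat cs U → Compat cs ([] ∷ U)
    end  : ∀ {c b cs U} → Compat cs U → Compat ((c , b) ∷ cs) ((c ∷ []) ∷ U)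
    cont : ∀ {c d u cs U} → Compat cs ((d ∷ u) ∷ U) → Compat ((c , false) ∷ cs) ((c ∷ d ∷ u) ∷ U)

  Refines : Sent a → Sent a → Set
  Refines F I = ∃[ bs ] concat bs ≡ F × All NonEmpty bs × map concat bs ≡ I

  compat-refines : ∀ {cs U} → Compat cs U → Refines (flat U) (cutAt cs)
  compat-refines done     = [] , refl , [] , refl
  compat-refines (skip p) = compat-refines p
  compat-refines (end {c} {true} p) with compat-refines p
  ... | bs , e , h , e′ = ((c ∷ []) ∷ []) ∷ bs , cong ((c ∷ []) ∷_) e , s≤s z≤n ∷ h , cong ((c ∷ []) ∷_) e′
  -- A word of U ending without a cut joins the group of the word that follows it; after the last
  -- letter it forms a group by itself.
  compat-refines (end {c} {false} {cs} p) with cutAt cs | compat-refines p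
  ... | []     | []     , e , h , e′     = ((c ∷ []) ∷ []) ∷ [] , cong ((c ∷ []) ∷_) e , s≤s z≤n ∷ [] , refl
  ... | w ∷ ws | b ∷ bs , e , _ ∷ h , e′ = ((c ∷ []) ∷ b) ∷ bs , cong ((c ∷ []) ∷_) e , s≤s z≤n ∷ h ,
    cong₂ _∷_ (cong (c ∷_) (ListP.∷-injectiveˡ e′)) (ListP.∷-injectiveʳ e′)
  compat-refines (cont {c} {cs = cs} p) with cutAt cs | compat-refines p
  ... | _      | [] ∷ bs      , e , () ∷ h , e′
  ... | w ∷ ws | (x ∷ g) ∷ bs , e , _ ∷ h , e′ with ListP.∷-injective e
  ... | refl , e₂ = ((c ∷ x) ∷ g) ∷ bs , cong ((c ∷ x) ∷_) e₂ , s≤s z≤n ∷ h ,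
    cong₂ _∷_ (cong (c ∷_) (ListP.∷-injectiveˡ e′)) (ListP.∷-injectiveʳ e′)

  cutAt-nonempty : ∀ (p : Fin a × Bool) cs → cutAt (p ∷ cs) ≢ []
  cutAt-nonempty (c , true)  cs ()
  cutAt-nonempty (c , false) cs e with cutAt cs
  cutAt-nonempty (c , false) cs () | []
  cutAt-nonempty (c , false) cs () | _ ∷ _

  cutAt-sentence : ∀ (cs : List (Fin a × Bool)) → IsSentence (cutAt cs)
  cutAt-sentence []                 = []
  cutAt-sentence ((c , true)  ∷ cs) = s≤s z≤n ∷ cutAt-sentence cs
  cutAt-sentence ((c , false) ∷ cs) with cutAt cs | cutAt-sentence cs
  ... | []     | _     = s≤s z≤n ∷ []
  ... | w ∷ ws | _ ∷ s = s≤s z≤n ∷ s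

  cutAt-letters : ∀ (cs : List (Fin a × Bool)) → concat (cutAt cs) ≡ map proj₁ cs
  cutAt-letters []                 = refl
  cutAt-letters ((c , true)  ∷ cs) = cong (c ∷_) (cutAt-letters cs)
  cutAt-letters ((c , false) ∷ cs) with cutAt cs | cutAt-letters cs
  ... | []     | e = cong (c ∷_) e
  ... | w ∷ ws | e = cong (c ∷_) e

  no-letters : ∀ {g : Sent a} → IsSentence g → concat g ≡ [] → g ≡ []
  no-letters []                          e = refl
  no-letters {(_ ∷ _) ∷ _} (_ ∷ _)       ()
  no-letters {[] ∷ _}      (() ∷ _)      e

  sentence-part : ∀ (g : Sent a) {F} {U : List (Word a)} → g ++ F ≡ flat U → IsSentence g
  sentence-part g {U = U} e = AllP.++⁻ˡ g (subst IsSentence (sym e) (flat-sentence U))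

  refines-compat : ∀ cs U → Refines (flat U) (cutAt cs) → Compat cs U
  refines-compat [] [] r = done
  refines-compat (p ∷ cs) [] ([] , e , h , e′) = contradiction (sym e′) (cutAt-nonempty p cs)
  refines-compat cs [] ([] ∷ bs , e , () ∷ h , e′)
  refines-compat cs ([] ∷ U) r = skip (refines-compat cs U r)
  refines-compat cs ((c ∷ u) ∷ U) ([] ∷ bs , e , () ∷ h , e′)
  refines-compat [] ((c ∷ u) ∷ U) ((g ∷ b) ∷ bs , e , h , ())
  refines-compat ((c₀ , true) ∷ cs) ((c ∷ []) ∷ U) ((x ∷ g) ∷ bs , e , _ ∷ h , e′)
    with ListP.∷-injective e
  ... | refl , e₂ with ListP.∷-injective e′
  ... | e₃ , e₄ with ListP.∷-injective e₃
  -- The cut makes c a complete word of the coarse sentence, so nothing else belongs to its group.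
  ... | refl , e₅ with no-letters (sentence-part g {U = U} e₂) e₅
  ... | refl = end (refines-compat cs U (bs , e₂ , h , e₄))
  refines-compat ((c₀ , false) ∷ cs) ((c ∷ []) ∷ U) ((x ∷ g) ∷ bs , e , _ ∷ h , e′)
    with ListP.∷-injective e
  -- The recursive call is abstracted together with `cutAt cs`, so that its hypothesis follows the
  -- distinction whether another coarse word comes after c.
  ... | refl , e₂ with cutAt cs | cutAt-sentence cs | (λ bs → refines-compat cs U bs)
  ... | [] | _ | rec = first (ListP.∷-injective e′)
    where
    first : c ∷ concat g ≡ c₀ ∷ [] × map concat bs ≡ [] → Compat ((c₀ , false) ∷ cs) ((c ∷ []) ∷ U)
    first (e₃ , e₄) with ListP.∷-injective e₃
    ... | refl , e₅ with no-letters (sentence-part g {U = U} e₂) e₅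
    ... | refl = end (rec (bs , e₂ , h , e₄))
  ... | w ∷ ws | w≢ ∷ _ | rec = first (ListP.∷-injective e′)
    where
    nonempty : ∀ (g : Sent a) → NonEmpty (concat g) → NonEmpty g
    nonempty (_ ∷ _) _ = s≤s z≤n
    first : c ∷ concat g ≡ c₀ ∷ w × map concat bs ≡ ws → Compat ((c₀ , false) ∷ cs) ((c ∷ []) ∷ U)
    first (e₃ , e₄) with ListP.∷-injective e₃
    ... | refl , refl = end (rec (g ∷ bs , e₂ , nonempty g w≢ ∷ h , cong (concat g ∷_) e₄))
  refines-compat ((c₀ , true) ∷ cs) ((c ∷ d ∷ u) ∷ U) ((x ∷ g) ∷ bs , e , _ ∷ h , e′)
    with ListP.∷-injective e
  ... | refl , e₂ = contradiction (ListP.∷-injectiveʳ (ListP.∷-injectiveˡ e′)) λ ()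
  refines-compat ((c₀ , false) ∷ cs) ((c ∷ d ∷ u) ∷ U) ((x ∷ g) ∷ bs , e , _ ∷ h , e′)
    with ListP.∷-injective e
  ... | refl , e₂ with cutAt cs | (λ bs → refines-compat cs ((d ∷ u) ∷ U) bs)
  ... | [] | rec = contradiction (ListP.∷-injectiveʳ (ListP.∷-injectiveˡ e′)) λ ()
  ... | w ∷ ws | rec with ListP.∷-injective e′
  ... | e₃ , e₄ with ListP.∷-injective e₃
  ... | refl , e₅ = cont (rec (((d ∷ u) ∷ g) ∷ bs , cong ((d ∷ u) ∷_) e₂ , s≤s z≤n ∷ h , cong₂ _∷_ e₅ e₄))

  -- Every cut separates letters of different words of U. Past the last letter `blk` is `length U`,
  -- so a cut at the very end satisfies the condition.
  CutsIn : List (Fin a × Bool) → List (Word a) → Set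
  CutsIn cs U = ∀ s c → at cs s ≡ just (c , true) → blk U s ≢ blk U (suc s)

  compat⁻ : ∀ {cs U} → Compat cs U → map proj₁ cs ≡ concat U × CutsIn cs U
  compat⁻ done     = refl , λ _ _ ()
  compat⁻ (skip p) = let (e , h) = compat⁻ p in e , λ s c q b → h s c q (ℕP.suc-injective b)
  compat⁻ (end {c} p) = let (e , h) = compat⁻ p in cong (c ∷_) e , λ where
    zero    _ _ ()
    (suc s) d q b → h s d q (ℕP.suc-injective b)
  compat⁻ (cont {c} p) = let (e , h) = compat⁻ p in cong (c ∷_) e , λ where
    zero    _ ()
    (suc s) d q b → h s d q b

  compat⁺ : ∀ cs U → map proj₁ cs ≡ concat U → CutsIn cs U → Compat cs U
  compat⁺ []             []                e h = done
  compat⁺ cs             ([] ∷ U)          e h = skip (compat⁺ cs U e (λ s c q b → h s c q (cong suc b)))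
  compat⁺ ((c , b) ∷ cs) ((_ ∷ []) ∷ U)    e h with ListP.∷-injective e
  ... | refl , e′ = end (compat⁺ cs U e′ (λ s d q b → h (suc s) d q (cong suc b)))
  -- A cut after the first of two letters of one word: both letters lie in block 0.
  compat⁺ ((c , true) ∷ cs)  ((_ ∷ d ∷ u) ∷ U) e h = contradiction refl (h 0 c refl)
  compat⁺ ((c , false) ∷ cs) ((_ ∷ d ∷ u) ∷ U) e h with ListP.∷-injective e
  ... | refl , e′ = cont (compat⁺ cs ((d ∷ u) ∷ U) e′ (λ s d q b → h (suc s) d q b))

  cutAt-⪯⁺ : ∀ cs U → map proj₁ cs ≡ concat U → CutsIn cs U → flat U ⪯ cutAt cs
  cutAt-⪯⁺ cs U e h = let (bs , p , q , r) = compat-refines (compat⁺ cs U e h) in ⪯⁺ bs p q r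

  cutAt-⪯⁻ : ∀ cs U → flat U ⪯ cutAt cs → map proj₁ cs ≡ concat U × CutsIn cs U
  cutAt-⪯⁻ cs U r = compat⁻ (refines-compat cs U (⪯⁻ {J = flat U} {I = cutAt cs} r))

-- Standard tableaux and descents

mutual
  rowSearch : Filling → ℕ → List (ℕ × ℕ) → Maybe ℕ
  rowSearch = _

  rowOf-search : ∀ T e → rowOf T e ≡ rowSearch T e (rowIdxFrom 1 T)
  rowOf-search T e with rowIdxFrom 1 T
  ... | xs = refl

mutual
  colorSearch : ∀ {a} → Sent a → Filling → ℕ → List (ℕ × Fin a) → Maybe (Fin a)
  colorSearch = _

  colorOf-search : ∀ {a} (J : Sent a) T e → colorOf J T e ≡ colorSearch J T e (concat (rowCells J T))
  colorOf-search J T e with concat (rowCells J T)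
  ... | xs = refl

mutual
  label : ∀ {a} → Sent a → Filling → ℕ → Maybe (Fin a × Bool)
  label = _

  coA-label : ∀ {a} (I : Sent a) T → coA I T ≡ cutAt (mapMaybe (label I T) (range1 (size I)))
  coA-label I T = refl

rowSearch-just : ∀ T e xs {r} → rowSearch T e xs ≡ just r → (r , e) ∈ xs
rowSearch-just T e ((r , e′) ∷ xs) eq with e′ ℕP.≟ e
rowSearch-just T e ((r , e) ∷ xs)  refl | yes refl = here refl
rowSearch-just T e ((r , e′) ∷ xs) eq   | no _     = there (rowSearch-just T e xs eq)

rowSearch-found : ∀ T e xs {r} → (r , e) ∈ xs → ∃[ r′ ] rowSearch T e xs ≡ just r′
rowSearch-found T e ((r , e′) ∷ xs) p with e′ ℕP.≟ e
... | yes _ = r , refl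
rowSearch-found T e ((r , e′) ∷ xs) (here refl) | no ¬p = contradiction refl ¬p
rowSearch-found T e ((r , e′) ∷ xs) (there p)   | no ¬p = rowSearch-found T e xs p

module _ {a : ℕ} (J : Sent a) (T : Filling) (e : ℕ) where

  colorSearch-just : ∀ xs {c} → colorSearch J T e xs ≡ just c → (e , c) ∈ xs
  colorSearch-just ((e′ , c) ∷ xs) eq with e′ ℕP.≟ e
  colorSearch-just ((e′ , c) ∷ xs) refl | yes refl = here refl
  colorSearch-just ((e′ , c) ∷ xs) eq   | no _     = there (colorSearch-just xs eq)

  colorSearch-found : ∀ xs {c} → (e , c) ∈ xs → ∃[ c′ ] colorSearch J T e xs ≡ just c′
  colorSearch-found ((e′ , c) ∷ xs) p with e′ ℕP.≟ e
  ... | yes _ = c , refl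
  colorSearch-found ((e′ , c) ∷ xs) (here refl) | no ¬p = contradiction refl ¬p
  colorSearch-found ((e′ , c) ∷ xs) (there p)   | no ¬p = colorSearch-found xs p

label-just : ∀ {a} (I : Sent a) T i {c} → colorOf I T i ≡ just c → label I T i ≡ just (c , isDescent T i)
label-just I T i e rewrite e = refl

isDescent-true : ∀ F i → isDescent F i ≡ true → ∃[ r ] ∃[ r′ ] rowOf F i ≡ just r × rowOf F (suc i) ≡ just r′ × r < r′
isDescent-true F i d with rowOf F i | rowOf F (suc i)
... | just r | just r′ = r , r′ , refl , refl , ℕP.<ᵇ⇒< r r′ (subst T (sym d) _)

isDescent-intro : ∀ T i {r r′} → rowOf T i ≡ just r → rowOf T (suc i) ≡ just r′ → r < r′ → isDescent T i ≡ true
isDescent-intro T i {r} {r′} e e′ l rewrite e | e′ with r <ᵇ r′ | ℕP.<⇒<ᵇ l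
... | true | _ = refl

∈-concat-reverse : {X : Set} (xss : List (List X)) {x : X} → x ∈ concat (reverse xss) → x ∈ concat xss
∈-concat-reverse xss x∈ with ∈-concat⁻′ (reverse xss) x∈
... | xs , p , q = ∈-concat⁺′ p (Perm.∈-resp-↭ (Perm.↭-reverse xss) q)

∈-concat-reverse⁻ : {X : Set} (xss : List (List X)) {x : X} → x ∈ concat xss → x ∈ concat (reverse xss)
∈-concat-reverse⁻ xss x∈ with ∈-concat⁻′ xss x∈
... | xs , p , q = ∈-concat⁺′ p (Perm.∈-resp-↭ (↭-sym (Perm.↭-reverse xss)) q)

-- `colorOf` searches the rows from the top and `uAt` reads them from the bottom, but both range
-- over the same cells, and only one of them contains e.
colorOf-single : ∀ {a} (I : Sent a) S e {c} → uAt I S e ≡ [ c ] → colorOf I S e ≡ just c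
colorOf-single I S e {c} eq with colorSearch-found I S e (concat (rowCells I S))
  (∈-concat-reverse (rowCells I S) (∈-atIndex⁻ {m = readingCells I S} (subst (c ∈_) (sym eq) (here refl))))
... | c′ , found with subst (c′ ∈_) eq (∈-atIndex⁺ {m = readingCells I S}
  (∈-concat-reverse⁻ (rowCells I S) (colorSearch-just I S e (concat (rowCells I S)) found)))
... | here refl = trans (colorOf-search I S e) found

readingWord-↭ : ∀ S → readingWord S ↭ concat S
readingWord-↭ []      = ↭-refl
readingWord-↭ (t ∷ S) = ↭-trans (Perm.++-comm (readingWord S) t) (Perm.++⁺ˡ t (readingWord-↭ S))

readingWord-count : ∀ S i → count (λ x → x ℕP.≟ i) (readingWord S) ≡ count (λ x → x ℕP.≟ i) (concat S)
readingWord-count S i = Perm.↭-length (Perm.filter-↭ (λ x → x ℕP.≟ i) (readingWord-↭ S))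

rowIdx-∈⁺ : ∀ b S {x} → x ∈ readingWord S → ∃[ r ] (r , x) ∈ rowIdxFrom b S
rowIdx-∈⁺ b (t ∷ S) x∈ with ∈-++⁻ (readingWord S) x∈
... | inj₁ p = let (r , q) = rowIdx-∈⁺ (suc b) S p in r , ∈-++⁺ʳ (map (b ,_) t) q
... | inj₂ p = b , ∈-++⁺ˡ (∈-map⁺ (b ,_) p)

rowIdx-∈⁻ : ∀ b S {r x} → (r , x) ∈ rowIdxFrom b S → x ∈ readingWord S
rowIdx-∈⁻ b (t ∷ S) p with ∈-++⁻ (map (b ,_) t) p
... | inj₂ q = ∈-++⁺ˡ (rowIdx-∈⁻ (suc b) S q)
... | inj₁ q with ∈-map⁻ (b ,_) q
... | _ , x∈ , refl = ∈-++⁺ʳ (readingWord S) x∈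

rowIdx-≥ : ∀ b S {r x} → (r , x) ∈ rowIdxFrom b S → b ≤ r
rowIdx-≥ b (t ∷ S) p with ∈-++⁻ (map (b ,_) t) p
... | inj₂ q = ℕP.<⇒≤ (rowIdx-≥ (suc b) S q)
... | inj₁ q with ∈-map⁻ (b ,_) q
... | _ , _ , refl = ℕP.≤-refl

rowIdx-unique : ∀ b S {r r′ x} → Unique (readingWord S) → (r , x) ∈ rowIdxFrom b S → (r′ , x) ∈ rowIdxFrom b S → r ≡ r′
rowIdx-unique b (t ∷ S) u p q with ∈-++⁻ (map (b ,_) t) p | ∈-++⁻ (map (b ,_) t) q
... | inj₂ p′ | inj₂ q′ = rowIdx-unique (suc b) S (proj₁ (AllPairs-++⁻ (readingWord S) u)) p′ q′
... | inj₁ p′ | inj₁ q′ with ∈-map⁻ (b ,_) p′ | ∈-map⁻ (b ,_) q′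
... | _ , _ , refl | _ , _ , refl = refl
rowIdx-unique b (t ∷ S) u p q | inj₁ p′ | inj₂ q′ with ∈-map⁻ (b ,_) p′
... | _ , x∈ , refl = contradiction refl (AllPairs-cross (readingWord S) u (rowIdx-∈⁻ (suc b) S q′) x∈)
rowIdx-unique b (t ∷ S) u p q | inj₂ p′ | inj₁ q′ with ∈-map⁻ (b ,_) q′
... | _ , x∈ , refl = contradiction refl (AllPairs-cross (readingWord S) u (rowIdx-∈⁻ (suc b) S p′) x∈)

-- A larger row index means a lower row, which comes earlier in the reading word.
lower-row-first : ∀ {R : ℕ → ℕ → Set} b S → AllPairs R (readingWord S) → ∀ {r x r′ y} →
  (r , x) ∈ rowIdxFrom b S → (r′ , y) ∈ rowIdxFrom b S → r < r′ → R y x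
lower-row-first b (t ∷ S) s p q l with ∈-++⁻ (map (b ,_) t) p | ∈-++⁻ (map (b ,_) t) q
... | inj₂ p′ | inj₂ q′ = lower-row-first (suc b) S (proj₁ (AllPairs-++⁻ (readingWord S) s)) p′ q′ l
... | inj₁ p′ | inj₁ q′ with ∈-map⁻ (b ,_) p′ | ∈-map⁻ (b ,_) q′
... | _ , _ , refl | _ , _ , refl = contradiction l (ℕP.n≮n b)
lower-row-first b (t ∷ S) s p q l | inj₁ p′ | inj₂ q′ with ∈-map⁻ (b ,_) p′
... | _ , x∈ , refl = AllPairs-cross (readingWord S) s (rowIdx-∈⁻ (suc b) S q′) x∈
lower-row-first b (t ∷ S) s p q l | inj₂ p′ | inj₁ q′ with ∈-map⁻ (b ,_) q′
... | _ , _ , refl = contradiction (ℕP.<-trans l (rowIdx-≥ (suc b) S p′)) (ℕP.n≮n _)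

-- Two places of the reading word either lie in one row or the earlier lies in the lower row.
rows-AllPairs : ∀ {R : ℕ → ℕ → Set} b S → All (AllPairs R) S →
  (∀ {r x r′ y} → (r , x) ∈ rowIdxFrom b S → (r′ , y) ∈ rowIdxFrom b S → r < r′ → R y x) →
  AllPairs R (readingWord S)
rows-AllPairs b []      []       h = []
rows-AllPairs b (t ∷ S) (s ∷ ss) h = AllPairsP.++⁺
  (rows-AllPairs (suc b) S ss (λ p q → h (∈-++⁺ʳ (map (b ,_) t) p) (∈-++⁺ʳ (map (b ,_) t) q))) s
  (All.tabulate (λ y∈ → All.tabulate (λ x∈ → let (r , p) = rowIdx-∈⁺ (suc b) S y∈ in
    h (∈-++⁺ˡ (∈-map⁺ (b ,_) x∈)) (∈-++⁺ʳ (map (b ,_) t) p) (rowIdx-≥ (suc b) S p))))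

module _ {X : Set} where

  at-just : ∀ (xs : List X) i {x} → at xs i ≡ just x → i < length xs
  at-just (x ∷ xs) zero    e = z<s
  at-just (x ∷ xs) (suc i) e = s≤s (at-just xs i e)

  at-< : ∀ (xs : List X) i → i < length xs → ∃[ x ] at xs i ≡ just x
  at-< (x ∷ xs) zero    l       = x , refl
  at-< (x ∷ xs) (suc i) (s≤s l) = at-< xs i l

  at-≥ : ∀ (xs : List X) i → length xs ≤ i → at xs i ≡ nothing
  at-≥ []       i       l       = refl
  at-≥ (x ∷ xs) (suc i) (s≤s l) = at-≥ xs i l

  at-map : {Y : Set} (f : X → Y) (xs : List X) (i : ℕ) {x : X} → at xs i ≡ just x → at (map f xs) i ≡ just (f x)
  at-map f (x ∷ xs) zero    refl = refl
  at-map f (x ∷ xs) (suc i) e    = at-map f xs i e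

  -- As f is defined on all arguments in question, `mapMaybe` drops nothing and positions are
  -- preserved.
  at-mapMaybe : (f : ℕ → Maybe X) (g : ℕ → ℕ) (m : ℕ) → (∀ i → i < m → ∃[ x ] f (suc (g i)) ≡ just x) →
    length (mapMaybe f (map suc (applyUpTo g m))) ≡ m
    × (∀ i → i < m → at (mapMaybe f (map suc (applyUpTo g m))) i ≡ f (suc (g i)))
  at-mapMaybe f g zero    h = refl , λ _ ()
  at-mapMaybe f g (suc m) h with f (suc (g 0)) in eq | h 0 z<s
  ... | just x | _ , _ = let (l , k) = at-mapMaybe f (g ∘ suc) m (λ i l → h (suc i) (s≤s l)) in
    cong suc l , λ where
      zero    _ → sym eq
      (suc i) l → k i (s≤s⁻¹ l)

count-unique : ∀ {xs : List ℕ} → (∀ {x} → x ∈ xs → count (λ y → y ℕP.≟ x) xs ≡ 1) → Unique xs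
count-unique {[]}     h = []
count-unique {x ∷ xs} h = All.tabulate (λ { {y} y∈ refl → ℕP.n≮n 0 (ℕP.<-≤-trans
    (ListP.filter-some (λ z → z ℕP.≟ x) (Any.map sym y∈))
    (ℕP.≤-reflexive (ℕP.suc-injective (trans (sym (cong length (ListP.filter-accept (λ z → z ℕP.≟ x) refl))) (h (here refl)))))) })
  ∷ count-unique tail
  where
  tail : ∀ {y} → y ∈ xs → count (λ z → z ℕP.≟ y) xs ≡ 1
  tail {y} y∈ = by-cases (x ℕP.≟ y)
    where
    by-cases : Dec (x ≡ y) → count (λ z → z ℕP.≟ y) xs ≡ 1
    by-cases (no x≢y) = trans (sym (cong length (ListP.filter-reject (λ z → z ℕP.≟ y) x≢y))) (h (there y∈))
    by-cases (yes refl) = ℕP.≤-antisym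
      (ℕP.≤-trans (ℕP.n≤1+n _) (ℕP.≤-reflexive (trans (sym (cong length (ListP.filter-accept (λ z → z ℕP.≟ x) refl))) (h (here refl)))))
      (ListP.filter-some (λ z → z ℕP.≟ x) (Any.map sym y∈))

module _ {a : ℕ} {I : Sent a} {S : Filling} (sh : Shaped I S) where

  labels : List (Fin a × Bool)
  labels = mapMaybe (label I S) (range1 (size I))

  module _ (single : ∀ s → s < size I → ∃[ c ] uAt I S (suc s) ≡ [ c ]) where

    label-single : ∀ s {c} → uAt I S (suc s) ≡ [ c ] → label I S (suc s) ≡ just (c , isDescent S (suc s))
    label-single s e = label-just I S (suc s) (colorOf-single I S (suc s) e)

    labels-at-length : length labels ≡ size I × (∀ s → s < size I → at labels s ≡ label I S (suc s))
    labels-at-length = at-mapMaybe (label I S) id (size I)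
      (λ s l → let (c , e) = single s l in (c , isDescent S (suc s)) , label-single s e)

    labels-length : length labels ≡ size I
    labels-length = proj₁ labels-at-length

    labels-at : ∀ s {c} → s < size I → uAt I S (suc s) ≡ [ c ] → at labels s ≡ just (c , isDescent S (suc s))
    labels-at s l e = trans (proj₂ labels-at-length s l) (label-single s e)

    -- Each of the labels up to `size I` has a colour, so cutting keeps exactly `size I` letters.
    coA-vertex : coA I S ∈ sentencesOf a (size I)
    coA-vertex = subst (λ n → coA I S ∈ sentencesOf a n)
      (trans (size-concat (coA I S)) (trans (cong length (cutAt-letters labels))
        (trans (ListP.length-map proj₁ labels) labels-length)))
      (∈-sentencesOf⁺ (cutAt-sentence labels))

  standard-single : IsStandard (size I) S → ∀ s → s < size I → ∃[ c ] uAt I S (suc s) ≡ [ c ]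
  standard-single std s l = only (uAt I S (suc s)) (trans (uAt-length sh (suc s))
    (trans (readingWord-count S (suc s)) (All.lookup std (∈-range1⁺ (s≤s z≤n) l))))
    where
    only : ∀ (w : Word a) → length w ≡ 1 → ∃[ c ] w ≡ [ c ]
    only (c ∷ []) e = c , refl

  single-standard : (∀ s → s < size I → ∃[ c ] uAt I S (suc s) ≡ [ c ]) → IsStandard (size I) S
  single-standard single = AllP.map⁺ (All.tabulate (λ {s} s∈ → let (c , e) = single s (∈-upTo⁻ s∈) in
    trans (sym (readingWord-count S (suc s))) (trans (sym (uAt-length sh (suc s))) (cong length e))))

  module _ {U : List (Word a)} where

    compatible-single : Compatible I S U → ∀ s → s < size I →
      ∃[ c ] at (concat U) s ≡ just c × uAt I S (suc s) ≡ [ c ]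
    compatible-single comp s l =
      let (c , e) = at-< (concat U) s (subst (s <_) (compatible-size {U = U} sh comp) l)
      in c , e , trans (compatible-atIndex {U = U} sh comp (suc s)) (trans (atIndex-reference U s) (cong toList e))

    -- Letter s of `concat U` has label `suc s`. A descent at that label inside a block would place
    -- the next larger label in a lower row, hence earlier in the reading word, against the order in
    -- the block.
    compatible⇒⪯ : Compatible I S U → IsStandard (size I) S × flat U ⪯ coA I S
    compatible⇒⪯ comp = single-standard single , cutAt-⪯⁺ labels U letters cuts
      where
      single : ∀ s → s < size I → ∃[ c ] uAt I S (suc s) ≡ [ c ]
      single s l = let (c , _ , e) = compatible-single comp s l in c , e
      length-≤ : ∀ {s} → ¬ (s < size I) → length (map proj₁ labels) ≤ s
      length-≤ s≮ = subst (_≤ _) (sym (trans (ListP.length-map proj₁ labels) (labels-length single))) (ℕP.≮⇒≥ s≮)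
      letters : map proj₁ labels ≡ concat U
      letters = at-ext λ s → by-cases s (s <? size I)
        where
        by-cases : ∀ s → Dec (s < size I) → at (map proj₁ labels) s ≡ at (concat U) s
        by-cases s (yes l) = let (c , e , f) = compatible-single comp s l in
          trans (at-map proj₁ labels s (labels-at single s l f)) (sym e)
        by-cases s (no s≮) = trans (at-≥ (map proj₁ labels) s (length-≤ s≮))
          (sym (at-≥ (concat U) s (subst (_≤ s) (compatible-size {U = U} sh comp) (ℕP.≮⇒≥ s≮))))
      cuts : CutsIn labels U
      cuts s c e b =
        let l                          = subst (s <_) (labels-length single) (at-just labels s e)
            (_ , f)                    = single s l
            descent                    = cong proj₂ (MaybeP.just-injective (trans (sym (labels-at single s l f)) e))
            (r , r′ , p , p′ , r<r′)   = isDescent-true S (suc s) descent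
        in ℕP.<-asym (ℕP.n<1+n (suc s)) (lower-row-first 1 S (compatible-sorted {U = U} sh comp)
             (rowSearch-just S (suc s) (rowIdxFrom 1 S) (trans (sym (rowOf-search S (suc s))) p))
             (rowSearch-just S (suc (suc s)) (rowIdxFrom 1 S) (trans (sym (rowOf-search S (suc (suc s)))) p′))
             r<r′ (cong suc (sym b)))

    -- Refinement gives the colours label by label and forbids descents inside a block. Order in a
    -- block then follows from increasing rows for boxes of one row, and from `rising` for boxes of
    -- different rows.
    ⪯⇒compatible : All (λ e → 1 ≤ e × e ≤ size I) (readingWord S) → IsCIT S → IsStandard (size I) S →
      flat U ⪯ coA I S → Compatible I S U
    ⪯⇒compatible bound (rows , _) std ref = compatible⁺ {U = U} sh sorted colors
      where
      single : ∀ s → s < size I → ∃[ c ] uAt I S (suc s) ≡ [ c ]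
      single = standard-single std
      letters : map proj₁ labels ≡ concat U
      letters = proj₁ (cutAt-⪯⁻ labels U ref)
      cuts : CutsIn labels U
      cuts = proj₂ (cutAt-⪯⁻ labels U ref)
      U-length : length (concat U) ≡ size I
      U-length = trans (sym (cong length letters)) (trans (ListP.length-map proj₁ labels) (labels-length single))

      colors : ∀ e → atIndex (readingCells I S) e ≡ atIndex (reference U) e
      colors zero = trans (uAt-none 0 sh (All.map (λ (l , _) → ℕP.>⇒≢ l) bound))
        (sym (atIndex-none (reference U) 0 (All.map (λ (l , _) → ℕP.>⇒≢ l) (reference-bound U))))
      colors (suc s) = by-cases (s <? size I)
        where
        by-cases : Dec (s < size I) → uAt I S (suc s) ≡ atIndex (reference U) (suc s)
        by-cases (yes l) = let (c , e) = single s l in trans e (sym (trans (atIndex-reference U s)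
          (cong toList (trans (cong (λ w → at w s) (sym letters)) (at-map proj₁ labels s (labels-at single s l e))))))
        by-cases (no s≮) = trans
          (uAt-none (suc s) sh (All.map (λ { (_ , l) refl → s≮ l }) bound))
          (sym (trans (atIndex-reference U s) (cong toList (at-≥ (concat U) s
            (ℕP.≤-trans (ℕP.≤-reflexive U-length) (ℕP.≮⇒≥ s≮))))))

      unique : Unique (readingWord S)
      unique = count-unique λ {x} x∈ → trans (readingWord-count S x)
        (let (l , r) = All.lookup bound x∈ in All.lookup std (∈-range1⁺ l r))

      row-sorted : ∀ T → Unique (readingWord T) → All (Linked _≤_) T →
        All (AllPairs (λ x y → block U x ≡ block U y → x < y)) T
      row-sorted []      u []       = []
      row-sorted (t ∷ T) u (r ∷ rs) = let (uT , ut) = AllPairs-++⁻ (readingWord T) u in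
        AllPairs.zipWith (λ (l , ≢) _ → ℕP.≤∧≢⇒< l ≢) (LinkedP.Linked⇒AllPairs ℕP.≤-trans r , ut) ∷ row-sorted T uT rs

      row : ∀ s → s < size I → ∃[ r ] rowOf S (suc s) ≡ just r
      row s l = let (c , e) = single s l
                    (r , p) = rowIdx-∈⁺ 1 S (subst (suc s ∈_) (readingCells-entries sh)
                      (∈-map⁺ proj₁ (∈-atIndex⁻ {m = readingCells I S} (subst (c ∈_) (sym e) (here refl)))))
                    (r′ , q) = rowSearch-found S (suc s) (rowIdxFrom 1 S) p
        in r′ , trans (rowOf-search S (suc s)) q

      -- Inside a block there is no descent, so rows weakly rise from entry to entry.
      rising : ∀ {r x y} → (r , suc x) ∈ rowIdxFrom 1 S → y < size I → blk U x ≡ blk U y →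
        ∀ d → d + x ≤ y → ∃[ ρ ] rowOf S (suc (d + x)) ≡ just ρ × ρ ≤ r
      rising {r} {x} p y< b zero le =
        let (ρ , q) = rowSearch-found S (suc x) (rowIdxFrom 1 S) p
        in ρ , trans (rowOf-search S (suc x)) q ,
           ℕP.≤-reflexive (rowIdx-unique 1 S unique (rowSearch-just S (suc x) (rowIdxFrom 1 S) q) p)
      rising {r} {x} {y} p y< b (suc d) le =
        let (ρ , q , ρ≤r) = rising p y< b d (ℕP.<⇒≤ le)
            (ρ′ , q′)     = row (suc (d + x)) (ℕP.≤-<-trans le y<)
        in ρ′ , q′ , ℕP.≤-trans (ℕP.≮⇒≥ (λ ρ<ρ′ → no-descent (isDescent-intro S (suc (d + x)) q q′ ρ<ρ′))) ρ≤r
        where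
        -- Both letters lie between x and y, which share a block, and `blk` is monotone.
        same-block : blk U (d + x) ≡ blk U (suc (d + x))
        same-block = ℕP.≤-antisym (blk-step U (d + x))
          (ℕP.≤-trans (blk-mono U le) (ℕP.≤-trans (ℕP.≤-reflexive (sym b)) (blk-mono U (ℕP.m≤n+m x d))))
        no-descent : isDescent S (suc (d + x)) ≢ true
        no-descent t = let l = ℕP.<-trans le y<
                           (c , e) = single (d + x) l
          in cuts (d + x) c (trans (labels-at single (d + x) l e) (cong (λ z → just (c , z)) t)) same-block

      sorted : BlockSorted U (readingWord S)
      sorted = rows-AllPairs 1 S (row-sorted S unique rows) across
        where
        across : ∀ {r x r′ y} → (r , x) ∈ rowIdxFrom 1 S → (r′ , y) ∈ rowIdxFrom 1 S → r < r′ →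
          block U y ≡ block U x → y < x
        -- Were x at most y, climbing from x to y inside the block would put y no lower than x, but
        -- row r′ is lower than row r.
        across {r} {x} {r′} {y} p q r<r′ b = ℕP.≰⇒> λ x≤y → ℕP.<⇒≱ r<r′
          (below x y p q b x≤y (All.lookup bound (rowIdx-∈⁻ 1 S p)) (All.lookup bound (rowIdx-∈⁻ 1 S q)))
          where
          below : ∀ x y → (r , x) ∈ rowIdxFrom 1 S → (r′ , y) ∈ rowIdxFrom 1 S → block U y ≡ block U x → x ≤ y →
            1 ≤ x × x ≤ size I → 1 ≤ y × y ≤ size I → r′ ≤ r
          below (suc x) (suc y) p q b (s≤s x≤y) _ (_ , y<) =
            let (ρ , e , ρ≤r) = rising p y< (sym (ℕP.suc-injective b)) (y ∸ x) (ℕP.≤-reflexive (ℕP.m∸n+n≡m x≤y))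
                e′ = subst (λ z → rowOf S (suc z) ≡ just ρ) (ℕP.m∸n+n≡m x≤y) e
            in subst (_≤ r) (rowIdx-unique 1 S unique
                 (rowSearch-just S (suc y) (rowIdxFrom 1 S) (trans (sym (rowOf-search S (suc y))) e′)) q) ρ≤r

-- The expansion of S* in the basis F, and its inversion

count-witness : {X : Set} {P : X → Set} (P? : Decidable P) (xs : List X) → count P? xs ≢ 0 → ∃[ x ] x ∈ xs × P x
count-witness P? []       c≢0 = contradiction refl c≢0
count-witness P? (x ∷ xs) c≢0 with P? x
... | yes p = x , here refl , p
... | no _  = let (y , y∈ , q) = count-witness P? xs c≢0 in y , there y∈ , q

count-positive : {X : Set} {P : X → Set} (P? : Decidable P) {xs : List X} {x : X} → x ∈ xs → P x → count P? xs ≢ 0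
count-positive P? x∈ p = ℕP.>⇒≢ (ListP.filter-some P? (Any.map (λ { refl → p }) x∈))

module _ {a : ℕ} where

  ⪯-refl : (I : Sent a) → I ⪯ I
  ⪯-refl I = ⪯⁺ (map [_] I) (ListP.concat-map-[_] I) (AllP.map⁺ (All.tabulate {xs = I} (λ _ → s≤s z≤n)))
    (trans (sym (ListP.map-∘ I)) (trans (ListP.map-cong ListP.++-identityʳ I) (ListP.map-id I)))

  ∈-scits⁻ : ∀ (I : Sent a) {S} → S ∈ scits I → S ∈ fillings I (size I) × IsCIT S × IsStandard (size I) S
  ∈-scits⁻ I S∈ =
    let (p , std) = ∈-filter⁻ (isStandard? (size I)) {xs = filter isCIT? (fillings I (size I))} S∈
        (q , cit) = ∈-filter⁻ isCIT? {xs = fillings I (size I)} p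
    in q , cit , std

  -- The tableaux of type U and the coarsened images of the standard tableaux refined by U form two
  -- duplicate-free lists; `to` standardizes and `from` coarsens.
  coeffS-scits : (I : Sent a) (U : List (Word a)) →
    coeffS I U ≡ count (λ S → ⪯? (coA I S) (flat U)) (scits I)
  coeffS-scits I U = trans (length-≡ CITs-unique images-unique to from) (ListP.length-map coarse SCITs)
    where
    monomial? : Decidable (λ T → MonEq (xT I T) (typeMon U))
    monomial? T = monEq? (typeMon U) (xT I T)
    refined? : Decidable (λ S → flat U ⪯ coA I S)
    refined? S = ⪯? (coA I S) (flat U)
    coarse : Filling → Filling
    coarse = map (map (block U))
    CITs SCITs : List Filling
    CITs  = filter monomial? (filter isCIT? (fillings I (length U)))
    SCITs = filter refined? (scits I)

    CITs-unique : Unique CITs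
    CITs-unique = UniqueP.filter⁺ monomial? (UniqueP.filter⁺ isCIT? (fillings-unique I (length U)))

    SCITs-unique : Unique SCITs
    SCITs-unique = UniqueP.filter⁺ refined? (UniqueP.filter⁺ (isStandard? (size I))
      (UniqueP.filter⁺ isCIT? (fillings-unique I (size I))))

    properties : ∀ {S} → S ∈ SCITs → Shaped I S × IsCIT S × Compatible I S U
    properties {S} S∈ with ∈-filter⁻ refined? {xs = scits I} S∈
    ... | p , ref with ∈-scits⁻ I p
    ... | q , cit , std with ∈-fillings⁻ I q
    ... | sh , bound = sh , cit , ⪯⇒compatible {I = I} {S = S} sh {U = U} bound cit std ref

    images-unique : Unique (map coarse SCITs)
    images-unique = unique-map coarse (λ {S} {S′} S∈ S′∈ →
      let (sh , _ , comp) = properties S∈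
          (sh′ , _ , comp′) = properties S′∈
      in compatible-injective {I = I} {S = S} {S′ = S′} {U = U} sh sh′ comp comp′) SCITs-unique

    to : ∀ {T} → T ∈ CITs → T ∈ map coarse SCITs
    to {T} T∈ with ∈-filter⁻ monomial? {xs = filter isCIT? (fillings I (length U))} T∈
    ... | p , mon with ∈-filter⁻ isCIT? {xs = fillings I (length U)} p
    ... | q , cit with ∈-fillings⁻ I q
    ... | sh , bound with standardization {I = I} {T = T} {U = U} sh (All.map proj₁ bound) (type-monomial⁻ U sh mon)
    ... | S , refl , comp = ∈-map⁺ coarse (∈-filter⁺ refined? (∈-filter⁺ (isStandard? (size I)) (∈-filter⁺ isCIT?
      (∈-fillings⁺ shS (subst (λ n → All (λ e → 1 ≤ e × e ≤ n) (readingWord S)) (sym (compatible-size {I = I} {S = S} {U = U} shS comp))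
        (compatible-bound {I = I} {S = S} {U = U} shS comp)))
      (CIT-map⁻ U {S} (compatible-sorted {I = I} {S = S} {U = U} shS comp) cit))
      (proj₁ (compatible⇒⪯ {I = I} {S = S} shS {U = U} comp))) (proj₂ (compatible⇒⪯ {I = I} {S = S} shS {U = U} comp)))
      where
      shS : Shaped I S
      shS = shaped-map⁻ (block U) S sh

    from : ∀ {T} → T ∈ map coarse SCITs → T ∈ CITs
    from T∈ with ∈-map⁻ coarse T∈
    ... | S , S∈ , refl with properties S∈
    ... | sh , cit , comp = ∈-filter⁺ monomial? (∈-filter⁺ isCIT?
      (∈-fillings⁺ {m = length U} (shaped-map⁺ (block U) sh) (subst (All (λ e → 1 ≤ e × e ≤ length U)) (sym (readingWord-map (block U) S))
        (AllP.map⁺ (All.map in-range (compatible-bound {I = I} {S = S} {U = U} sh comp)))))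
      (CIT-map⁺ U {S} (compatible-sorted {I = I} {S = S} {U = U} sh comp) cit))
      (type-monomial⁺ U (shaped-map⁺ (block U) sh) (compatible-type {I = I} {S = S} {U = U} comp))
      where
      in-range : ∀ {e} → 1 ≤ e × e ≤ length (concat U) → 1 ≤ block U e × block U e ≤ length U
      in-range {suc s} (_ , l) = s≤s z≤n , blk-bound U s l

  coA-∈ : ∀ {I : Sent a} {S} → S ∈ scits I → coA I S ∈ sentencesOf a (size I)
  coA-∈ {I} {S} S∈ with ∈-scits⁻ I S∈
  ... | p , _ , std with ∈-fillings⁻ I p
  ... | sh , _ = coA-vertex {I = I} {S = S} sh (standard-single {I = I} {S = S} sh std)

  -- Each standard tableau S contributes the coefficient of F at `coA I S`; collecting the tableaux
  -- with the same value J of `coA` produces the factor L I J.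
  coeffS-expansion : (I : Sent a) (U : List (Word a)) →
    ℤ.+ coeffS I U ≡ ∑ (sentencesOf a (size I)) (λ J → ℤ.+ L I J *ᶻ ℤ.+ coeffF J U)
  coeffS-expansion I U = begin
    ℤ.+ coeffS I U
      ≡⟨ cong ℤ.+_ (coeffS-scits I U) ⟩
    ℤ.+ count (λ S → ⪯? (coA I S) (flat U)) (scits I)
      ≡⟨ count-∑ (λ S → ⪯? (coA I S) (flat U)) (scits I) ⟩
    ∑ (scits I) (λ S → 𝟙 (⪯? (coA I S) (flat U)))
      -- The indicator of refinement is a coefficient of F, spread over all J by an indicator of
      -- `coA I S ≡ J`.
      ≡⟨ ∑-cong (scits I) (λ S S∈ → trans (sym (coeffF-flat (coA I S) U)) (sym (select S S∈))) ⟩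
    ∑ (scits I) (λ S → ∑ V (λ J → 𝟙 (sent-≟ (coA I S) J) *ᶻ ℤ.+ coeffF J U))
      ≡⟨ ∑-comm (scits I) V (λ S J → 𝟙 (sent-≟ (coA I S) J) *ᶻ ℤ.+ coeffF J U) ⟩
    ∑ V (λ J → ∑ (scits I) (λ S → 𝟙 (sent-≟ (coA I S) J) *ᶻ ℤ.+ coeffF J U))
      ≡⟨ ∑-cong V (λ J _ → trans (∑-*ʳ (scits I) (ℤ.+ coeffF J U) (λ S → 𝟙 (sent-≟ (coA I S) J)))
           (cong (_*ᶻ ℤ.+ coeffF J U) (sym (count-∑ (λ S → sent-≟ (coA I S) J) (scits I))))) ⟩
    ∑ V (λ J → ℤ.+ L I J *ᶻ ℤ.+ coeffF J U)  ∎
    where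
    open ≡-Reasoning
    V : List (Sent a)
    V = sentencesOf a (size I)
    select : ∀ S → S ∈ scits I →
      ∑ V (λ J → 𝟙 (sent-≟ (coA I S) J) *ᶻ ℤ.+ coeffF J U) ≡ ℤ.+ coeffF (coA I S) U
    select S S∈ = trans
      (∑-single (λ J → 𝟙 (sent-≟ (coA I S) J) *ᶻ ℤ.+ coeffF J U) (sentencesOf-unique (size I)) (coA-∈ {I} {S} S∈)
        (λ J _ J≢ → trans (cong (_*ᶻ ℤ.+ coeffF J U) (𝟙-no (sent-≟ (coA I S) J) (J≢ ∘ sym)))
          (ℤP.*-zeroˡ (ℤ.+ coeffF J U))))
      (trans (cong (_*ᶻ ℤ.+ coeffF (coA I S) U) (𝟙-yes (sent-≟ (coA I S) (coA I S)) refl))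
        (ℤP.*-identityˡ (ℤ.+ coeffF (coA I S) U)))

  -- A standard tableau with `coA` equal to J is counted in the coefficient at x_J, because J
  -- refines itself. So there is a tableau of shape I and type J, to which the comparison of row
  -- lengths applies.
  L-triangular : ∀ {I J : Sent a} → IsSentence I → IsSentence J → L I J ≢ 0 → J ≡ I ⊎ J ⊏ I
  L-triangular {I} {J} s s′ L≢0 with count-witness (λ S → sent-≟ (coA I S) J) (scits I) L≢0
  ... | S , S∈ , refl = coeffS-triangular s s′ λ z →
    count-positive (λ S → ⪯? (coA I S) (flat J)) S∈
      (subst (_⪯ J) (sym (flat-id s′)) (⪯-refl J))
      (trans (sym (coeffS-scits I J)) z)

  -- Take the coefficient at x_I in the expansion of S*_I; it is 1. A term with J different from I
  -- vanishes: either L I J is zero, or J has lexicographically smaller word lengths and is not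
  -- refined by I.
  L-diagonal : ∀ {I : Sent a} → IsSentence I → L I I ≡ 1
  L-diagonal {I} s = ℤP.+-injective (begin
    ℤ.+ L I I
      ≡⟨ ℤP.*-identityʳ (ℤ.+ L I I) ⟨
    ℤ.+ L I I *ᶻ 1ℤ
      ≡⟨ cong (ℤ.+ L I I *ᶻ_) (trans (coeffF-flat I I) (𝟙-yes (⪯? I (flat I)) (subst (_⪯ I) (sym (flat-id s)) (⪯-refl I)))) ⟨
    ℤ.+ L I I *ᶻ ℤ.+ coeffF I I
      ≡⟨ ∑-single (λ J → ℤ.+ L I J *ᶻ ℤ.+ coeffF J I) (sentencesOf-unique (size I)) (∈-sentencesOf⁺ {I = I} s)
           (λ J J∈ J≢I → off-diagonal J (proj₁ (∈-sentencesOf⁻ (size I) J∈)) J≢I (L I J ℕP.≟ 0)) ⟨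
    ∑ (sentencesOf a (size I)) (λ J → ℤ.+ L I J *ᶻ ℤ.+ coeffF J I)
      ≡⟨ coeffS-expansion I I ⟨
    ℤ.+ coeffS I I
      ≡⟨ cong ℤ.+_ (coeffS-diagonal s) ⟩
    1ℤ  ∎)
    where
    open ≡-Reasoning
    off-diagonal : ∀ J → IsSentence J → J ≢ I → Dec (L I J ≡ 0) → ℤ.+ L I J *ᶻ ℤ.+ coeffF J I ≡ 0ℤ
    off-diagonal J s′ J≢I (yes L≡0) = trans (cong (λ l → ℤ.+ l *ᶻ ℤ.+ coeffF J I) L≡0) (ℤP.*-zeroˡ (ℤ.+ coeffF J I))
    off-diagonal J s′ J≢I (no L≢0) with L-triangular s s′ L≢0
    ... | inj₁ J≡I = contradiction J≡I J≢I
    ... | inj₂ J⊏I = trans (cong (ℤ.+ L I J *ᶻ_) (trans (coeffF-flat J I)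
            (𝟙-no (⪯? J (flat I)) (λ r → coarsening-⋢ s (subst (_⪯ J) (flat-id s) r) J⊏I))))
          (ℤP.*-zeroʳ (ℤ.+ L I J))

theorem4p29 : (a n : ℕ) (I : Sent a) → IsSentence I → size I ≡ n →
    (U : List (Word a)) →
    ℤ.+ (coeffF I U)
    ≡ sumℤ (map (λ K → Linv n I K ℤ.* ℤ.+ (coeffS K U))
    (filter (reachable? n I) (sentencesOf a n)))
-- With U fixed, F and S* are the vectors of their coefficients at x_U.
theorem4p29 a n I s refl U = inversion (λ J → ℤ.+ coeffF J U) (λ J → ℤ.+ coeffS J U) expansion (∈-sentencesOf⁺ s)
  where
  sentence : ∀ {J} → J ∈ sentencesOf a n → IsSentence J
  sentence J∈ = proj₁ (∈-sentencesOf⁻ n J∈)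
  edge-⊏ : ∀ {I J} → I ∈ sentencesOf a n → J ∈ sentencesOf a n → Edge I J → J ⊏ I
  edge-⊏ I∈ J∈ (J≢I , L≢0) with L-triangular (sentence I∈) (sentence J∈) L≢0
  ... | inj₁ J≡I = contradiction J≡I J≢I
  ... | inj₂ J⊏I = J⊏I
  open Inversion n _⊏_ ⊏-irrefl ⊏-trans (λ I∈ → L-diagonal (sentence I∈)) edge-⊏
  expansion : ∀ {J} → J ∈ sentencesOf a n → ℤ.+ coeffS J U ≡ ∑ (sentencesOf a n) (λ K → ℤ.+ L J K *ᶻ ℤ.+ coeffF K U)
  expansion {J} J∈ = subst (λ m → ℤ.+ coeffS J U ≡ ∑ (sentencesOf a m) (λ K → ℤ.+ L J K *ᶻ ℤ.+ coeffF K U))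
    (proj₂ (∈-sentencesOf⁻ n J∈)) (coeffS-expansion J U)
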